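{- Let $a, r \ge 1$ and $b \ge \max\{a, 2r+2\}$ be integers. Let $G$ be a connected graph of order $n \geq (r+1)(b-r)+2a^2+2a(r+2)-1$. If $\lambda(G) \geq \lambda(H_{n}^{a,r})$, where $H_{n}^{a,r}=rK_1\vee \big(K_{a-1}\vee (K_{n-a-r}\cup K_1)\big)$, then $G$ is fractional $ID$-$[a,b]$-factor-critical (with respect to $r$) unless $G \cong H_{n}^{a,r}$.
   Context: All graphs are finite, simple and undirected. $\lambda(G)$ denotes the largest eigenvalue of the adjacency matrix of $G$. $K_m$ is the complete graph on $m$ vertices ($K_0$ is the empty graph), $mK_1$ is the edgeless graph on $m$ vertices, $G_1\cup G_2$ is disjoint union, and the join $G_1\vee G_2$ is obtained from $G_1\cup G_2$ by adding all edges between $V(G_1)$ and $V(G_2)$. For positive integers $a\le b$, a graph $G$ has a fractional $[a,b]$-factor if there is a function $h: E(G)\to[0,1]$ such that $a\le \sum_{e\ni v} h(e)\le b$ for every $v\in V(G)$ (the sum is over edges incident with $v$). For an integer $r\ge 1$, $G$ is fractional $ID$-$[a,b]$-factor-critical (with respect to $r$) if for every independent set $I$ of $G$ with $|I|=r$, the graph $G-I$ has a fractional $[a,b]$-factor. -}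

module Defs where

open import Algebra.Bundles.Raw using (RawMonoid)
import Algebra.Definitions.RawMonoid as RawMonoidDefs
open import Data.Bool.Base using (Bool; true; false; if_then_else_; not)
open import Data.Fin.Base using (Fin; zero; suc; splitAt)
open import Data.Fin.Properties using (_≟_)
open import Data.Fin.Subset using (Subset; _∈_; ∁; ∣_∣)
import Data.Integer.Base as ℤ
open import Data.Nat.Base as ℕ using (ℕ; _∸_)
import Data.Nat.Properties as ℕ
open import Data.Product.Base using (Σ-syntax; ∃-syntax; _×_; _,_)
open import Data.Rational.Base as ℚ using (ℚ; 0ℚ; 1ℚ; ½)
import Data.Rational.Properties as ℚ
open import Data.Rational.Solver using (module +-*-Solver)
open import Data.Sum.Base using (_⊎_; inj₁; inj₂)
open import Data.Vec.Base using (_∷_)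
open import Data.Vec.Functional using (Vector)
open import Function.Bundles using (_↔_; module Inverse)
open import Level using (0ℓ)
open import Relation.Binary.Construct.Closure.ReflexiveTransitive using (Star)
open import Relation.Binary.PropositionalEquality
  using (_≡_; refl; sym; cong; cong₂; subst)
open import Relation.Nullary using (¬_; yes; no; does; contradiction)

------------------------------------------------------------------------
-- Real numbers

-- Reals are Cauchy sequences of rationals, taken up to the setoid
-- equality _≃_ below.  The type Σ makes the modulus part of the data.

IsCauchy : (ℕ → ℚ) → Set
IsCauchy s = ∀ ε → 0ℚ ℚ.< ε →
  ∃[ N ] (∀ m n → N ℕ.≤ m → N ℕ.≤ n → ℚ.∣ s m ℚ.- s n ∣ ℚ.≤ ε)

record ℝ : Set where
  constructor mkℝ
  field
    seq    : ℕ → ℚ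
    cauchy : IsCauchy seq

open ℝ public

infix 4 _≃_ _≤ᴿ_

_≃_ : ℝ → ℝ → Set
x ≃ y = ∀ ε → 0ℚ ℚ.< ε →
  ∃[ N ] (∀ n → N ℕ.≤ n → ℚ.∣ seq x n ℚ.- seq y n ∣ ℚ.≤ ε)

_≤ᴿ_ : ℝ → ℝ → Set
x ≤ᴿ y = ∀ ε → 0ℚ ℚ.< ε →
  ∃[ N ] (∀ n → N ℕ.≤ n → seq x n ℚ.≤ seq y n ℚ.+ ε)

fromℚ : ℚ → ℝ
fromℚ q = mkℝ (λ _ → q) λ ε 0<ε → 0 , λ _ _ _ _ →
  subst (ℚ._≤ ε) (cong ℚ.∣_∣ (sym (ℚ.+-inverseʳ q))) (ℚ.<⇒≤ 0<ε)

fromℕ : ℕ → ℝ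
fromℕ k = fromℚ (ℤ.+ k ℚ./ 1)

0ᴿ 1ᴿ : ℝ
0ᴿ = fromℚ 0ℚ
1ᴿ = fromℚ 1ℚ

private
  half-pos : ∀ ε → 0ℚ ℚ.< ε → 0ℚ ℚ.< ε ℚ.* ½
  half-pos ε 0<ε = ℚ.*-monoˡ-<-pos ½ 0<ε

  half+half : ∀ ε → ε ℚ.* ½ ℚ.+ ε ℚ.* ½ ≡ ε
  half+half ε = begin
    ε ℚ.* ½ ℚ.+ ε ℚ.* ½  ≡⟨ ℚ.*-distribˡ-+ ε ½ ½ ⟨
    ε ℚ.* (½ ℚ.+ ½)      ≡⟨ ℚ.*-identityʳ ε ⟩
    ε                    ∎
    where open Relation.Binary.PropositionalEquality.≡-Reasoning

  +-cauchy : ∀ {s t} → IsCauchy s → IsCauchy t → IsCauchy (λ n → s n ℚ.+ t n)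
  +-cauchy {s} {t} cs ct ε 0<ε
    with M , p ← cs (ε ℚ.* ½) (half-pos ε 0<ε)
       | N , q ← ct (ε ℚ.* ½) (half-pos ε 0<ε)
    = M ℕ.⊔ N , λ m n M⊔N≤m M⊔N≤n → begin
      ℚ.∣ (s m ℚ.+ t m) ℚ.- (s n ℚ.+ t n) ∣
        ≡⟨ cong ℚ.∣_∣ (rearrange (s m) (t m) (s n) (t n)) ⟩
      ℚ.∣ (s m ℚ.- s n) ℚ.+ (t m ℚ.- t n) ∣
        ≤⟨ ℚ.∣p+q∣≤∣p∣+∣q∣ (s m ℚ.- s n) (t m ℚ.- t n) ⟩
      ℚ.∣ s m ℚ.- s n ∣ ℚ.+ ℚ.∣ t m ℚ.- t n ∣
        ≤⟨ ℚ.+-mono-≤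
             (p m n (ℕ.m⊔n≤o⇒m≤o M N M⊔N≤m) (ℕ.m⊔n≤o⇒m≤o M N M⊔N≤n))
             (q m n (ℕ.m⊔n≤o⇒n≤o M N M⊔N≤m) (ℕ.m⊔n≤o⇒n≤o M N M⊔N≤n)) ⟩
      ε ℚ.* ½ ℚ.+ ε ℚ.* ½
        ≡⟨ half+half ε ⟩
      ε ∎
    where
    open ℚ.≤-Reasoning
    open +-*-Solver
    rearrange : ∀ a b c d → (a ℚ.+ b) ℚ.- (c ℚ.+ d) ≡ (a ℚ.- c) ℚ.+ (b ℚ.- d)
    rearrange = solve 4 (λ a b c d →
      (a :+ b) :- (c :+ d) := (a :- c) :+ (b :- d)) refl

  bounded : ∀ {s} → IsCauchy s →
    Σ[ B ∈ ℚ ] 0ℚ ℚ.< B × ∃[ N ] (∀ n → N ℕ.≤ n → ℚ.∣ s n ∣ ℚ.≤ B)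
  bounded {s} cs with N , p ← cs 1ℚ (ℚ.positive⁻¹ 1ℚ)
    = 1ℚ ℚ.+ ℚ.∣ s N ∣
    , ℚ.+-mono-<-≤ (ℚ.positive⁻¹ 1ℚ) (ℚ.0≤∣p∣ (s N))
    , N , λ n N≤n → begin
      ℚ.∣ s n ∣                            ≡⟨ cong ℚ.∣_∣ (split (s n) (s N)) ⟩
      ℚ.∣ (s n ℚ.- s N) ℚ.+ s N ∣          ≤⟨ ℚ.∣p+q∣≤∣p∣+∣q∣ (s n ℚ.- s N) (s N) ⟩
      ℚ.∣ s n ℚ.- s N ∣ ℚ.+ ℚ.∣ s N ∣      ≤⟨ ℚ.+-monoˡ-≤ ℚ.∣ s N ∣ (p n N N≤n ℕ.≤-refl) ⟩
      1ℚ ℚ.+ ℚ.∣ s N ∣                     ∎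
    where
    open ℚ.≤-Reasoning
    open +-*-Solver
    split : ∀ a b → a ≡ (a ℚ.- b) ℚ.+ b
    split = solve 2 (λ a b → a := (a :- b) :+ b) refl

  *-mono-∣∣ : ∀ {x y B δ} → 0ℚ ℚ.< B → ℚ.∣ x ∣ ℚ.≤ B → ℚ.∣ y ∣ ℚ.≤ δ →
              ℚ.∣ x ℚ.* y ∣ ℚ.≤ B ℚ.* δ
  *-mono-∣∣ {x} {y} {B} {δ} 0<B x≤B y≤δ = begin
    ℚ.∣ x ℚ.* y ∣          ≡⟨ ℚ.∣p*q∣≡∣p∣*∣q∣ x y ⟩
    ℚ.∣ x ∣ ℚ.* ℚ.∣ y ∣    ≤⟨ ℚ.*-monoʳ-≤-nonNeg ℚ.∣ y ∣ {{ℚ.∣-∣-nonNeg y}} x≤B ⟩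
    B ℚ.* ℚ.∣ y ∣          ≤⟨ ℚ.*-monoˡ-≤-nonNeg B {{ℚ.nonNegative (ℚ.<⇒≤ 0<B)}} y≤δ ⟩
    B ℚ.* δ                ∎
    where open ℚ.≤-Reasoning

  divide : ∀ B ε → 0ℚ ℚ.< B → 0ℚ ℚ.< ε → Σ[ δ ∈ ℚ ] 0ℚ ℚ.< δ × B ℚ.* δ ≡ ε
  divide B ε 0<B 0<ε = B⁻¹ ℚ.* ε , 0<δ , B*δ≡ε
    where
    instance
      B-pos : ℚ.Positive B
      B-pos = ℚ.positive 0<B
      B-nonZero : ℚ.NonZero B
      B-nonZero = ℚ.pos⇒nonZero B

    B⁻¹ : ℚ
    B⁻¹ = ℚ.1/ B

    0<δ : 0ℚ ℚ.< B⁻¹ ℚ.* ε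
    0<δ = subst (ℚ._< B⁻¹ ℚ.* ε) (ℚ.*-zeroʳ B⁻¹)
      (ℚ.*-monoʳ-<-pos B⁻¹ {{ℚ.1/pos⇒pos B}} 0<ε)

    B*δ≡ε : B ℚ.* (B⁻¹ ℚ.* ε) ≡ ε
    B*δ≡ε = begin
      B ℚ.* (B⁻¹ ℚ.* ε)    ≡⟨ ℚ.*-assoc B B⁻¹ ε ⟨
      (B ℚ.* B⁻¹) ℚ.* ε    ≡⟨ cong (ℚ._* ε) (ℚ.*-inverseʳ B) ⟩
      1ℚ ℚ.* ε             ≡⟨ ℚ.*-identityˡ ε ⟩
      ε                    ∎
      where open Relation.Binary.PropositionalEquality.≡-Reasoning

  *-cauchy : ∀ {s t} → IsCauchy s → IsCauchy t → IsCauchy (λ n → s n ℚ.* t n)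
  *-cauchy {s} {t} cs ct ε 0<ε =
    let B , 0<B , K , s≤B = bounded {s} cs
        C , 0<C , L , t≤C = bounded {t} ct
        δ , 0<δ , total   = divide (B ℚ.+ C) ε (ℚ.+-mono-< 0<B 0<C) 0<ε
        M , p             = cs δ 0<δ
        N , q             = ct δ 0<δ
    in (K ℕ.⊔ L) ℕ.⊔ (M ℕ.⊔ N) , λ m n P≤m P≤n →
      let KL≤m = ℕ.m⊔n≤o⇒m≤o (K ℕ.⊔ L) (M ℕ.⊔ N) P≤m
          KL≤n = ℕ.m⊔n≤o⇒m≤o (K ℕ.⊔ L) (M ℕ.⊔ N) P≤n
          MN≤m = ℕ.m⊔n≤o⇒n≤o (K ℕ.⊔ L) (M ℕ.⊔ N) P≤m
          MN≤n = ℕ.m⊔n≤o⇒n≤o (K ℕ.⊔ L) (M ℕ.⊔ N) P≤n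
      in estimate B C δ {s m} {t m} {s n} {t n} 0<B 0<C total
           (s≤B m (ℕ.m⊔n≤o⇒m≤o K L KL≤m))
           (t≤C n (ℕ.m⊔n≤o⇒n≤o K L KL≤n))
           (p m n (ℕ.m⊔n≤o⇒m≤o M N MN≤m) (ℕ.m⊔n≤o⇒m≤o M N MN≤n))
           (q m n (ℕ.m⊔n≤o⇒n≤o M N MN≤m) (ℕ.m⊔n≤o⇒n≤o M N MN≤n))
    where
    rearrange : ∀ a b c d →
      (a ℚ.* b) ℚ.- (c ℚ.* d) ≡ a ℚ.* (b ℚ.- d) ℚ.+ d ℚ.* (a ℚ.- c)
    rearrange = solve 4 (λ a b c d →
      (a :* b) :- (c :* d) := a :* (b :- d) :+ d :* (a :- c)) refl
      where open +-*-Solver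

    estimate : ∀ B C δ {a b c d} → 0ℚ ℚ.< B → 0ℚ ℚ.< C → (B ℚ.+ C) ℚ.* δ ≡ ε →
      ℚ.∣ a ∣ ℚ.≤ B → ℚ.∣ d ∣ ℚ.≤ C → ℚ.∣ a ℚ.- c ∣ ℚ.≤ δ → ℚ.∣ b ℚ.- d ∣ ℚ.≤ δ →
      ℚ.∣ a ℚ.* b ℚ.- c ℚ.* d ∣ ℚ.≤ ε
    estimate B C δ {a} {b} {c} {d} 0<B 0<C total a≤B d≤C a-c≤δ b-d≤δ = begin
      ℚ.∣ a ℚ.* b ℚ.- c ℚ.* d ∣
        ≡⟨ cong ℚ.∣_∣ (rearrange a b c d) ⟩
      ℚ.∣ a ℚ.* (b ℚ.- d) ℚ.+ d ℚ.* (a ℚ.- c) ∣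
        ≤⟨ ℚ.∣p+q∣≤∣p∣+∣q∣ (a ℚ.* (b ℚ.- d)) (d ℚ.* (a ℚ.- c)) ⟩
      ℚ.∣ a ℚ.* (b ℚ.- d) ∣ ℚ.+ ℚ.∣ d ℚ.* (a ℚ.- c) ∣
        ≤⟨ ℚ.+-mono-≤ (*-mono-∣∣ {a} {b ℚ.- d} {B} {δ} 0<B a≤B b-d≤δ)
                       (*-mono-∣∣ {d} {a ℚ.- c} {C} {δ} 0<C d≤C a-c≤δ) ⟩
      B ℚ.* δ ℚ.+ C ℚ.* δ
        ≡⟨ ℚ.*-distribʳ-+ δ B C ⟨
      (B ℚ.+ C) ℚ.* δ
        ≡⟨ total ⟩
      ε ∎
      where open ℚ.≤-Reasoning

infixl 6 _+ᴿ_
infixl 7 _*ᴿ_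

_+ᴿ_ : ℝ → ℝ → ℝ
x +ᴿ y = mkℝ (λ n → seq x n ℚ.+ seq y n) (+-cauchy {seq x} {seq y} (cauchy x) (cauchy y))

_*ᴿ_ : ℝ → ℝ → ℝ
x *ᴿ y = mkℝ (λ n → seq x n ℚ.* seq y n) (*-cauchy {seq x} {seq y} (cauchy x) (cauchy y))

+-0-rawMonoidᴿ : RawMonoid 0ℓ 0ℓ
+-0-rawMonoidᴿ = record { Carrier = ℝ ; _≈_ = _≃_ ; _∙_ = _+ᴿ_ ; ε = 0ᴿ }

open RawMonoidDefs +-0-rawMonoidᴿ public using (sum)

------------------------------------------------------------------------
-- Eigenvalues

Matrix : ℕ → Set
Matrix n = Fin n → Fin n → ℝ

IsEigenvalue : ∀ {n} → Matrix n → ℝ → Set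
IsEigenvalue {n} A μ = Σ[ x ∈ Vector ℝ n ]
  ¬ (∀ i → x i ≃ 0ᴿ) ×
  (∀ i → sum (λ j → A i j *ᴿ x j) ≃ μ *ᴿ x i)

-- For symmetric A every eigenvalue is real, so only real ones are compared.
IsLargestEigenvalue : ∀ {n} → Matrix n → ℝ → Set
IsLargestEigenvalue A ρ =
  IsEigenvalue A ρ × (∀ μ → IsEigenvalue A μ → μ ≤ᴿ ρ)

------------------------------------------------------------------------
-- Graphs

record Graph (n : ℕ) : Set where
  field
    adj    : Fin n → Fin n → Bool
    symm   : ∀ u v → adj u v ≡ adj v u
    irrefl : ∀ v → adj v v ≡ false

open Graph public

Adjacent : ∀ {n} → Graph n → Fin n → Fin n → Set
Adjacent G u v = adj G u v ≡ true

adjacencyMatrix : ∀ {n} → Graph n → Matrix n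
adjacencyMatrix G u v = if adj G u v then 1ᴿ else 0ᴿ

-- λ(G) ≃ ρ; a relation, since reals are only determined up to _≃_.
IsSpectralRadius : ∀ {n} → Graph n → ℝ → Set
IsSpectralRadius G = IsLargestEigenvalue (adjacencyMatrix G)

Connected : ∀ {n} → Graph n → Set
Connected G = ∀ u v → Star (Adjacent G) u v

infix 4 _≅_

_≅_ : ∀ {m n} → Graph m → Graph n → Set
_≅_ {m} {n} G H = Σ[ f ∈ Fin m ↔ Fin n ]
  (∀ u v → adj H (Inverse.to f u) (Inverse.to f v) ≡ adj G u v)

complete : ∀ n → Graph n
complete n = record
  { adj    = λ u v → not (does (u ≟ v))
  ; symm   = λ u v → cong not (does-sym u v)
  ; irrefl = λ v → cong not (does-refl v)
  }
  where
  does-sym : ∀ (u v : Fin n) → does (u ≟ v) ≡ does (v ≟ u)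
  does-sym u v with u ≟ v | v ≟ u
  ... | yes _   | yes _   = refl
  ... | no _    | no _    = refl
  ... | yes u≡v | no v≢u  = contradiction (sym u≡v) v≢u
  ... | no u≢v  | yes v≡u = contradiction (sym v≡u) u≢v

  does-refl : ∀ (v : Fin n) → does (v ≟ v) ≡ true
  does-refl v with v ≟ v
  ... | yes _  = refl
  ... | no v≢v = contradiction refl v≢v

edgeless : ∀ n → Graph n
edgeless n = record
  { adj = λ _ _ → false ; symm = λ _ _ → refl ; irrefl = λ _ → refl }

-- G₁ and G₂ side by side; `cross` says whether all or none of the pairs
-- between the two vertex sets are edges.
module _ {m n} (cross : Bool) (G₁ : Graph m) (G₂ : Graph n) where

  adj⊎ : Fin m ⊎ Fin n → Fin m ⊎ Fin n → Bool
  adj⊎ (inj₁ u) (inj₁ v) = adj G₁ u v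
  adj⊎ (inj₂ u) (inj₂ v) = adj G₂ u v
  adj⊎ (inj₁ _) (inj₂ _) = cross
  adj⊎ (inj₂ _) (inj₁ _) = cross

  symm⊎ : ∀ u v → adj⊎ u v ≡ adj⊎ v u
  symm⊎ (inj₁ u) (inj₁ v) = symm G₁ u v
  symm⊎ (inj₂ u) (inj₂ v) = symm G₂ u v
  symm⊎ (inj₁ _) (inj₂ _) = refl
  symm⊎ (inj₂ _) (inj₁ _) = refl

  irrefl⊎ : ∀ v → adj⊎ v v ≡ false
  irrefl⊎ (inj₁ v) = irrefl G₁ v
  irrefl⊎ (inj₂ v) = irrefl G₂ v

  combine : Graph (m ℕ.+ n)
  combine = record
    { adj    = λ u v → adj⊎ (splitAt m u) (splitAt m v)
    ; symm   = λ u v → symm⊎ (splitAt m u) (splitAt m v)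
    ; irrefl = λ v → irrefl⊎ (splitAt m v)
    }

infixr 6 _∪ᴳ_ _∨ᴳ_

_∪ᴳ_ : ∀ {m n} → Graph m → Graph n → Graph (m ℕ.+ n)
_∪ᴳ_ = combine false

_∨ᴳ_ : ∀ {m n} → Graph m → Graph n → Graph (m ℕ.+ n)
_∨ᴳ_ = combine true

-- embed p enumerates the elements of p in increasing order.
embed : ∀ {n} (p : Subset n) → Fin ∣ p ∣ → Fin n
embed (true  ∷ p) zero    = zero
embed (true  ∷ p) (suc i) = suc (embed p i)
embed (false ∷ p) i       = suc (embed p i)

induced : ∀ {n} → Graph n → (p : Subset n) → Graph ∣ p ∣
induced G p = record
  { adj    = λ i j → adj G (embed p i) (embed p j)
  ; symm   = λ i j → symm G (embed p i) (embed p j)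
  ; irrefl = λ i → irrefl G (embed p i)
  }

infixl 6 _-ᴳ_

_-ᴳ_ : ∀ {n} → Graph n → (I : Subset n) → Graph ∣ ∁ I ∣
G -ᴳ I = induced G (∁ I)

Independent : ∀ {n} → Graph n → Subset n → Set
Independent G I = ∀ u v → u ∈ I → v ∈ I → ¬ Adjacent G u v

weightedDegree : ∀ {n} → Graph n → (Fin n → Fin n → ℝ) → Fin n → ℝ
weightedDegree G h v = sum (λ u → if adj G v u then h v u else 0ᴿ)

-- A function on the (undirected) edges is a function on ordered pairs of
-- vertices, symmetric on adjacent pairs; its other values are ignored.
HasFractionalFactor : ∀ {n} → Graph n → (a b : ℕ) → Set
HasFractionalFactor {n} G a b = Σ[ h ∈ (Fin n → Fin n → ℝ) ]
  (∀ u v → Adjacent G u v → h u v ≃ h v u) ×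
  (∀ u v → Adjacent G u v → 0ᴿ ≤ᴿ h u v × h u v ≤ᴿ 1ᴿ) ×
  (∀ v → fromℕ a ≤ᴿ weightedDegree G h v × weightedDegree G h v ≤ᴿ fromℕ b)

IsFractionalIDFactorCritical : ∀ {n} → Graph n → (r a b : ℕ) → Set
IsFractionalIDFactorCritical G r a b =
  ∀ I → Independent G I → ∣ I ∣ ≡ r → HasFractionalFactor (G -ᴳ I) a b

-- The order is n, up to a propositional equality, when 1 ≤ a and a + r ≤ n;
-- truncated subtraction is then exact.
extremal : ∀ n a r →
  Graph (r ℕ.+ ((a ∸ 1) ℕ.+ ((n ∸ a ∸ r) ℕ.+ 1)))
extremal n a r =
  edgeless r ∨ᴳ (complete (a ∸ 1) ∨ᴳ (complete (n ∸ a ∸ r) ∪ᴳ complete 1))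

{-# OPTIONS --safe #-}
module Submission where

-- Suppose G - I has no fractional [a,b]-factor.  Then it has no a-regular one,
-- so by the cut criterion for bipartite factors, applied to the adjacency
-- matrix of G - I, there are vertex sets X and Y avoiding I with
-- e(X,Y) < a (|X| + |Y| - |G - I|); by symmetry |X| ≤ |Y|.
--
-- If |X| = 1, some vertex has fewer than a neighbours outside I, and G is a
-- spanning subgraph of H.  Weighting the eigenvalue inequality for G with a
-- positive eigenvector of H shows that a proper connected spanning subgraph
-- of H has a smaller spectral radius.
--
-- If |X| ≥ 2, too many edges are missing: λ(G)² is at most the largest row
-- sum of A², hence at most 2e(G) - n + 1, while the quotient matrix of H gives
-- λ(H)² ≥ (n - r - 2) λ(H) + r (n - r - 1) and λ(H) ≥ n - 3.
--
-- The bound on λ(H) needs an actual eigenvalue, since λ(H) is only given as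
-- an upper bound of the eigenvalues; it is found by bisection.

-- The order on Cauchy reals is undecidable, so the proof avoids Perron vectors of G and Rayleigh
-- quotients. It uses the entrywise absolute value z of an arbitrary eigenvector, which satisfies z
-- ≥ 0 and ρz ≤ Az. Each spectral step pairs this with a nonnegative weight vector and then uses
-- only monotonicity and cancellation. Strict inequalities appear as integer gaps of 1, and
-- positivity of an eigenvector as entries that are at least 1. For H such an eigenvector is
-- explicit: its entries are polynomials in a root of the characteristic equation.
--
-- Fractional factors are reached through integers. A 0/1 matrix F inside the adjacency matrix with
-- all row and column sums a gives the weights (F + Fᵀ)/2, and for 0/1 matrices a violated cut can
-- be searched for. The price is that rows and columns are independent copies of the vertices, so X
-- and Y may overlap; the count of missing edges must correct for X ∩ Y.
--
-- The order bound enters as n - r ≥ r² + 2r + 1 + 2a² + 2ar + 4a, its value for b = 2r + 2.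

-- Finite integer sums and counting by indicators.

module IntegerSums where

  open import Data.Bool.Base using (Bool; true; false; _∧_; not)
  open import Data.Fin.Base using (Fin; zero; suc; punchIn)
  open import Data.Fin.Properties using (_≟_)
  open import Data.Integer.Base hiding (suc)
  open import Data.Integer.Properties hiding (_≟_)
  open import Data.Integer.Tactic.RingSolver using (solve-∀)
  open import Data.Nat.Base as ℕ using (ℕ; zero; suc)
  open import Data.Product.Base using (∃; _,_)
  open import Function.Base using (_∘_)
  open import Relation.Binary.PropositionalEquality
  open import Relation.Nullary

  import Algebra.Properties.Semiring.Sum +-*-semiring as Sum

  opaque
    Σℤ : ∀ {n} → (Fin n → ℤ) → ℤ
    Σℤ = Sum.sum

    Σ-nil : (f : Fin 0 → ℤ) → Σℤ f ≡ 0ℤ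
    Σ-nil _ = refl

    Σ-cons : ∀ {n} (f : Fin (suc n) → ℤ) → Σℤ f ≡ f zero + Σℤ (f ∘ suc)
    Σ-cons _ = refl

    Σ-cong : ∀ {n} {f g : Fin n → ℤ} → f ≗ g → Σℤ f ≡ Σℤ g
    Σ-cong = Sum.sum-cong-≗

    Σ-distrib-+ : ∀ {n} (f g : Fin n → ℤ) → Σℤ (λ i → f i + g i) ≡ Σℤ f + Σℤ g
    Σ-distrib-+ = Sum.∑-distrib-+

    Σ-comm : ∀ {m n} (f : Fin m → Fin n → ℤ) →
             Σℤ (λ i → Σℤ (f i)) ≡ Σℤ (λ j → Σℤ (λ i → f i j))
    Σ-comm = Sum.∑-comm

    Σ-punchIn : ∀ {n} (f : Fin (suc n) → ℤ) i → Σℤ f ≡ f i + Σℤ (f ∘ punchIn i)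
    Σ-punchIn f i = Sum.sum-remove {i = i} f

    Σ-distribˡ-* : ∀ {n} c (f : Fin n → ℤ) → c * Σℤ f ≡ Σℤ (λ i → c * f i)
    Σ-distribˡ-* = Sum.*-distribˡ-sum

    Σ-mono : ∀ {n} {f g : Fin n → ℤ} → (∀ i → f i ≤ g i) → Σℤ f ≤ Σℤ g
    Σ-mono {zero}  f≤g = ≤-refl
    Σ-mono {suc n} f≤g = +-mono-≤ (f≤g zero) (Σ-mono (f≤g ∘ suc))

    Σ-zero : ∀ {n} {f : Fin n → ℤ} → (∀ i → f i ≡ 0ℤ) → Σℤ f ≡ 0ℤ
    Σ-zero {zero}  f≡0 = refl
    Σ-zero {suc n} f≡0 = cong₂ _+_ (f≡0 zero) (Σ-zero (f≡0 ∘ suc))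

    Σ-nonneg : ∀ {n} {f : Fin n → ℤ} → (∀ i → 0ℤ ≤ f i) → 0ℤ ≤ Σℤ f
    Σ-nonneg {zero}  0≤f = ≤-refl
    Σ-nonneg {suc n} 0≤f = +-mono-≤ (0≤f zero) (Σ-nonneg (0≤f ∘ suc))

    Σ-const : ∀ n c → Σℤ {n} (λ _ → c) ≡ + n * c
    Σ-const zero    c = refl
    Σ-const (suc n) c = trans (cong (λ s → c + s) (Σ-const n c)) (sym (suc-* (+ n) c))

  -- Linear arithmetic is done by exhibiting the difference as a sum of
  -- visibly nonnegative terms.
  ≤-by : ∀ {a b} s → 0ℤ ≤ s → b - a ≡ s → a ≤ b
  ≤-by s 0≤s b-a≡s = 0≤i-j⇒j≤i (subst (0ℤ ≤_) (sym b-a≡s) 0≤s)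

  diff : ∀ {a b} → a ≤ b → 0ℤ ≤ b - a
  diff = i≤j⇒0≤j-i

  infixl 6 _⊕_
  infixl 7 _⊛_

  _⊕_ : ∀ {a b} → 0ℤ ≤ a → 0ℤ ≤ b → 0ℤ ≤ a + b
  _⊕_ = +-mono-≤

  _⊛_ : ∀ {a b} → 0ℤ ≤ a → 0ℤ ≤ b → 0ℤ ≤ a * b
  _⊛_ {+ m} {+ n} _ _ = subst (0ℤ ≤_) (pos-* m n) (+≤+ ℕ.z≤n)

  nat : ∀ n → 0ℤ ≤ + n
  nat _ = +≤+ ℕ.z≤n

  square : ∀ a → 0ℤ ≤ a * a
  square (+ n) = nat n ⊛ nat n
  square -[1+ n ] = nat _

  ⟦_⟧ : Bool → ℤ
  ⟦ true  ⟧ = 1ℤ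
  ⟦ false ⟧ = 0ℤ

  ⟦⟧≥0 : ∀ b → 0ℤ ≤ ⟦ b ⟧
  ⟦⟧≥0 true  = nat 1
  ⟦⟧≥0 false = nat 0

  ⟦⟧≤1 : ∀ b → ⟦ b ⟧ ≤ 1ℤ
  ⟦⟧≤1 true  = +≤+ (ℕ.s≤s ℕ.z≤n)
  ⟦⟧≤1 false = nat 1

  ⟦∧⟧ : ∀ b c → ⟦ b ∧ c ⟧ ≡ ⟦ b ⟧ * ⟦ c ⟧
  ⟦∧⟧ true  c = sym (*-identityˡ ⟦ c ⟧)
  ⟦∧⟧ false c = refl

  ⟦not⟧ : ∀ b → ⟦ not b ⟧ ≡ 1ℤ - ⟦ b ⟧
  ⟦not⟧ true  = refl
  ⟦not⟧ false = refl

  Σ-distrib-- : ∀ {n} (f g : Fin n → ℤ) → Σℤ (λ i → f i - g i) ≡ Σℤ f - Σℤ g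
  Σ-distrib-- f g = begin
    Σℤ (λ i → f i - g i)              ≡⟨ Σ-cong (λ i → minus (f i) (g i)) ⟩
    Σℤ (λ i → f i + -1ℤ * g i)        ≡⟨ Σ-distrib-+ f (λ i → -1ℤ * g i) ⟩
    Σℤ f + Σℤ (λ i → -1ℤ * g i)       ≡⟨ cong (λ s → Σℤ f + s) (Σ-distribˡ-* -1ℤ g) ⟨
    Σℤ f + -1ℤ * Σℤ g                 ≡⟨ minus (Σℤ f) (Σℤ g) ⟨
    Σℤ f - Σℤ g                       ∎
    where
    open ≡-Reasoning
    minus : ∀ a b → a - b ≡ a + -1ℤ * b
    minus = solve-∀

  δ : ∀ {n} → Fin n → Fin n → Bool
  δ i j = does (i ≟ j)

  δ-refl : ∀ {n} (i : Fin n) → δ i i ≡ true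
  δ-refl i = dec-true (i ≟ i) refl
    where open import Relation.Nullary.Decidable

  δ-≢ : ∀ {n} {i j : Fin n} → i ≢ j → δ i j ≡ false
  δ-≢ {i = i} {j} i≢j = dec-false (i ≟ j) i≢j
    where open import Relation.Nullary.Decidable

  opaque
    unfolding Σℤ

    Σ-δ : ∀ {n} (i : Fin n) (f : Fin n → ℤ) → Σℤ (λ j → ⟦ δ i j ⟧ * f j) ≡ f i
    Σ-δ {suc n} zero    f = trans
      (cong₂ _+_ (*-identityˡ (f zero)) (Σ-zero λ j → *-zeroˡ (f (suc j))))
      (+-identityʳ (f zero))
    Σ-δ {suc n} (suc i) f = trans (+-identityˡ _) (Σ-δ i (f ∘ suc))

  term≤Σ : ∀ {n} {f : Fin n → ℤ} → (∀ i → 0ℤ ≤ f i) → ∀ i → f i ≤ Σℤ f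
  term≤Σ {f = f} 0≤f i = subst (_≤ Σℤ f) (Σ-δ i f) (Σ-mono term)
    where
    term : ∀ j → ⟦ δ i j ⟧ * f j ≤ f j
    term j with δ i j
    ... | true  = ≤-reflexive (*-identityˡ (f j))
    ... | false = 0≤f j

  -- Each difference `g i - f i` is one term of a sum of nonnegative terms whose total is at most 0.
  Σ-≡⇒≗ : ∀ {n} {f g : Fin n → ℤ} → (∀ i → f i ≤ g i) → Σℤ g ≤ Σℤ f →
          ∀ i → f i ≡ g i
  Σ-≡⇒≗ {f = f} {g} f≤g Σg≤Σf i = ≤-antisym (f≤g i)
    (i-j≤0⇒i≤j (≤-trans (term≤Σ {f = λ i → g i - f i} (λ i → diff (f≤g i)) i)
      (subst (_≤ 0ℤ) (sym (Σ-distrib-- g f)) (i≤j⇒i-j≤0 Σg≤Σf))))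

  # : ∀ {n} → (Fin n → Bool) → ℤ
  # P = Σℤ (λ i → ⟦ P i ⟧)

  ∃-of-#>0 : ∀ {n} (P : Fin n → Bool) → 0ℤ < # P → ∃ λ i → P i ≡ true
  ∃-of-#>0 {zero}  P 0<#P with +<+ () ← subst (0ℤ <_) (Σ-nil (λ i → ⟦ P i ⟧)) 0<#P
  ∃-of-#>0 {suc n} P 0<#P
    with P zero in eq | subst (0ℤ <_) (Σ-cons (λ i → ⟦ P i ⟧)) 0<#P
  ... | true  | _ = zero , eq
  ... | false | 0<#tail
    with i , Pi ← ∃-of-#>0 (P ∘ suc) (subst (0ℤ <_) (+-identityˡ _) 0<#tail) = suc i , Pi

-- Cut criterion for 0/1 matrices with prescribed row and column sums.

module BipartiteFactors where

  open IntegerSums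
  open import Data.Bool.Base using (Bool; true; false; _∧_; _∨_; not; T)
  open import Data.Bool.Properties using (T-∧; ∧-zeroʳ; ∧-identityʳ; ∨-identityʳ; not-involutive)
  open import Data.Empty using (⊥; ⊥-elim)
  open import Data.Fin.Base using (Fin)
  open import Data.Fin.Properties using (_≟_)
  open import Data.Fin.Subset.Properties using (anySubset?)
  open import Data.Integer.Base hiding (suc; _⊔_)
  open import Data.Integer.Properties hiding (_≟_)
  open import Data.Integer.Tactic.RingSolver using (solve-∀)
  open import Data.List.Base using (List; []; _∷_; allFin; cartesianProduct)
  open import Data.List.Membership.Propositional using (_∈_)
  open import Data.List.Membership.Propositional.Properties
    using (∈-cartesianProduct⁺; ∈-allFin)
  open import Data.List.Relation.Unary.Any using (here; there)
  open import Data.Product.Base using (∃₂; _,_; _×_; proj₁; proj₂)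
  open import Data.Sum.Base using (_⊎_; inj₁; inj₂)
  open import Data.Unit.Base using (tt)
  open import Data.Vec.Base using (lookup; tabulate)
  open import Data.Vec.Properties using (lookup∘tabulate)
  open import Function.Base using (_∘_)
  open import Function.Bundles using (module Equivalence)
  open import Relation.Binary.PropositionalEquality
  open import Relation.Nullary using (yes; no)

  demand : ∀ {m} → (Fin m → ℤ) → (Fin m → Bool) → ℤ
  demand p X = Σℤ (λ i → ⟦ X i ⟧ * p i)

  cells : ∀ {m n} → (Fin m → Fin n → Bool) → (Fin m → Bool) → (Fin n → Bool) → ℤ
  cells A X Y = Σℤ (λ i → Σℤ (λ j → ⟦ A i j ∧ X i ∧ Y j ⟧))

  -- In the flow network from a source through rows, cells and columns to a sink, take the cut whose
  -- source side consists of the rows in X and the columns outside Y. Its capacity is this number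
  -- plus the demand of the rows outside X, so `Feasible` says that no cut is smaller than the total
  -- row demand.
  capacity : ∀ {m n} → (Fin m → Fin n → Bool) → (Fin n → ℤ) →
             (Fin m → Bool) → (Fin n → Bool) → ℤ
  capacity A q X Y = cells A X Y + demand q (not ∘ Y)

  Feasible : ∀ {m n} → (Fin m → Fin n → Bool) → (Fin m → ℤ) → (Fin n → ℤ) → Set
  Feasible A p q = ∀ X Y → demand p X ≤ capacity A q X Y

  Violated : ∀ {m n} → (Fin m → Fin n → Bool) → (Fin m → ℤ) → (Fin n → ℤ) → Set
  Violated A p q = ∃₂ λ X Y → capacity A q X Y < demand p X

  record Factor {m n} (A : Fin m → Fin n → Bool) (p : Fin m → ℤ) (q : Fin n → ℤ) : Set where
    field
      factor  : Fin m → Fin n → Bool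
      within  : ∀ i j → factor i j ≡ true → A i j ≡ true
      rows    : ∀ i → # (factor i) ≡ p i
      columns : ∀ j → # (λ i → factor i j) ≡ q j

  open Factor public

  demand-cong : ∀ {m} p {X X′ : Fin m → Bool} → X ≗ X′ → demand p X ≡ demand p X′
  demand-cong p X≗X′ = Σ-cong λ i → cong (λ b → ⟦ b ⟧ * p i) (X≗X′ i)

  capacity-cong : ∀ {m n} (A : Fin m → Fin n → Bool) q {X X′ Y Y′} →
                  X ≗ X′ → Y ≗ Y′ → capacity A q X Y ≡ capacity A q X′ Y′
  capacity-cong A q X≗X′ Y≗Y′ = cong₂ _+_
    (Σ-cong λ i → Σ-cong λ j →
      cong₂ (λ x y → ⟦ A i j ∧ x ∧ y ⟧) (X≗X′ i) (Y≗Y′ j))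
    (demand-cong q (cong not ∘ Y≗Y′))

  -- There are finitely many pairs of subsets, and the comparison of integers is decidable. This
  -- makes the case split in `factor-on` constructive.
  violated? : ∀ {m n} (A : Fin m → Fin n → Bool) p q → Violated A p q ⊎ Feasible A p q
  violated? A p q
    with anySubset? (λ X → anySubset? λ Y →
           capacity A q (lookup X) (lookup Y) <? demand p (lookup X))
  ... | yes (X , Y , viol) = inj₁ (lookup X , lookup Y , viol)
  ... | no ¬viol = inj₂ λ X Y → subst₂ _≤_
        (demand-cong p (lookup∘tabulate X))
        (capacity-cong A q (lookup∘tabulate X) (lookup∘tabulate Y))
        (≮⇒≥ λ viol → ¬viol (tabulate X , tabulate Y , viol))

  erase : ∀ {m n} → Fin m → Fin n → (Fin m → Fin n → Bool) → Fin m → Fin n → Bool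
  erase i j A u v = A u v ∧ not (δ i u ∧ δ j v)

  insert : ∀ {m n} → Fin m → Fin n → (Fin m → Fin n → Bool) → Fin m → Fin n → Bool
  insert i j A u v = A u v ∨ (δ i u ∧ δ j v)

  decrement : ∀ {m} → Fin m → (Fin m → ℤ) → Fin m → ℤ
  decrement i p u = p u - ⟦ δ i u ⟧

  Σ-decrement : ∀ {m} i (p : Fin m → ℤ) → Σℤ (decrement i p) ≡ Σℤ p - 1ℤ
  Σ-decrement i p = trans (Σ-distrib-- p _)
    (cong (λ s → Σℤ p - s)
      (trans (Σ-cong λ u → sym (*-identityʳ ⟦ δ i u ⟧)) (Σ-δ i (λ _ → 1ℤ))))

  demand-decrement : ∀ {m} i (p : Fin m → ℤ) X →
                     demand (decrement i p) X ≡ demand p X - ⟦ X i ⟧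
  demand-decrement i p X = trans
    (Σ-cong λ u → expand ⟦ X u ⟧ (p u) ⟦ δ i u ⟧)
    (trans (Σ-distrib-- (λ u → ⟦ X u ⟧ * p u) _)
           (cong (λ s → demand p X - s) (Σ-δ i (λ u → ⟦ X u ⟧))))
    where
    expand : ∀ x a d → x * (a - d) ≡ x * a - d * x
    expand = solve-∀

  cells-erase : ∀ {m n} (A : Fin m → Fin n → Bool) {i j} X Y → A i j ≡ true →
                cells A X Y ≡ cells (erase i j A) X Y + ⟦ X i ∧ Y j ⟧
  cells-erase A {i} {j} X Y Aij = begin
    cells A X Y
      ≡⟨ Σ-cong (λ u → Σ-cong (cell u)) ⟩
    Σℤ (λ u → Σℤ (λ v → ⟦ erase i j A u v ∧ X u ∧ Y v ⟧ + ⟦ δ i u ⟧ * (⟦ δ j v ⟧ * ⟦ X u ∧ Y v ⟧)))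
      ≡⟨ Σ-cong (λ u → Σ-distrib-+ _ _) ⟩
    Σℤ (λ u → Σℤ (λ v → ⟦ erase i j A u v ∧ X u ∧ Y v ⟧) + Σℤ (λ v → ⟦ δ i u ⟧ * (⟦ δ j v ⟧ * ⟦ X u ∧ Y v ⟧)))
      ≡⟨ Σ-distrib-+ _ _ ⟩
    cells (erase i j A) X Y + Σℤ (λ u → Σℤ (λ v → ⟦ δ i u ⟧ * (⟦ δ j v ⟧ * ⟦ X u ∧ Y v ⟧)))
      ≡⟨ cong (λ s → cells (erase i j A) X Y + s) (Σ-cong λ u →
           trans (sym (Σ-distribˡ-* ⟦ δ i u ⟧ (λ v → ⟦ δ j v ⟧ * ⟦ X u ∧ Y v ⟧))) (cong (⟦ δ i u ⟧ *_) (Σ-δ j λ v → ⟦ X u ∧ Y v ⟧))) ⟩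
    cells (erase i j A) X Y + Σℤ (λ u → ⟦ δ i u ⟧ * ⟦ X u ∧ Y j ⟧)
      ≡⟨ cong (λ s → cells (erase i j A) X Y + s) (Σ-δ i λ u → ⟦ X u ∧ Y j ⟧) ⟩
    cells (erase i j A) X Y + ⟦ X i ∧ Y j ⟧ ∎
    where
    open ≡-Reasoning
    cell : ∀ u v → ⟦ A u v ∧ X u ∧ Y v ⟧ ≡
           ⟦ erase i j A u v ∧ X u ∧ Y v ⟧ + ⟦ δ i u ⟧ * (⟦ δ j v ⟧ * ⟦ X u ∧ Y v ⟧)
    cell u v with i ≟ u | j ≟ v
    ... | yes refl | yes refl rewrite Aij = trans (sym (*-identityˡ _)) (trans (sym (*-identityˡ _)) (sym (+-identityˡ _)))
    ... | yes refl | no _ rewrite ∧-identityʳ (A i v) = sym (+-identityʳ _)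
    ... | no _     | _    rewrite ∧-identityʳ (A u v) = sym (+-identityʳ _)

  -- A quantifier that computes: an inequality between indicators of up to four Booleans is settled
  -- by evaluating its truth table, with `tt` as the proof.
  ∀ᵇ : (Bool → Bool) → Bool
  ∀ᵇ f = f true ∧ f false

  ∀ᵇ⇒ : ∀ f → T (∀ᵇ f) → ∀ b → T (f b)
  ∀ᵇ⇒ f t true  = proj₁ (Equivalence.to T-∧ t)
  ∀ᵇ⇒ f t false = proj₂ (Equivalence.to (T-∧ {f true}) t)

  ∀ᵇ⁴⇒ : ∀ (f : Bool → Bool → Bool → Bool → Bool) → T (∀ᵇ λ a → ∀ᵇ λ b → ∀ᵇ λ c → ∀ᵇ λ d → f a b c d) →
         ∀ a b c d → T (f a b c d)
  ∀ᵇ⁴⇒ f t a b c d = ∀ᵇ⇒ (f a b c) (∀ᵇ⇒ (λ c → ∀ᵇ (f a b c))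
    (∀ᵇ⇒ (λ b → ∀ᵇ λ c → ∀ᵇ (f a b c)) (∀ᵇ⇒ (λ a → ∀ᵇ λ b → ∀ᵇ λ c → ∀ᵇ (f a b c)) t a) b) c) d

  module _ {m n} (X X′ : Fin m → Bool) (Y Y′ : Fin n → Bool) where

    X∪X′ X∩X′ : Fin m → Bool
    X∪X′ i = X i ∨ X′ i
    X∩X′ i = X i ∧ X′ i

    Y∪Y′ Y∩Y′ : Fin n → Bool
    Y∪Y′ j = Y j ∨ Y′ j
    Y∩Y′ j = Y j ∧ Y′ j

    -- The two rectangles on the left lie in the union of the two on the right, and a cell that lies
    -- in both on the left has its row in both X and X′ and its column in both Y and Y′, hence lies
    -- in both on the right.
    cells-submodular : ∀ (A : Fin m → Fin n → Bool) →
      cells A X∪X′ Y∩Y′ + cells A X∩X′ Y∪Y′ ≤ cells A X Y + cells A X′ Y′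
    cells-submodular A = subst₂ _≤_ (ΣΣ-+ _ _) (ΣΣ-+ _ _)
      (Σ-mono λ i → Σ-mono λ j → cell (A i j) (X i) (X′ i) (Y j) (Y′ j))
      where
      ΣΣ-+ : ∀ (f g : Fin m → Fin n → ℤ) →
             Σℤ (λ i → Σℤ (λ j → f i j + g i j)) ≡
             Σℤ (λ i → Σℤ (f i)) + Σℤ (λ i → Σℤ (g i))
      ΣΣ-+ f g = trans (Σ-cong λ i → Σ-distrib-+ (f i) (g i)) (Σ-distrib-+ _ _)
      cell : ∀ a x x′ y y′ →
        ⟦ a ∧ (x ∨ x′) ∧ (y ∧ y′) ⟧ + ⟦ a ∧ (x ∧ x′) ∧ (y ∨ y′) ⟧ ≤
        ⟦ a ∧ x ∧ y ⟧ + ⟦ a ∧ x′ ∧ y′ ⟧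
      cell false _ _ _ _ = ≤-refl
      cell true x x′ y y′ = ≤ᵇ⇒≤ (∀ᵇ⁴⇒ (λ x x′ y y′ →
        ⟦ (x ∨ x′) ∧ (y ∧ y′) ⟧ + ⟦ (x ∧ x′) ∧ (y ∨ y′) ⟧ ≤ᵇ
        ⟦ x ∧ y ⟧ + ⟦ x′ ∧ y′ ⟧) tt x x′ y y′)

  demand-modular : ∀ {m} p (X X′ Z Z′ : Fin m → Bool) →
    (∀ i → ⟦ Z i ⟧ + ⟦ Z′ i ⟧ ≡ ⟦ X i ⟧ + ⟦ X′ i ⟧) →
    demand p Z + demand p Z′ ≡ demand p X + demand p X′
  demand-modular p X X′ Z Z′ eq = trans (sym (Σ-distrib-+ _ _)) (trans
    (Σ-cong λ i → trans (sym (*-distribʳ-+ (p i) ⟦ Z i ⟧ ⟦ Z′ i ⟧))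
      (trans (cong (_* p i) (eq i)) (*-distribʳ-+ (p i) ⟦ X i ⟧ ⟦ X′ i ⟧)))
    (Σ-distrib-+ _ _))

  ⟦∨⟧+⟦∧⟧ : ∀ x y → ⟦ x ∨ y ⟧ + ⟦ x ∧ y ⟧ ≡ ⟦ x ⟧ + ⟦ y ⟧
  ⟦∨⟧+⟦∧⟧ true  true  = refl
  ⟦∨⟧+⟦∧⟧ true  false = refl
  ⟦∨⟧+⟦∧⟧ false true  = refl
  ⟦∨⟧+⟦∧⟧ false false = refl

  ⟦¬∧⟧+⟦¬∨⟧ : ∀ x y → ⟦ not (x ∧ y) ⟧ + ⟦ not (x ∨ y) ⟧ ≡ ⟦ not x ⟧ + ⟦ not y ⟧
  ⟦¬∧⟧+⟦¬∨⟧ true  true  = refl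
  ⟦¬∧⟧+⟦¬∨⟧ true  false = refl
  ⟦¬∧⟧+⟦¬∨⟧ false true  = refl
  ⟦¬∧⟧+⟦¬∨⟧ false false = refl

  -- A cell can be left out of the factor or put into it.  If both fail, the
  -- two violating pairs uncross to (X ∪ X′ , Y ∩ Y′) and (X ∩ X′ , Y ∪ Y′), one
  -- of which is violating already before the choice.
  uncross : ∀ {m n} (A : Fin m → Fin n → Bool) p q {i j} → A i j ≡ true → Feasible A p q →
            Violated (erase i j A) p q →
            Violated (erase i j A) (decrement i p) (decrement j q) → ⊥
  uncross A p q {i} {j} Aij feas (X , Y , viol) (X′ , Y′ , viol′) =
    absurd (demand p X) (demand p X′) (demand p X∪) (demand p X∩)
      (cells A⁻ X Y) (cells A⁻ X′ Y′) (cells A⁻ X∪ Y∩) (cells A⁻ X∩ Y∪)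
      (demand q (not ∘ Y)) (demand q (not ∘ Y′)) (demand q (not ∘ Y∩)) (demand q (not ∘ Y∪))
      ⟦ X′ i ⟧ ⟦ not (Y′ j) ⟧ ⟦ X∪ i ∧ Y∩ j ⟧ ⟦ X∩ i ∧ Y∪ j ⟧
      (demand-modular p X X′ X∪ X∩ λ u → ⟦∨⟧+⟦∧⟧ (X u) (X′ u))
      (demand-modular q (not ∘ Y) (not ∘ Y′) (not ∘ Y∩) (not ∘ Y∪) λ v → ⟦¬∧⟧+⟦¬∨⟧ (Y v) (Y′ v))
      (i<j⇒suc[i]≤j viol)
      (subst₂ (λ c d → 1ℤ + (cells A⁻ X′ Y′ + c) ≤ d)
        (demand-decrement j q (not ∘ Y′)) (demand-decrement i p X′) (i<j⇒suc[i]≤j viol′))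
      (subst (λ c → demand p X∪ ≤ c + demand q (not ∘ Y∩))
        (cells-erase A X∪ Y∩ Aij) (feas X∪ Y∩))
      (subst (λ c → demand p X∩ ≤ c + demand q (not ∘ Y∪))
        (cells-erase A X∩ Y∪ Aij) (feas X∩ Y∪))
      (cells-submodular X X′ Y Y′ A⁻)
      -- The two strict violations leave a surplus of 2. The chosen cell and the two decrements can
      -- account for only 1 of it, and this truth table is where that bound comes from.
      (≤ᵇ⇒≤ (∀ᵇ⁴⇒ (λ x x′ y y′ →
        ⟦ not y′ ⟧ + (⟦ (x ∨ x′) ∧ (y ∧ y′) ⟧ + ⟦ (x ∧ x′) ∧ (y ∨ y′) ⟧) ≤ᵇ 1ℤ + ⟦ x′ ⟧)
        tt (X i) (X′ i) (Y j) (Y′ j)))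
    where
    X∪ = X∪X′ X X′ Y Y′
    X∩ = X∩X′ X X′ Y Y′
    Y∪ = Y∪Y′ X X′ Y Y′
    Y∩ = Y∩Y′ X X′ Y Y′
    A⁻ = erase i j A
    absurd : ∀ d d′ du dn c c′ cu cn s s′ su sn x y bu bn →
      du + dn ≡ d + d′ → su + sn ≡ s + s′ →
      1ℤ + (c + s) ≤ d → 1ℤ + (c′ + (s′ - y)) ≤ d′ - x →
      du ≤ cu + bu + su → dn ≤ cn + bn + sn → cu + cn ≤ c + c′ →
      y + (bu + bn) ≤ 1ℤ + x → ⊥
    absurd d d′ du dn c c′ cu cn s s′ su sn x y bu bn eqd eqs h₁ h₂ h₃ h₄ h₅ h₆
      with subst (0ℤ ≤_) (cancel (d + d′) (c + c′) (s + s′) (bu + bn) x y)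
        (diff upper ⊕ diff lower ⊕ diff h₆)
      where
      shuffle : ∀ cu bu su cn bn sn →
        cu + bu + su + (cn + bn + sn) ≡ cu + cn + (bu + bn) + (su + sn)
      shuffle = solve-∀
      collect : ∀ c c′ s s′ y →
        1ℤ + (c + s) + (1ℤ + (c′ + (s′ - y))) ≡ 1ℤ + 1ℤ + (c + c′) + (s + s′) - y
      collect = solve-∀
      upper : d + d′ ≤ c + c′ + (bu + bn) + (s + s′)
      upper = subst₂ (λ a b → a ≤ c + c′ + (bu + bn) + b) eqd eqs
        (≤-trans (subst (du + dn ≤_) (shuffle cu bu su cn bn sn) (+-mono-≤ h₃ h₄))
          (+-monoˡ-≤ (su + sn) (+-monoˡ-≤ (bu + bn) h₅)))
      lower : 1ℤ + 1ℤ + (c + c′) + (s + s′) - y ≤ d + d′ - x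
      lower = subst₂ _≤_ (collect c c′ s s′ y) (sym (+-assoc d d′ (- x))) (+-mono-≤ h₁ h₂)
      cancel : ∀ D C S B x y →
        C + B + S - D + (D - x - (1ℤ + 1ℤ + C + S - y)) + (1ℤ + x - (y + B)) ≡ -1ℤ
      cancel = solve-∀
    ... | ()

  -- Without cells, feasibility of row i against all columns gives `p i ≤ 0`, and of no rows against
  -- all columns but j gives `0 ≤ q j`. Equal totals then force every demand to be 0.
  empty-factor : ∀ {m n} (A : Fin m → Fin n → Bool) p q → (∀ i j → A i j ≡ false) →
                 Σℤ p ≡ Σℤ q → Feasible A p q → Factor A p q
  empty-factor A p q A≡false Σp≡Σq feas = record
    { factor  = A
    ; within  = λ _ _ → λ Aij → Aij
    ; rows    = λ i → trans (Σ-zero λ j → cong ⟦_⟧ (A≡false i j)) (sym (p≡0 i))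
    ; columns = λ j → trans (Σ-zero λ i → cong ⟦_⟧ (A≡false i j)) (q≡0 j)
    }
    where
    Σ0 : ∀ {m} → Σℤ {m} (λ _ → 0ℤ) ≡ 0ℤ
    Σ0 = Σ-zero (λ _ → refl)

    cells≡0 : ∀ X Y → cells A X Y ≡ 0ℤ
    cells≡0 X Y = Σ-zero λ i → Σ-zero λ j → cong (λ b → ⟦ b ∧ X i ∧ Y j ⟧) (A≡false i j)

    p≤0 : ∀ i → p i ≤ 0ℤ
    p≤0 i = subst₂ _≤_ (Σ-δ i p)
      (cong₂ _+_ (cells≡0 (δ i) (λ _ → true)) (Σ-zero λ j → *-zeroˡ (q j)))
      (feas (δ i) (λ _ → true))

    q≥0 : ∀ j → 0ℤ ≤ q j
    q≥0 j = subst₂ _≤_ (Σ-zero λ i → *-zeroˡ (p i))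
      (trans (cong₂ _+_ (cells≡0 (λ _ → false) (not ∘ δ j))
          (trans (demand-cong q (not-involutive ∘ δ j)) (Σ-δ j q)))
        (+-identityˡ (q j)))
      (feas (λ _ → false) (not ∘ δ j))

    p≡0 : ∀ i → p i ≡ 0ℤ
    p≡0 = Σ-≡⇒≗ p≤0 (subst₂ _≤_ (sym Σ0) (sym Σp≡Σq) (Σ-nonneg q≥0))

    q≡0 : ∀ j → 0ℤ ≡ q j
    q≡0 = Σ-≡⇒≗ q≥0 (subst₂ _≤_ Σp≡Σq (trans Σ0 (sym Σ0)) (Σ-mono p≤0))

  insert-factor : ∀ {m n} (A : Fin m → Fin n → Bool) p q {i j} → A i j ≡ true →
                  Factor (erase i j A) (decrement i p) (decrement j q) → Factor A p q
  insert-factor A p q {i} {j} Aij F = record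
    { factor  = insert i j (factor F)
    ; within  = λ u v → in-A u v
    ; rows    = λ u → trans (Σ-cong (cell u)) (trans (Σ-distrib-+ _ _)
        (trans (cong₂ _+_ (rows F u) (trans (Σ-cong λ v → *-comm ⟦ δ i u ⟧ ⟦ δ j v ⟧) (Σ-δ j λ _ → ⟦ δ i u ⟧)))
          (cancel (p u) ⟦ δ i u ⟧)))
    ; columns = λ v → trans (Σ-cong λ u → cell u v) (trans (Σ-distrib-+ _ _)
        (trans (cong₂ _+_ (columns F v) (Σ-δ i λ _ → ⟦ δ j v ⟧)) (cancel (q v) ⟦ δ j v ⟧)))
    }
    where
    cancel : ∀ a d → a - d + d ≡ a
    cancel = solve-∀

    in-A : ∀ u v → insert i j (factor F) u v ≡ true → A u v ≡ true
    in-A u v e with factor F u v in eq | A u v in eqA | i ≟ u | j ≟ v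
    ... | _    | true  | _        | _        = refl
    ... | true | false | _        | _        with () ← trans (sym (cong (_∧ not (δ i u ∧ δ j v)) eqA)) (within F u v eq)
    in-A u v () | false | false | yes _    | no _
    in-A u v () | false | false | no _     | _
    ... | false | false | yes refl | yes refl with () ← trans (sym Aij) eqA

    -- The given factor avoids the erased cell, so inserting that cell raises the counts of row i
    -- and column j by exactly one.
    F-ij : factor F i j ≡ false
    F-ij with factor F i j in eq
    ... | false = refl
    ... | true with () ← trans (sym (within F i j eq))
            (trans (cong (λ b → A i j ∧ not b) (cong₂ _∧_ (δ-refl i) (δ-refl j))) (∧-zeroʳ (A i j)))

    cell : ∀ u v → ⟦ insert i j (factor F) u v ⟧ ≡ ⟦ factor F u v ⟧ + ⟦ δ i u ⟧ * ⟦ δ j v ⟧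
    cell u v with i ≟ u | j ≟ v
    ... | yes refl | yes refl rewrite F-ij = refl
    ... | yes refl | no _ rewrite ∨-identityʳ (factor F i v) = sym (+-identityʳ _)
    ... | no _     | no _ rewrite ∨-identityʳ (factor F u v) = sym (+-identityʳ _)
    ... | no _     | yes _ rewrite ∨-identityʳ (factor F u v) = sym (+-identityʳ _)

  erase-factor : ∀ {m n} (A : Fin m → Fin n → Bool) p q {i j} →
                 Factor (erase i j A) p q → Factor A p q
  erase-factor A p q F = record
    { factor = factor F
    ; within = λ u v Fuv → ∧-true (A u v) (within F u v Fuv)
    ; rows = rows F
    ; columns = columns F
    }
    where
    ∧-true : ∀ a {b} → a ∧ b ≡ true → a ≡ true
    ∧-true true _ = refl

  Supported : ∀ {m n} → (Fin m → Fin n → Bool) → List (Fin m × Fin n) → Set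
  Supported A L = ∀ i j → A i j ≡ true → (i , j) ∈ L

  erase-supported : ∀ {m n} (A : Fin m → Fin n → Bool) {i j L} →
                    Supported A ((i , j) ∷ L) → Supported (erase i j A) L
  erase-supported A {i} {j} A⊆L u v e with A u v in Auv
  ... | true with A⊆L u v Auv
  ...   | there ∈L = ∈L
  ...   | here refl with () ← trans (sym e) (cong not (cong₂ _∧_ (δ-refl i) (δ-refl j)))

  skip-supported : ∀ {m n} (A : Fin m → Fin n → Bool) {i j L} → A i j ≡ false →
                   Supported A ((i , j) ∷ L) → Supported A L
  skip-supported A Aij A⊆L u v Auv with A⊆L u v Auv
  ... | there ∈L = ∈L
  ... | here refl with () ← trans (sym Aij) Auv

  -- The list holds every cell not yet decided. A cell is discarded or put into the factor,
  -- whichever keeps the remaining problem feasible, and `uncross` excludes that both fail.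
  -- Insertion lowers both totals by 1, which preserves their equality.
  factor-on : ∀ {m n} (L : List (Fin m × Fin n)) (A : Fin m → Fin n → Bool) p q →
              Supported A L → Σℤ p ≡ Σℤ q → Feasible A p q → Factor A p q
  factor-on [] A p q A⊆L Σp≡Σq feas = empty-factor A p q A≡false Σp≡Σq feas
    where
    A≡false : ∀ i j → A i j ≡ false
    A≡false i j with A i j in eq
    ... | false = refl
    ... | true with () ← A⊆L i j eq
  factor-on ((i , j) ∷ L) A p q A⊆L Σp≡Σq feas with A i j in Aij
  ... | false = factor-on L A p q (skip-supported A Aij A⊆L) Σp≡Σq feas
  ... | true with violated? (erase i j A) p q
                | violated? (erase i j A) (decrement i p) (decrement j q)
  ...   | inj₂ feas⁻ | _ = erase-factor A p q {i} {j}
          (factor-on L (erase i j A) p q (erase-supported A A⊆L) Σp≡Σq feas⁻)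
  ...   | inj₁ _ | inj₂ feas⁻ = insert-factor A p q Aij
          (factor-on L (erase i j A) _ _ (erase-supported A A⊆L)
            (trans (Σ-decrement i p) (trans (cong (_- 1ℤ) Σp≡Σq) (sym (Σ-decrement j q)))) feas⁻)
  ...   | inj₁ viol | inj₁ viol′ = ⊥-elim (uncross A p q Aij feas viol viol′)

  factor-or-violation : ∀ {m n} (A : Fin m → Fin n → Bool) p q → Σℤ p ≡ Σℤ q →
                        Factor A p q ⊎ Violated A p q
  factor-or-violation A p q Σp≡Σq with violated? A p q
  ... | inj₁ viol = inj₂ viol
  ... | inj₂ feas = inj₁ (factor-on (cartesianProduct (allFin _) (allFin _)) A p q
          (λ i j _ → ∈-cartesianProduct⁺ (∈-allFin i) (∈-allFin j)) Σp≡Σq feas)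

-- Rational inequalities and the embedding of the integers.

module Rationals where

  open import Data.Integer.Base as ℤ using (ℤ)
  import Data.Integer.Properties as ℤ
  open import Data.Nat.Base as ℕ using (ℕ; suc)
  import Data.Nat.Properties as ℕ
  open import Data.Product.Base using (∃; _,_)
  open import Data.Rational.Base
  open import Data.Rational.Properties
  open import Data.Rational.Unnormalised.Base as ℚᵘ using (mkℚᵘ; *≡*; *≤*)
  import Data.Rational.Unnormalised.Properties as ℚᵘ
  open import Data.Sum.Base using (inj₁; inj₂)
  open import Relation.Binary.PropositionalEquality
  open import Relation.Nullary.Decidable using (dec⇒maybe)
  open import Tactic.RingSolver using (solve-∀)
  open import Tactic.RingSolver.Core.AlmostCommutativeRing
    using (AlmostCommutativeRing; fromCommutativeRing)

  ring : AlmostCommutativeRing _ _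
  ring = fromCommutativeRing +-*-commutativeRing λ x → dec⇒maybe (0ℚ ≟ x)

  diff : ∀ {p q} → p ≤ q → 0ℚ ≤ q - p
  diff {p} {q} p≤q = subst (_≤ q - p) (+-inverseʳ p) (+-monoˡ-≤ (- p) p≤q)

  ≤-by : ∀ {p q} s → 0ℚ ≤ s → q - p ≡ s → p ≤ q
  ≤-by {p} {q} s 0≤s q-p≡s = subst₂ _≤_ (+-identityˡ p) (cancel q p)
    (+-monoˡ-≤ p (subst (0ℚ ≤_) (sym q-p≡s) 0≤s))
    where
    cancel : ∀ q p → q - p + p ≡ q
    cancel = solve-∀ ring

  infixl 6 _⊕_
  infixl 7 _⊛_

  _⊕_ : ∀ {p q} → 0ℚ ≤ p → 0ℚ ≤ q → 0ℚ ≤ p + q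
  0≤p ⊕ 0≤q = +-mono-≤ 0≤p 0≤q

  _⊛_ : ∀ {p q} → 0ℚ ≤ p → 0ℚ ≤ q → 0ℚ ≤ p * q
  _⊛_ {p} {q} 0≤p 0≤q = subst (_≤ p * q) (*-zeroʳ p)
    (*-monoˡ-≤-nonNeg p {{nonNegative 0≤p}} 0≤q)

  0≤1 : 0ℚ ≤ 1ℚ
  0≤1 = nonNegative⁻¹ 1ℚ

  p≤∣p∣ : ∀ p → p ≤ ∣ p ∣
  p≤∣p∣ p with ≤-total 0ℚ p
  ... | inj₁ 0≤p = ≤-reflexive (sym (0≤p⇒∣p∣≡p 0≤p))
  ... | inj₂ p≤0 = ≤-trans p≤0 (0≤∣p∣ p)

  ∣p∣≤ : ∀ {p q} → p ≤ q → - p ≤ q → ∣ p ∣ ≤ q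
  ∣p∣≤ {p} p≤q -p≤q with ∣p∣≡p∨∣p∣≡-p p
  ... | inj₁ ∣p∣≡p  = subst (_≤ _) (sym ∣p∣≡p) p≤q
  ... | inj₂ ∣p∣≡-p = subst (_≤ _) (sym ∣p∣≡-p) -p≤q

  ∣p-q∣≡∣q-p∣ : ∀ p q → ∣ p - q ∣ ≡ ∣ q - p ∣
  ∣p-q∣≡∣q-p∣ p q = trans (sym (∣-p∣≡∣p∣ (p - q))) (cong ∣_∣ (swap p q))
    where
    swap : ∀ p q → - (p - q) ≡ q - p
    swap = solve-∀ ring

  ∣p-q∣≤⇒p≤q+ : ∀ {p q ε} → ∣ p - q ∣ ≤ ε → p ≤ q + ε
  ∣p-q∣≤⇒p≤q+ {p} {q} {ε} h = ≤-by (ε - (p - q))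
    (diff (≤-trans (p≤∣p∣ (p - q)) h)) (rearrange p q ε)
    where
    rearrange : ∀ p q ε → q + ε - p ≡ ε - (p - q)
    rearrange = solve-∀ ring

  ∣∣p∣-∣q∣∣≤∣p-q∣ : ∀ p q → ∣ ∣ p ∣ - ∣ q ∣ ∣ ≤ ∣ p - q ∣
  ∣∣p∣-∣q∣∣≤∣p-q∣ p q = ∣p∣≤ (half p q)
    (subst₂ _≤_ (swap ∣ q ∣ ∣ p ∣) (∣p-q∣≡∣q-p∣ q p) (half q p))
    where
    swap : ∀ p q → p - q ≡ - (q - p)
    swap = solve-∀ ring
    cancel : ∀ a b → a + b - b ≡ a
    cancel = solve-∀ ring
    restore : ∀ a b → a - b + b ≡ a
    restore = solve-∀ ring
    half : ∀ p q → ∣ p ∣ - ∣ q ∣ ≤ ∣ p - q ∣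
    half p q = subst (∣ p ∣ - ∣ q ∣ ≤_) (cancel ∣ p - q ∣ ∣ q ∣) (+-monoˡ-≤ (- ∣ q ∣)
      (subst (λ x → ∣ x ∣ ≤ ∣ p - q ∣ + ∣ q ∣) (restore p q) (∣p+q∣≤∣p∣+∣q∣ (p - q) q)))

  half-positive : ∀ {ε} → 0ℚ < ε → 0ℚ < ε * ½
  half-positive = *-monoˡ-<-pos ½

  half+half : ∀ ε → ε * ½ + ε * ½ ≡ ε
  half+half ε = trans (sym (*-distribˡ-+ ε ½ ½)) (*-identityʳ ε)

  opaque
    ι : ℤ → ℚ
    ι i = i / 1

    ι-def : ∀ i → ι i ≡ i / 1
    ι-def _ = refl

    ι-0 : ι ℤ.0ℤ ≡ 0ℚ
    ι-0 = refl

    ι-1 : ι ℤ.1ℤ ≡ 1ℚ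
    ι-1 = refl

    toℚᵘ-ι : ∀ i → toℚᵘ (ι i) ℚᵘ.≃ mkℚᵘ i 0
    toℚᵘ-ι i = toℚᵘ-fromℚᵘ (mkℚᵘ i 0)

  ι-+ : ∀ i j → ι (i ℤ.+ j) ≡ ι i + ι j
  ι-+ i j = toℚᵘ-injective (begin
    toℚᵘ (ι (i ℤ.+ j))             ≈⟨ toℚᵘ-ι (i ℤ.+ j) ⟩
    mkℚᵘ (i ℤ.+ j) 0               ≈⟨ *≡* (cong (ℤ._* ℤ.1ℤ) (sym (cong₂ ℤ._+_ (ℤ.*-identityʳ i) (ℤ.*-identityʳ j)))) ⟩
    mkℚᵘ i 0 ℚᵘ.+ mkℚᵘ j 0         ≈⟨ ℚᵘ.+-cong (toℚᵘ-ι i) (toℚᵘ-ι j) ⟨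
    toℚᵘ (ι i) ℚᵘ.+ toℚᵘ (ι j)     ≈⟨ toℚᵘ-homo-+ (ι i) (ι j) ⟨
    toℚᵘ (ι i + ι j)               ∎)
    where open ℚᵘ.≃-Reasoning

  ι-* : ∀ i j → ι (i ℤ.* j) ≡ ι i * ι j
  ι-* i j = toℚᵘ-injective (begin
    toℚᵘ (ι (i ℤ.* j))             ≈⟨ toℚᵘ-ι (i ℤ.* j) ⟩
    mkℚᵘ (i ℤ.* j) 0               ≈⟨ *≡* refl ⟩
    mkℚᵘ i 0 ℚᵘ.* mkℚᵘ j 0         ≈⟨ ℚᵘ.*-cong (toℚᵘ-ι i) (toℚᵘ-ι j) ⟨
    toℚᵘ (ι i) ℚᵘ.* toℚᵘ (ι j)     ≈⟨ toℚᵘ-homo-* (ι i) (ι j) ⟨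
    toℚᵘ (ι i * ι j)               ∎)
    where open ℚᵘ.≃-Reasoning

  ι-mono : ∀ {i j} → i ℤ.≤ j → ι i ≤ ι j
  ι-mono {i} {j} i≤j = toℚᵘ-cancel-≤ (begin
    toℚᵘ (ι i)   ≃⟨ toℚᵘ-ι i ⟩
    mkℚᵘ i 0     ≤⟨ *≤* (ℤ.*-monoʳ-≤-nonNeg ℤ.1ℤ i≤j) ⟩
    mkℚᵘ j 0     ≃⟨ toℚᵘ-ι j ⟨
    toℚᵘ (ι j)   ∎)
    where open ℚᵘ.≤-Reasoning

  ι-nonneg : ∀ n → 0ℚ ≤ ι (ℤ.+ n)
  ι-nonneg n = subst (_≤ ι (ℤ.+ n)) ι-0 (ι-mono (ℤ.+≤+ ℕ.z≤n))

  -- A positive fraction with denominator q + 1 is at least 1/(q + 1), so W(q + 1) copies of it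
  -- reach W.
  archimedean : ∀ W ε → 0ℚ < ε → ∃ λ n → ι (ℤ.+ W) ≤ ι (ℤ.+ n) * ε
  archimedean W ε@(mkℚ ℤ.+[1+ p ] q _) _ = W ℕ.* suc q , toℚᵘ-cancel-≤ (begin
    toℚᵘ (ι (ℤ.+ W))                              ≃⟨ toℚᵘ-ι (ℤ.+ W) ⟩
    mkℚᵘ (ℤ.+ W) 0                                ≤⟨ *≤* (subst₂ ℤ._≤_ (trans (ℤ.pos-* W (suc q)) (cong (λ k → ℤ.+ W ℤ.* ℤ.+ k) (sym (ℕ.+-identityʳ (suc q)))))
                                                       (trans (ℤ.pos-* (W ℕ.* suc q) (suc p)) (sym (ℤ.*-identityʳ _)))
                                                       (ℤ.+≤+ (ℕ.m≤m*n (W ℕ.* suc q) (suc p)))) ⟩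
    mkℚᵘ (ℤ.+ (W ℕ.* suc q)) 0 ℚᵘ.* toℚᵘ ε        ≃⟨ ℚᵘ.*-congʳ {toℚᵘ ε} (toℚᵘ-ι (ℤ.+ (W ℕ.* suc q))) ⟨
    toℚᵘ (ι (ℤ.+ (W ℕ.* suc q))) ℚᵘ.* toℚᵘ ε      ≃⟨ toℚᵘ-homo-* (ι (ℤ.+ (W ℕ.* suc q))) ε ⟨
    toℚᵘ (ι (ℤ.+ (W ℕ.* suc q)) * ε)              ∎)
    where open ℚᵘ.≤-Reasoning
  archimedean W (mkℚ ℤ.+0 q _) (*<* (ℤ.+<+ ()))
  archimedean W (mkℚ ℤ.-[1+ p ] q _) (*<* ())

-- The Cauchy reals as an ordered commutative semiring with absolute value.

module Reals where

  open import Defs hiding (sum)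
  import Defs
  open Rationals
  open import Algebra.Bundles using (CommutativeSemiring)
  import Algebra.Properties.Semiring.Sum as SemiringSum
  open import Algebra.Structures.Biased using (IsCommutativeSemiringˡ)
  open import Data.Fin.Base using (Fin; zero; suc)
  open import Data.Nat.Base as ℕ using (ℕ; zero; suc)
  import Data.Nat.Properties as ℕ
  open import Data.Product.Base using (∃; _,_; _×_)
  open import Data.Rational.Base hiding (_≃_)
  open import Data.Rational.Properties hiding (_≟_)
  open import Function.Base using (_∘_)
  open import Level using (0ℓ)
  open import Relation.Binary.Bundles using (Preorder)
  open import Relation.Binary.PropositionalEquality
  open import Relation.Binary.Structures using (IsEquivalence)
  open import Tactic.RingSolver using (solve-∀)

  infix 4 _≈_ _≼_
  infixl 6 _⊞_
  infixl 7 _⊠_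

  private
    variable
      x y z x′ y′ : ℝ

  -- Opaque copies of the operations and relations, so that Agda can infer the
  -- real numbers they are applied to.
  opaque
    _≈_ _≼_ : ℝ → ℝ → Set
    _≈_ = _≃_
    _≼_ = _≤ᴿ_

    _⊞_ _⊠_ : ℝ → ℝ → ℝ
    _⊞_ = _+ᴿ_
    _⊠_ = _*ᴿ_

    κ : ℚ → ℝ
    κ = fromℚ

    ≃⇒≈ : x ≃ y → x ≈ y
    ≃⇒≈ h = h

    ≈⇒≃ : x ≈ y → x ≃ y
    ≈⇒≃ h = h

    ≤⇒≼ : x ≤ᴿ y → x ≼ y
    ≤⇒≼ h = h

    ≼⇒≤ : x ≼ y → x ≤ᴿ y
    ≼⇒≤ h = h

    ⊠-def : x *ᴿ y ≡ x ⊠ y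
    ⊠-def = refl

    κ-def : ∀ q → fromℚ q ≡ κ q
    κ-def _ = refl

    seq-⊞ : ∀ x y k → seq (x ⊞ y) k ≡ seq x k + seq y k
    seq-⊞ _ _ _ = refl

    seq-⊠ : ∀ x y k → seq (x ⊠ y) k ≡ seq x k * seq y k
    seq-⊠ _ _ _ = refl

    seq-κ : ∀ q k → seq (κ q) k ≡ q
    seq-κ _ _ = refl

    ≼-pointwise : (∀ k → seq x k ≤ seq y k) → x ≼ y
    ≼-pointwise {x} {y} x≤y ε 0<ε = 0 , λ n _ → ≤-trans (x≤y n)
      (subst (_≤ seq y n + ε) (+-identityʳ (seq y n)) (+-monoʳ-≤ (seq y n) (<⇒≤ 0<ε)))

    ≈-pointwise : (∀ k → seq x k ≡ seq y k) → x ≈ y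
    ≈-pointwise {x} {y} x≡y ε 0<ε = 0 , λ n _ →
      subst (λ a → ∣ a - seq y n ∣ ≤ ε) (sym (x≡y n))
        (subst (λ a → ∣ a ∣ ≤ ε) (sym (+-inverseʳ (seq y n))) (<⇒≤ 0<ε))

    ≈-sym : x ≈ y → y ≈ x
    ≈-sym {x} {y} x≈y ε 0<ε with N , p ← x≈y ε 0<ε =
      N , λ n N≤n → subst (_≤ ε) (∣p-q∣≡∣q-p∣ (seq x n) (seq y n)) (p n N≤n)

    ≼-reflexive : x ≈ y → x ≼ y
    ≼-reflexive {x} {y} x≈y ε 0<ε with N , p ← x≈y ε 0<ε =
      N , λ n N≤n → ∣p-q∣≤⇒p≤q+ {seq x n} {seq y n} (p n N≤n)

    ≼-antisym : x ≼ y → y ≼ x → x ≈ y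
    ≼-antisym {x} {y} x≼y y≼x ε 0<ε
      with M , p ← x≼y ε 0<ε | N , q ← y≼x ε 0<ε =
      M ℕ.⊔ N , λ n h → ∣p∣≤
        (≤-by (seq y n + ε - seq x n) (diff (p n (ℕ.m⊔n≤o⇒m≤o M N h))) (lemma₁ (seq x n) (seq y n) ε))
        (≤-by (seq x n + ε - seq y n) (diff (q n (ℕ.m⊔n≤o⇒n≤o M N h))) (lemma₂ (seq x n) (seq y n) ε))
      where
      lemma₁ : ∀ a b e → e - (a - b) ≡ b + e - a
      lemma₁ = solve-∀ ring
      lemma₂ : ∀ a b e → e - - (a - b) ≡ a + e - b
      lemma₂ = solve-∀ ring

    ≼-trans : x ≼ y → y ≼ z → x ≼ z
    ≼-trans {x} {y} {z} x≼y y≼z ε 0<ε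
      with M , p ← x≼y (ε * ½) (half-positive 0<ε) | N , q ← y≼z (ε * ½) (half-positive 0<ε) =
      M ℕ.⊔ N , λ n h → begin
        seq x n                      ≤⟨ p n (ℕ.m⊔n≤o⇒m≤o M N h) ⟩
        seq y n + ε * ½              ≤⟨ +-monoˡ-≤ (ε * ½) (q n (ℕ.m⊔n≤o⇒n≤o M N h)) ⟩
        seq z n + ε * ½ + ε * ½      ≡⟨ +-assoc (seq z n) (ε * ½) (ε * ½) ⟩
        seq z n + (ε * ½ + ε * ½)    ≡⟨ cong (seq z n +_) (half+half ε) ⟩
        seq z n + ε                  ∎
      where open ≤-Reasoning

    ⊞-mono : x ≼ x′ → y ≼ y′ → x ⊞ y ≼ x′ ⊞ y′
    ⊞-mono {x} {x′} {y} {y′} x≼x′ y≼y′ ε 0<ε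
      with M , p ← x≼x′ (ε * ½) (half-positive 0<ε) | N , q ← y≼y′ (ε * ½) (half-positive 0<ε) =
      M ℕ.⊔ N , λ n h → begin
        seq x n + seq y n
          ≤⟨ +-mono-≤ (p n (ℕ.m⊔n≤o⇒m≤o M N h)) (q n (ℕ.m⊔n≤o⇒n≤o M N h)) ⟩
        seq x′ n + ε * ½ + (seq y′ n + ε * ½)
          ≡⟨ shuffle (seq x′ n) (seq y′ n) (ε * ½) ⟩
        seq x′ n + seq y′ n + (ε * ½ + ε * ½)
          ≡⟨ cong (seq x′ n + seq y′ n +_) (half+half ε) ⟩
        seq x′ n + seq y′ n + ε ∎
      where
      open ≤-Reasoning
      shuffle : ∀ a b e → a + e + (b + e) ≡ a + b + (e + e)
      shuffle = solve-∀ ring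

    ⊞-cancelˡ : ∀ z → z ⊞ x ≼ z ⊞ y → x ≼ y
    ⊞-cancelˡ {x} {y} z zx≼zy ε 0<ε with N , p ← zx≼zy ε 0<ε =
      N , λ n h → ≤-by _ (diff (p n h)) (cancel (seq x n) (seq y n) (seq z n) ε)
      where
      cancel : ∀ a b c e → b + e - a ≡ c + b + e - (c + a)
      cancel = solve-∀ ring

    bounded : ∀ x → ∃ λ B → 0ℚ < B × ∃ λ N → ∀ n → N ℕ.≤ n → ∣ seq x n ∣ ≤ B
    bounded x with N , p ← cauchy x 1ℚ (positive⁻¹ 1ℚ)
      = 1ℚ + ∣ seq x N ∣
      , +-mono-<-≤ (positive⁻¹ 1ℚ) (0≤∣p∣ (seq x N))
      , N , λ n N≤n → subst (λ a → ∣ a ∣ ≤ 1ℚ + ∣ seq x N ∣) (restore (seq x n) (seq x N))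
          (≤-trans (∣p+q∣≤∣p∣+∣q∣ (seq x n - seq x N) (seq x N))
                   (+-monoˡ-≤ ∣ seq x N ∣ (p n N N≤n ℕ.≤-refl)))
      where
      restore : ∀ a b → a - b + b ≡ a
      restore = solve-∀ ring

    quotient : ∀ B ε → 0ℚ < B → 0ℚ < ε → ∃ λ δ → 0ℚ < δ × δ * B ≡ ε
    quotient B ε 0<B 0<ε = 1/ B * ε , 0<δ , trans (*-comm (1/ B * ε) B)
      (trans (sym (*-assoc B (1/ B) ε)) (trans (cong (_* ε) (*-inverseʳ B)) (*-identityˡ ε)))
      where
      instance
        B-pos : Positive B
        B-pos = positive 0<B
        B-nonZero : NonZero B
        B-nonZero = pos⇒nonZero B
      0<δ : 0ℚ < 1/ B * ε
      0<δ = subst (_< 1/ B * ε) (*-zeroʳ (1/ B)) (*-monoʳ-<-pos (1/ B) {{1/pos⇒pos B}} 0<ε)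

    ⊠-congʳ : x ≈ x′ → x ⊠ y ≈ x′ ⊠ y
    ⊠-congʳ {x} {x′} {y} x≈x′ ε 0<ε =
      let B , 0<B , M , b = bounded y
          δ , 0<δ , δB≡ε = quotient B ε 0<B 0<ε
          N , p = x≈x′ δ 0<δ
      in M ℕ.⊔ N , λ n h → estimate (seq x n) (seq x′ n) (seq y n) (<⇒≤ 0<δ) δB≡ε
           (p n (ℕ.m⊔n≤o⇒n≤o M N h)) (b n (ℕ.m⊔n≤o⇒m≤o M N h))
      where
      factor : ∀ a b c → a * c - b * c ≡ (a - b) * c
      factor = solve-∀ ring
      estimate : ∀ a b c {δ B ε} → 0ℚ ≤ δ → δ * B ≡ ε → ∣ a - b ∣ ≤ δ → ∣ c ∣ ≤ B →
                 ∣ a * c - b * c ∣ ≤ ε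
      estimate a b c {δ} {B} {ε} 0≤δ δB≡ε a-b≤δ c≤B = begin
        ∣ a * c - b * c ∣      ≡⟨ cong ∣_∣ (factor a b c) ⟩
        ∣ (a - b) * c ∣        ≡⟨ ∣p*q∣≡∣p∣*∣q∣ (a - b) c ⟩
        ∣ a - b ∣ * ∣ c ∣      ≤⟨ *-monoʳ-≤-nonNeg ∣ c ∣ {{∣-∣-nonNeg c}} a-b≤δ ⟩
        δ * ∣ c ∣              ≤⟨ *-monoˡ-≤-nonNeg δ {{nonNegative 0≤δ}} c≤B ⟩
        δ * B                  ≡⟨ δB≡ε ⟩
        ε                      ∎
        where open ≤-Reasoning

    ∣_∣ᴿ : ℝ → ℝ
    ∣ x ∣ᴿ = mkℝ (λ n → ∣ seq x n ∣) λ ε 0<ε →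
      let N , p = cauchy x ε 0<ε
      in N , λ m n N≤m N≤n →
        ≤-trans (∣∣p∣-∣q∣∣≤∣p-q∣ (seq x m) (seq x n)) (p m n N≤m N≤n)

    0≼∣x∣ : ∀ x → κ 0ℚ ≼ ∣ x ∣ᴿ
    0≼∣x∣ x = ≼-pointwise {κ 0ℚ} {∣ x ∣ᴿ} λ k → 0≤∣p∣ (seq x k)

    x≼∣x∣ : ∀ x → x ≼ ∣ x ∣ᴿ
    x≼∣x∣ x = ≼-pointwise {x} {∣ x ∣ᴿ} λ k → p≤∣p∣ (seq x k)

    ∣x⊞y∣≼ : ∀ x y → ∣ x ⊞ y ∣ᴿ ≼ ∣ x ∣ᴿ ⊞ ∣ y ∣ᴿ
    ∣x⊞y∣≼ x y = ≼-pointwise {∣ x ⊞ y ∣ᴿ} {∣ x ∣ᴿ ⊞ ∣ y ∣ᴿ} λ k → ∣p+q∣≤∣p∣+∣q∣ (seq x k) (seq y k)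

    ∣x⊠y∣≈ : ∀ x y → ∣ x ⊠ y ∣ᴿ ≈ ∣ x ∣ᴿ ⊠ ∣ y ∣ᴿ
    ∣x⊠y∣≈ x y = ≈-pointwise {∣ x ⊠ y ∣ᴿ} {∣ x ∣ᴿ ⊠ ∣ y ∣ᴿ} λ k → ∣p*q∣≡∣p∣*∣q∣ (seq x k) (seq y k)

    ∣-∣-cong : x ≈ y → ∣ x ∣ᴿ ≈ ∣ y ∣ᴿ
    ∣-∣-cong {x} {y} x≈y ε 0<ε with N , p ← x≈y ε 0<ε =
      N , λ n h → ≤-trans (∣∣p∣-∣q∣∣≤∣p-q∣ (seq x n) (seq y n)) (p n h)

    ∣0∣≼0 : ∣ κ 0ℚ ∣ᴿ ≼ κ 0ℚ
    ∣0∣≼0 = ≼-pointwise {∣ κ 0ℚ ∣ᴿ} {κ 0ℚ} λ _ → ≤-refl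

    ∣x∣≼0⇒x≈0 : ∣ x ∣ᴿ ≼ κ 0ℚ → x ≈ κ 0ℚ
    ∣x∣≼0⇒x≈0 {x} h ε 0<ε with N , p ← h ε 0<ε = N , λ n N≤n →
      subst₂ (λ a b → ∣ a ∣ ≤ b) (minus-zero (seq x n)) (+-identityˡ ε) (p n N≤n)
      where
      minus-zero : ∀ a → a ≡ a - 0ℚ
      minus-zero = solve-∀ ring

    0≼⇒∣x∣≈x : κ 0ℚ ≼ x → ∣ x ∣ᴿ ≈ x
    0≼⇒∣x∣≈x {x} 0≼x = ≼-antisym {∣ x ∣ᴿ} {x} below (x≼∣x∣ x)
      where
      below : ∣ x ∣ᴿ ≼ x
      below ε 0<ε with N , p ← 0≼x (ε * ½) (half-positive 0<ε) = N , λ n h → ∣p∣≤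
        (subst (_≤ seq x n + ε) (+-identityʳ (seq x n)) (+-monoʳ-≤ (seq x n) (<⇒≤ 0<ε)))
        -- Twice the inequality 0 ≤ x + ε/2 is -x ≤ x + ε.
        (≤-by _ (diff (p n h) ⊕ diff (p n h))
          (subst (λ e → seq x n + e - - seq x n ≡ seq x n + ε * ½ - 0ℚ + (seq x n + ε * ½ - 0ℚ))
            (half+half ε) (double (seq x n) (ε * ½))))
        where
        double : ∀ a e → a + (e + e) - - a ≡ a + e - 0ℚ + (a + e - 0ℚ)
        double = solve-∀ ring

  ≈-refl : x ≈ x
  ≈-refl = ≈-pointwise λ _ → refl

  ≼-refl : x ≼ x
  ≼-refl = ≼-reflexive ≈-refl

  ≈-trans : x ≈ y → y ≈ z → x ≈ z
  ≈-trans x≈y y≈z = ≼-antisym (≼-trans (≼-reflexive x≈y) (≼-reflexive y≈z))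
    (≼-trans (≼-reflexive (≈-sym y≈z)) (≼-reflexive (≈-sym x≈y)))

  ⊞-cong : x ≈ x′ → y ≈ y′ → x ⊞ y ≈ x′ ⊞ y′
  ⊞-cong x≈x′ y≈y′ = ≼-antisym (⊞-mono (≼-reflexive x≈x′) (≼-reflexive y≈y′))
    (⊞-mono (≼-reflexive (≈-sym x≈x′)) (≼-reflexive (≈-sym y≈y′)))

  opaque
    unfolding _≈_

    ⊠-comm : ∀ x y → x ⊠ y ≈ y ⊠ x
    ⊠-comm x y = ≈-pointwise {x ⊠ y} {y ⊠ x} λ k → *-comm (seq x k) (seq y k)

  ⊠-cong : x ≈ x′ → y ≈ y′ → x ⊠ y ≈ x′ ⊠ y′
  ⊠-cong {x} {x′} {y} {y′} x≈x′ y≈y′ = ≈-trans (⊠-congʳ x≈x′)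
    (≈-trans (⊠-comm x′ y) (≈-trans (⊠-congʳ y≈y′) (⊠-comm y′ x′)))

  ≈-isEquivalence : IsEquivalence _≈_
  ≈-isEquivalence = record { refl = ≈-refl ; sym = ≈-sym ; trans = ≈-trans }

  opaque
    unfolding _≈_

    ℝ-isCommutativeSemiringˡ : IsCommutativeSemiringˡ _≈_ _⊞_ _⊠_ (κ 0ℚ) (κ 1ℚ)
    ℝ-isCommutativeSemiringˡ = record
      { +-isCommutativeMonoid = record
        { isMonoid = record
          { isSemigroup = record
            { isMagma = record { isEquivalence = ≈-isEquivalence
              ; ∙-cong = λ {x} {x′} {y} {y′} → ⊞-cong {x} {x′} {y} {y′} }
            ; assoc = λ x y z → ≈-pointwise {x ⊞ y ⊞ z} {x ⊞ (y ⊞ z)} λ k → +-assoc (seq x k) (seq y k) (seq z k)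
            }
          ; identity = (λ x → ≈-pointwise {κ 0ℚ ⊞ x} {x} λ k → +-identityˡ (seq x k))
                     , (λ x → ≈-pointwise {x ⊞ κ 0ℚ} {x} λ k → +-identityʳ (seq x k))
          }
        ; comm = λ x y → ≈-pointwise {x ⊞ y} {y ⊞ x} λ k → +-comm (seq x k) (seq y k)
        }
      ; *-isCommutativeMonoid = record
        { isMonoid = record
          { isSemigroup = record
            { isMagma = record { isEquivalence = ≈-isEquivalence
              ; ∙-cong = λ {x} {x′} {y} {y′} → ⊠-cong {x} {x′} {y} {y′} }
            ; assoc = λ x y z → ≈-pointwise {x ⊠ y ⊠ z} {x ⊠ (y ⊠ z)} λ k → *-assoc (seq x k) (seq y k) (seq z k)
            }
          ; identity = (λ x → ≈-pointwise {κ 1ℚ ⊠ x} {x} λ k → *-identityˡ (seq x k))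
                     , (λ x → ≈-pointwise {x ⊠ κ 1ℚ} {x} λ k → *-identityʳ (seq x k))
          }
        ; comm = ⊠-comm
        }
      ; distribʳ = λ x y z → ≈-pointwise {(y ⊞ z) ⊠ x} {y ⊠ x ⊞ z ⊠ x} λ k → *-distribʳ-+ (seq x k) (seq y k) (seq z k)
      ; zeroˡ = λ x → ≈-pointwise {κ 0ℚ ⊠ x} {κ 0ℚ} λ k → *-zeroˡ (seq x k)
      }

  ℝ-commutativeSemiring : CommutativeSemiring 0ℓ 0ℓ
  ℝ-commutativeSemiring = record
    { isCommutativeSemiring = IsCommutativeSemiringˡ.isCommutativeSemiring ℝ-isCommutativeSemiringˡ }

  module ℝ-Semiring = CommutativeSemiring ℝ-commutativeSemiring

  ≼-preorder : Preorder 0ℓ 0ℓ 0ℓ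
  ≼-preorder = record
    { Carrier = ℝ ; _≈_ = _≈_ ; _≲_ = _≼_
    ; isPreorder = record
      { isEquivalence = ≈-isEquivalence ; reflexive = ≼-reflexive ; trans = ≼-trans }
    }

  module ≼-Reasoning where
    open import Relation.Binary.Reasoning.Preorder ≼-preorder public

  -- A nonnegative real may have negative terms in its sequence, so a termwise argument fails. Both
  -- factors are therefore replaced by their absolute values, for which it works.
  ⊠-nonneg : κ 0ℚ ≼ x → κ 0ℚ ≼ y → κ 0ℚ ≼ x ⊠ y
  ⊠-nonneg {x} {y} 0≼x 0≼y = begin
    κ 0ℚ              ≲⟨ 0≼∣x∣ (x ⊠ y) ⟩
    ∣ x ⊠ y ∣ᴿ        ≈⟨ ∣x⊠y∣≈ x y ⟩
    ∣ x ∣ᴿ ⊠ ∣ y ∣ᴿ   ≈⟨ ⊠-cong (0≼⇒∣x∣≈x 0≼x) (0≼⇒∣x∣≈x 0≼y) ⟩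
    x ⊠ y             ∎
    where open ≼-Reasoning

  opaque
    unfolding _≈_

    -- Lets an inequality be traded for an equation with a nonnegative summand, so that monotonicity
    -- of `_⊠_` follows from `⊠-nonneg` and distributivity.
    difference : x ≼ y → ∃ λ d → κ 0ℚ ≼ d × x ⊞ d ≈ y
    difference {x} {y} x≼y = y ⊞ κ (- 1ℚ) ⊠ x
      , (λ ε 0<ε → let N , p = x≼y ε 0<ε in N , λ n h →
          ≤-by _ (diff (p n h)) (gap (seq x n) (seq y n) ε))
      , ≈-pointwise {x ⊞ (y ⊞ κ (- 1ℚ) ⊠ x)} {y} (λ k → restore (seq x k) (seq y k))
      where
      gap : ∀ a b e → b + - 1ℚ * a + e - 0ℚ ≡ b + e - a
      gap = solve-∀ ring
      restore : ∀ a b → a + (b + - 1ℚ * a) ≡ b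
      restore = solve-∀ ring

  ⊠-monoʳ : κ 0ℚ ≼ z → x ≼ y → z ⊠ x ≼ z ⊠ y
  ⊠-monoʳ {z} {x} {y} 0≼z x≼y with d , 0≼d , x+d≈y ← difference x≼y = begin
    z ⊠ x              ≈⟨ ℝ-Semiring.+-identityʳ (z ⊠ x) ⟨
    z ⊠ x ⊞ κ 0ℚ       ≲⟨ ⊞-mono ≼-refl (⊠-nonneg 0≼z 0≼d) ⟩
    z ⊠ x ⊞ z ⊠ d      ≈⟨ ℝ-Semiring.distribˡ z x d ⟨
    z ⊠ (x ⊞ d)        ≈⟨ ⊠-cong ≈-refl x+d≈y ⟩
    z ⊠ y              ∎
    where open ≼-Reasoning

  ⊠-monoˡ : κ 0ℚ ≼ z → x ≼ y → x ⊠ z ≼ y ⊠ z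
  ⊠-monoˡ {z} {x} {y} 0≼z x≼y = begin
    x ⊠ z   ≈⟨ ⊠-comm x z ⟩
    z ⊠ x   ≲⟨ ⊠-monoʳ 0≼z x≼y ⟩
    z ⊠ y   ≈⟨ ⊠-comm z y ⟩
    y ⊠ z   ∎
    where open ≼-Reasoning

  ⊞-cancelʳ : ∀ z → x ⊞ z ≼ y ⊞ z → x ≼ y
  ⊞-cancelʳ {x} {y} z h = ⊞-cancelˡ z (≼-trans (≼-reflexive (ℝ-Semiring.+-comm z x))
    (≼-trans h (≼-reflexive (ℝ-Semiring.+-comm y z))))

  κ-mono : ∀ {p q} → p ≤ q → κ p ≼ κ q
  κ-mono {p} {q} p≤q = ≼-pointwise λ k → subst₂ _≤_ (sym (seq-κ p k)) (sym (seq-κ q k)) p≤q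

  κ-⊞ : ∀ p q → κ p ⊞ κ q ≈ κ (p + q)
  κ-⊞ p q = ≈-pointwise λ k → trans (seq-⊞ (κ p) (κ q) k)
    (trans (cong₂ _+_ (seq-κ p k) (seq-κ q k)) (sym (seq-κ (p + q) k)))

  κ-⊠ : ∀ p q → κ p ⊠ κ q ≈ κ (p * q)
  κ-⊠ p q = ≈-pointwise λ k → trans (seq-⊠ (κ p) (κ q) k)
    (trans (cong₂ _*_ (seq-κ p k) (seq-κ q k)) (sym (seq-κ (p * q) k)))

  private
    module Sum = SemiringSum ℝ-Semiring.semiring

  opaque
    Σᴿ : ∀ {n} → (Fin n → ℝ) → ℝ
    Σᴿ = Sum.sum

    Σᴿ-nil : (f : Fin 0 → ℝ) → Σᴿ f ≡ κ 0ℚ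
    Σᴿ-nil _ = refl

    Σᴿ-cons : ∀ {n} (f : Fin (suc n) → ℝ) → Σᴿ f ≡ f zero ⊞ Σᴿ (f ∘ suc)
    Σᴿ-cons _ = refl

  opaque
    unfolding Σᴿ _≈_

    Σᴿ-def : ∀ {n} (f : Fin n → ℝ) → Defs.sum f ≡ Σᴿ f
    Σᴿ-def f = refl

  opaque
    unfolding Σᴿ

    Σᴿ-cong : ∀ {n} {f g : Fin n → ℝ} → (∀ i → f i ≈ g i) → Σᴿ f ≈ Σᴿ g
    Σᴿ-cong = Sum.sum-cong-≋

    Σᴿ-distrib-⊞ : ∀ {n} (f g : Fin n → ℝ) → Σᴿ (λ i → f i ⊞ g i) ≈ Σᴿ f ⊞ Σᴿ g
    Σᴿ-distrib-⊞ = Sum.∑-distrib-+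

    Σᴿ-comm : ∀ {m n} (f : Fin m → Fin n → ℝ) →
              Σᴿ (λ i → Σᴿ (f i)) ≈ Σᴿ (λ j → Σᴿ (λ i → f i j))
    Σᴿ-comm = Sum.∑-comm

    Σᴿ-distribˡ-⊠ : ∀ {n} c (f : Fin n → ℝ) → c ⊠ Σᴿ f ≈ Σᴿ (λ i → c ⊠ f i)
    Σᴿ-distribˡ-⊠ = Sum.*-distribˡ-sum

    Σᴿ-distribʳ-⊠ : ∀ {n} c (f : Fin n → ℝ) → Σᴿ f ⊠ c ≈ Σᴿ (λ i → f i ⊠ c)
    Σᴿ-distribʳ-⊠ = Sum.*-distribʳ-sum

    Σᴿ-mono : ∀ {n} {f g : Fin n → ℝ} → (∀ i → f i ≼ g i) → Σᴿ f ≼ Σᴿ g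
    Σᴿ-mono {zero}  f≼g = ≼-refl
    Σᴿ-mono {suc n} f≼g = ⊞-mono (f≼g zero) (Σᴿ-mono (f≼g ∘ suc))

    Σᴿ-nonneg : ∀ {n} {f : Fin n → ℝ} → (∀ i → κ 0ℚ ≼ f i) → κ 0ℚ ≼ Σᴿ f
    Σᴿ-nonneg {zero}  0≼f = ≼-refl
    Σᴿ-nonneg {suc n} 0≼f = ≼-trans (≼-reflexive (≈-sym (ℝ-Semiring.+-identityˡ (κ 0ℚ))))
      (⊞-mono (0≼f zero) (Σᴿ-nonneg (0≼f ∘ suc)))

    Σᴿ-zero : ∀ {n} {f : Fin n → ℝ} → (∀ i → f i ≈ κ 0ℚ) → Σᴿ f ≈ κ 0ℚ
    Σᴿ-zero {zero}  f≈0 = ≈-refl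
    Σᴿ-zero {suc n} f≈0 = ≈-trans (⊞-cong (f≈0 zero) (Σᴿ-zero (f≈0 ∘ suc)))
      (ℝ-Semiring.+-identityˡ (κ 0ℚ))

    ∣Σ∣≼Σ∣∣ : ∀ {n} (f : Fin n → ℝ) → ∣ Σᴿ f ∣ᴿ ≼ Σᴿ (λ i → ∣ f i ∣ᴿ)
    ∣Σ∣≼Σ∣∣ {zero}  f = ∣0∣≼0
    ∣Σ∣≼Σ∣∣ {suc n} f = ≼-trans (∣x⊞y∣≼ (f zero) _) (⊞-mono ≼-refl (∣Σ∣≼Σ∣∣ (f ∘ suc)))

    -- Termwise inequalities that add up to an equality are equalities. The proof cancels the other
    -- summands and never compares two reals by cases; all equality discussions of the spectral part
    -- rest on it.
    Σᴿ-rigid : ∀ {n} {f g : Fin n → ℝ} → (∀ i → g i ≼ f i) → Σᴿ f ≼ Σᴿ g →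
               ∀ i → f i ≼ g i
    Σᴿ-rigid {suc n} {f} {g} g≼f Σf≼Σg zero = ⊞-cancelʳ (Σᴿ (f ∘ suc))
      (≼-trans Σf≼Σg (⊞-mono ≼-refl (Σᴿ-mono (g≼f ∘ suc))))
    Σᴿ-rigid {suc n} {f} {g} g≼f Σf≼Σg (suc i) = Σᴿ-rigid (g≼f ∘ suc)
      (⊞-cancelˡ (f zero) (≼-trans Σf≼Σg (⊞-mono (g≼f zero) ≼-refl))) i

  ≡⇒≈ : x ≡ y → x ≈ y
  ≡⇒≈ refl = ≈-refl

  module _ {n} (A : Matrix n) (μ : ℝ) (x : Fin n → ℝ) (i : Fin n) where

    sum-def : Defs.sum (λ j → A i j *ᴿ x j) ≈ Σᴿ (λ j → A i j ⊠ x j)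
    sum-def = ≈-trans (≡⇒≈ (Σᴿ-def (λ j → A i j *ᴿ x j)))
      (Σᴿ-cong λ j → ≡⇒≈ (⊠-def {A i j} {x j}))

    eigenvector-equation : Defs.sum (λ j → A i j *ᴿ x j) ≃ μ *ᴿ x i →
                           Σᴿ (λ j → A i j ⊠ x j) ≈ μ ⊠ x i
    eigenvector-equation h = ≈-trans (≈-sym sum-def)
      (≈-trans (≃⇒≈ {Defs.sum (λ j → A i j *ᴿ x j)} {μ *ᴿ x i} h) (≡⇒≈ (⊠-def {μ} {x i})))

    eigenvector-equation⁻ : Σᴿ (λ j → A i j ⊠ x j) ≈ μ ⊠ x i →
                            Defs.sum (λ j → A i j *ᴿ x j) ≃ μ *ᴿ x i
    eigenvector-equation⁻ h = ≈⇒≃ {Defs.sum (λ j → A i j *ᴿ x j)} {μ *ᴿ x i}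
      (≈-trans sum-def (≈-trans h (≡⇒≈ (sym (⊠-def {μ} {x i})))))

-- Real roots of rational polynomials by bisection.

module Bisection where

  open import Defs hiding (sum)
  open Rationals
  open Reals
  open import Data.Nat.Base as ℕ using (ℕ; zero; suc)
  import Data.Integer.Base as ℤ
  import Data.Nat.Properties as ℕ
  open import Data.Product.Base using (∃; _,_; _×_; proj₁; proj₂)
  open import Data.Rational.Base hiding (_≃_)
  open import Data.Rational.Properties
  open import Function.Base using (_∘_)
  open import Relation.Binary.PropositionalEquality
  open import Relation.Nullary using (yes; no)
  open import Tactic.RingSolver using (solve-∀)

  infixl 6 _:+_
  infixl 7 _:*_

  -- Syntax that can be evaluated at rationals and at reals. Real evaluation is rational evaluation
  -- term by term, so continuity is just the congruence `⟦⟧ᴿ-cong`, and polynomial identities over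
  -- the rationals transfer to the reals termwise.
  data Poly : Set where
    var       : Poly
    con       : ℚ → Poly
    _:+_ _:*_ : Poly → Poly → Poly

  ⟦_⟧ℚ : Poly → ℚ → ℚ
  ⟦ var    ⟧ℚ t = t
  ⟦ con q  ⟧ℚ t = q
  ⟦ P :+ Q ⟧ℚ t = ⟦ P ⟧ℚ t + ⟦ Q ⟧ℚ t
  ⟦ P :* Q ⟧ℚ t = ⟦ P ⟧ℚ t * ⟦ Q ⟧ℚ t

  ⟦_⟧ᴿ : Poly → ℝ → ℝ
  ⟦ var    ⟧ᴿ x = x
  ⟦ con q  ⟧ᴿ x = κ q
  ⟦ P :+ Q ⟧ᴿ x = ⟦ P ⟧ᴿ x ⊞ ⟦ Q ⟧ᴿ x
  ⟦ P :* Q ⟧ᴿ x = ⟦ P ⟧ᴿ x ⊠ ⟦ Q ⟧ᴿ x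

  seq-⟦⟧ᴿ : ∀ P x k → seq (⟦ P ⟧ᴿ x) k ≡ ⟦ P ⟧ℚ (seq x k)
  seq-⟦⟧ᴿ var      x k = refl
  seq-⟦⟧ᴿ (con q)  x k = seq-κ q k
  seq-⟦⟧ᴿ (P :+ Q) x k = trans (seq-⊞ (⟦ P ⟧ᴿ x) (⟦ Q ⟧ᴿ x) k) (cong₂ _+_ (seq-⟦⟧ᴿ P x k) (seq-⟦⟧ᴿ Q x k))
  seq-⟦⟧ᴿ (P :* Q) x k = trans (seq-⊠ (⟦ P ⟧ᴿ x) (⟦ Q ⟧ᴿ x) k) (cong₂ _*_ (seq-⟦⟧ᴿ P x k) (seq-⟦⟧ᴿ Q x k))

  ⟦⟧ᴿ-cong : ∀ P {x y} → x ≈ y → ⟦ P ⟧ᴿ x ≈ ⟦ P ⟧ᴿ y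
  ⟦⟧ᴿ-cong var      x≈y = x≈y
  ⟦⟧ᴿ-cong (con q)  x≈y = ≈-refl
  ⟦⟧ᴿ-cong (P :+ Q) x≈y = ⊞-cong (⟦⟧ᴿ-cong P x≈y) (⟦⟧ᴿ-cong Q x≈y)
  ⟦⟧ᴿ-cong (P :* Q) x≈y = ⊠-cong (⟦⟧ᴿ-cong P x≈y) (⟦⟧ᴿ-cong Q x≈y)

  record Bracket (f : ℚ → ℚ) : Set where
    constructor bracket
    field
      lower upper : ℚ
      ordered     : lower ≤ upper
      below       : f lower ≤ 0ℚ
      above       : 0ℚ ≤ f upper

    midpoint : ℚ
    midpoint = (lower + upper) * ½

    width : ℚ
    width = upper - lower

    lower≤midpoint : lower ≤ midpoint
    lower≤midpoint = ≤-by (width * ½) (diff ordered ⊛ nonNegative⁻¹ ½)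
      (trans (cong (λ q → midpoint - q) (sym (trans (sym (*-distribˡ-+ lower ½ ½)) (*-identityʳ lower))))
        (rearrange lower upper ½))
      where
      rearrange : ∀ l u h → (l + u) * h - (l * h + l * h) ≡ (u - l) * h
      rearrange = solve-∀ ring

    midpoint≤upper : midpoint ≤ upper
    midpoint≤upper = ≤-by (width * ½) (diff ordered ⊛ nonNegative⁻¹ ½)
      (trans (cong (_- midpoint) (sym (trans (sym (*-distribˡ-+ upper ½ ½)) (*-identityʳ upper))))
        (rearrange lower upper ½))
      where
      rearrange : ∀ l u h → u * h + u * h - (l + u) * h ≡ (u - l) * h
      rearrange = solve-∀ ring

  open Bracket

  module _ {f : ℚ → ℚ} where

    -- The endpoints stay rational, so the sign of f at the midpoint is decidable.
    halve : (B : Bracket f) → ∃ λ (B′ : Bracket f) → lower B ≤ lower B′ × upper B′ ≤ upper B ×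
                                        width B′ ≡ width B * ½
    halve B with f (midpoint B) ≤? 0ℚ
    ... | yes fm≤0 = bracket (midpoint B) (upper B) (midpoint≤upper B) fm≤0 (above B)
      , lower≤midpoint B , ≤-refl
      , trans (cong (_- midpoint B) (sym (trans (sym (*-distribˡ-+ (upper B) ½ ½)) (*-identityʳ (upper B)))))
          (rearrange (lower B) (upper B) ½)
      where
      rearrange : ∀ l u h → u * h + u * h - (l + u) * h ≡ (u - l) * h
      rearrange = solve-∀ ring
    ... | no fm≰0 = bracket (lower B) (midpoint B) (lower≤midpoint B) (below B) (<⇒≤ (≰⇒> fm≰0))
      , ≤-refl , midpoint≤upper B
      , trans (cong (λ q → midpoint B - q) (sym (trans (sym (*-distribˡ-+ (lower B) ½ ½)) (*-identityʳ (lower B)))))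
          (rearrange (lower B) (upper B) ½)
      where
      rearrange : ∀ l u h → (l + u) * h - (l * h + l * h) ≡ (u - l) * h
      rearrange = solve-∀ ring

    module _ (B₀ : Bracket f) {W : ℕ} (width≤W : width B₀ ≤ ι (ℤ.+ W)) where

      brackets : ℕ → Bracket f
      brackets zero    = B₀
      brackets (suc k) = proj₁ (halve (brackets k))

      private
        l u : ℕ → ℚ
        l = lower ∘ brackets
        u = upper ∘ brackets

      l-mono : ∀ d k → l k ≤ l (d ℕ.+ k)
      l-mono zero    k = ≤-refl
      l-mono (suc d) k = ≤-trans (l-mono d k) (proj₁ (proj₂ (halve (brackets (d ℕ.+ k)))))

      u-anti : ∀ d k → u (d ℕ.+ k) ≤ u k
      u-anti zero    k = ≤-refl
      u-anti (suc d) k = ≤-trans (proj₁ (proj₂ (proj₂ (halve (brackets (d ℕ.+ k)))))) (u-anti d k)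

      l-mono-≤ : ∀ {k m} → k ℕ.≤ m → l k ≤ l m
      l-mono-≤ {k} {m} k≤m = subst (λ m → l k ≤ l m) (ℕ.m∸n+n≡m k≤m) (l-mono (m ℕ.∸ k) k)

      u-anti-≤ : ∀ {k m} → k ℕ.≤ m → u m ≤ u k
      u-anti-≤ {k} {m} k≤m = subst (λ m → u m ≤ u k) (ℕ.m∸n+n≡m k≤m) (u-anti (m ℕ.∸ k) k)

      -- One halving takes a width of at most (m + 2)ε to at most (m + 1)ε, because m + 2 ≤ 2(m +
      -- 1). This crude count makes powers of 2 unnecessary.
      shrink : ∀ ε → 0ℚ < ε → ∀ m k → width (brackets k) ≤ ι (ℤ.+ suc m) * ε →
               ∃ λ N → width (brackets N) ≤ ε
      shrink ε 0<ε zero k h = k , subst (width (brackets k) ≤_) (trans (cong (_* ε) ι-1) (*-identityˡ ε)) h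
      shrink ε 0<ε (suc m) k h = shrink ε 0<ε m (suc k) (begin
        width (brackets (suc k))           ≡⟨ proj₂ (proj₂ (proj₂ (halve (brackets k)))) ⟩
        width (brackets k) * ½             ≤⟨ *-monoʳ-≤-nonNeg ½ h ⟩
        ι (ℤ.+ suc (suc m)) * ε * ½        ≤⟨ *-monoʳ-≤-nonNeg ½ (*-monoʳ-≤-nonNeg ε {{nonNegative (<⇒≤ 0<ε)}}
                                                (ι-mono (ℤ.+≤+ (ℕ.s≤s (subst (suc m ℕ.≤_) (sym (ℕ.+-suc m m)) (ℕ.s≤s (ℕ.m≤m+n m m))))))) ⟩
        ι (ℤ.+ (suc m ℕ.+ suc m)) * ε * ½  ≡⟨ cong (λ q → q * ε * ½) (ι-+ (ℤ.+ suc m) (ℤ.+ suc m)) ⟩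
        (ι (ℤ.+ suc m) + ι (ℤ.+ suc m)) * ε * ½
                                           ≡⟨ distribute (ι (ℤ.+ suc m)) ε ½ ⟩
        ι (ℤ.+ suc m) * (ε * ½ + ε * ½)    ≡⟨ cong (ι (ℤ.+ suc m) *_) (half+half ε) ⟩
        ι (ℤ.+ suc m) * ε                  ∎)
        where
        open ≤-Reasoning
        distribute : ∀ i e h → (i + i) * e * h ≡ i * (e * h + e * h)
        distribute = solve-∀ ring

      narrow : ∀ ε → 0ℚ < ε → ∃ λ N → width (brackets N) ≤ ε
      narrow ε 0<ε with n , W≤nε ← archimedean W ε 0<ε = shrink ε 0<ε n 0
        (≤-trans width≤W (≤-trans W≤nε (*-monoʳ-≤-nonNeg ε {{nonNegative (<⇒≤ 0<ε)}}
          (ι-mono (ℤ.+≤+ (ℕ.n≤1+n n))))))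

      within-width : ∀ {N p q} → l N ≤ p → p ≤ u N → l N ≤ q → q ≤ u N →
                     ∣ p - q ∣ ≤ width (brackets N)
      within-width {N} {p} {q} l≤p p≤u l≤q q≤u = ∣p∣≤
        (≤-by _ (diff p≤u ⊕ diff l≤q) (gap₁ (l N) (u N) p q))
        (≤-by _ (diff q≤u ⊕ diff l≤p) (gap₂ (l N) (u N) p q))
        where
        gap₁ : ∀ l u p q → u - l - (p - q) ≡ u - p + (q - l)
        gap₁ = solve-∀ ring
        gap₂ : ∀ l u p q → u - l - - (p - q) ≡ u - q + (p - l)
        gap₂ = solve-∀ ring

      lower-limit upper-limit : ℝ
      lower-limit = mkℝ l λ ε 0<ε → let N , small = narrow ε 0<ε in N , λ m n N≤m N≤n →
        ≤-trans (within-width {N} (l-mono-≤ N≤m) (≤-trans (ordered (brackets m)) (u-anti-≤ N≤m))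
                                  (l-mono-≤ N≤n) (≤-trans (ordered (brackets n)) (u-anti-≤ N≤n))) small
      upper-limit = mkℝ u λ ε 0<ε → let N , small = narrow ε 0<ε in N , λ m n N≤m N≤n →
        ≤-trans (within-width {N} (≤-trans (l-mono-≤ N≤m) (ordered (brackets m))) (u-anti-≤ N≤m)
                                  (≤-trans (l-mono-≤ N≤n) (ordered (brackets n))) (u-anti-≤ N≤n)) small

      limits-agree : lower-limit ≃ upper-limit
      limits-agree ε 0<ε = let N , small = narrow ε 0<ε in N , λ n N≤n →
        ≤-trans (within-width {N} (l-mono-≤ N≤n) (≤-trans (ordered (brackets n)) (u-anti-≤ N≤n))
                                  (≤-trans (l-mono-≤ N≤n) (ordered (brackets n))) (u-anti-≤ N≤n)) small

      lo≤u : ∀ k → lower B₀ ≤ u k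
      lo≤u k = ≤-trans (l-mono-≤ {0} {k} ℕ.z≤n) (ordered (brackets k))

  -- The root is the limit of the upper ends, where f is nonnegative.
  root-between : ∀ P W (B : Bracket ⟦ P ⟧ℚ) → width B ≤ ι (ℤ.+ W) →
                 ∃ λ ρ → ⟦ P ⟧ᴿ ρ ≈ κ 0ℚ × (∀ k → lower B ≤ seq ρ k) × (∀ k → 0ℚ ≤ ⟦ P ⟧ℚ (seq ρ k))
  root-between P W B width≤W = upper-limit B width≤W
    , ≼-antisym
        (≼-trans (≼-reflexive (⟦⟧ᴿ-cong P (≈-sym (≃⇒≈ {lower-limit B width≤W} {upper-limit B width≤W} (limits-agree B width≤W)))))
          (≼-pointwise λ k → subst₂ _≤_ (sym (seq-⟦⟧ᴿ P (lower-limit B width≤W) k)) (sym (seq-κ 0ℚ k))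
            (below (brackets B width≤W k))))
        (≼-pointwise λ k → subst₂ _≤_ (sym (seq-κ 0ℚ k)) (sym (seq-⟦⟧ᴿ P (upper-limit B width≤W) k))
          (above (brackets B width≤W k)))
    , lo≤u B width≤W
    , λ k → above (brackets B width≤W k)

-- Spectral inequalities from moduli of eigenvectors.

module Spectral where

  open import Defs hiding (sum)
  import Defs
  open IntegerSums using (Σℤ; Σ-nil; Σ-cons; ⟦_⟧; ⟦⟧≥0; #; δ)
  open Rationals using (ι; ι-0; ι-1; ι-+; ι-*; ι-mono; 0≤1)
  open Reals
  open import Data.Bool.Base using (Bool; true; false)
  open import Data.Fin.Base using (Fin; zero; suc)
  open import Data.Integer.Base as ℤ using (ℤ)
  open import Data.Nat.Base using (zero; suc)
  open import Data.Product.Base using (_,_)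
  open import Data.Rational.Base as ℚ using (ℚ; 0ℚ; 1ℚ)
  import Data.Rational.Properties as ℚ
  open import Function.Base using (_∘_)
  open import Relation.Binary.Construct.Closure.ReflexiveTransitive using (Star; ε; _◅_)
  open import Relation.Binary.PropositionalEquality using (_≡_; sym; cong; subst)
  open import Relation.Nullary using (¬_)

  open ℝ-Semiring using (*-assoc; *-comm; *-identityˡ; *-identityʳ; +-identityʳ; zeroˡ; zeroʳ)
  open ≼-Reasoning

  0ʳ 1ʳ : ℝ
  0ʳ = κ 0ℚ
  1ʳ = κ 1ℚ

  int : ℤ → ℝ
  int i = κ (ι i)

  int-nonneg : ∀ {i} → ℤ.0ℤ ℤ.≤ i → 0ʳ ≼ int i
  int-nonneg {i} 0≤i = κ-mono (subst (ℚ._≤ ι i) ι-0 (ι-mono 0≤i))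

  int-mono : ∀ {i j} → i ℤ.≤ j → int i ≼ int j
  int-mono i≤j = κ-mono (ι-mono i≤j)

  int-⊠ : ∀ i j → int i ⊠ int j ≈ int (i ℤ.* j)
  int-⊠ i j = ≈-trans (κ-⊠ (ι i) (ι j)) (≈-pointwise λ k → cong (λ q → seq (κ q) k) (sym (ι-* i j)))

  int-⊞ : ∀ i j → int i ⊞ int j ≈ int (i ℤ.+ j)
  int-⊞ i j = ≈-trans (κ-⊞ (ι i) (ι j)) (≈-pointwise λ k → cong (λ q → seq (κ q) k) (sym (ι-+ i j)))

  int-0 : int ℤ.0ℤ ≈ 0ʳ
  int-0 = ≡⇒≈ (cong κ ι-0)

  int-1 : int ℤ.1ℤ ≈ 1ʳ
  int-1 = ≡⇒≈ (cong κ ι-1)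

  Σᴿ-int : ∀ {n} (f : Fin n → ℤ) → Σᴿ (int ∘ f) ≈ int (Σℤ f)
  Σᴿ-int {zero}  f = ≈-trans (≡⇒≈ (Σᴿ-nil (int ∘ f)))
    (≈-sym (≈-trans (≡⇒≈ (cong int (Σ-nil f))) int-0))
  Σᴿ-int {suc n} f = begin-equality
    Σᴿ (int ∘ f)                       ≈⟨ ≡⇒≈ (Σᴿ-cons (int ∘ f)) ⟩
    int (f zero) ⊞ Σᴿ (int ∘ f ∘ suc)  ≈⟨ ⊞-cong ≈-refl (Σᴿ-int (f ∘ suc)) ⟩
    int (f zero) ⊞ int (Σℤ (f ∘ suc))  ≈⟨ int-⊞ (f zero) (Σℤ (f ∘ suc)) ⟩
    int (f zero ℤ.+ Σℤ (f ∘ suc))      ≈⟨ ≡⇒≈ (cong int (Σ-cons f)) ⟨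
    int (Σℤ f)                         ∎

  ⟪_⟫ : Bool → ℝ
  ⟪ b ⟫ = int ⟦ b ⟧

  Σᴿ-δ : ∀ {n} (i : Fin n) (f : Fin n → ℝ) → Σᴿ (λ j → ⟪ δ i j ⟫ ⊠ f j) ≈ f i
  Σᴿ-δ {suc n} zero f = begin-equality
    Σᴿ (λ j → ⟪ δ zero j ⟫ ⊠ f j)
      ≈⟨ ≡⇒≈ (Σᴿ-cons (λ j → ⟪ δ zero j ⟫ ⊠ f j)) ⟩
    int ℤ.1ℤ ⊠ f zero ⊞ Σᴿ (λ j → int ℤ.0ℤ ⊠ f (suc j))
      ≈⟨ ⊞-cong (≈-trans (⊠-congʳ int-1) (*-identityˡ (f zero)))
                (Σᴿ-zero λ j → ≈-trans (⊠-congʳ int-0) (zeroˡ (f (suc j)))) ⟩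
    f zero ⊞ 0ʳ
      ≈⟨ +-identityʳ (f zero) ⟩
    f zero ∎
  Σᴿ-δ {suc n} (suc i) f = begin-equality
    Σᴿ (λ j → ⟪ δ (suc i) j ⟫ ⊠ f j)
      ≈⟨ ≡⇒≈ (Σᴿ-cons (λ j → ⟪ δ (suc i) j ⟫ ⊠ f j)) ⟩
    int ℤ.0ℤ ⊠ f zero ⊞ Σᴿ (λ j → ⟪ δ i j ⟫ ⊠ f (suc j))
      ≈⟨ ⊞-cong (≈-trans (⊠-congʳ int-0) (zeroˡ (f zero))) (Σᴿ-δ i (f ∘ suc)) ⟩
    0ʳ ⊞ f (suc i)
      ≈⟨ ℝ-Semiring.+-identityˡ (f (suc i)) ⟩
    f (suc i) ∎

  0≼⟪⟫ : ∀ b → 0ʳ ≼ ⟪ b ⟫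
  0≼⟪⟫ b = int-nonneg (⟦⟧≥0 b)

  pull-scalar : ∀ {n} ρ (w z : Fin n → ℝ) → ρ ⊠ Σᴿ (λ i → w i ⊠ z i) ≈ Σᴿ (λ i → w i ⊠ (ρ ⊠ z i))
  pull-scalar ρ w z = ≈-trans (Σᴿ-distribˡ-⊠ ρ (λ i → w i ⊠ z i)) (Σᴿ-cong λ i →
    ≈-trans (≈-sym (*-assoc ρ (w i) (z i)))
      (≈-trans (⊠-congʳ (*-comm ρ (w i))) (*-assoc (w i) ρ (z i))))

  infixr 8 _·_

  _·_ : ∀ {n} → (Fin n → Fin n → Bool) → (Fin n → ℝ) → Fin n → ℝ
  (A · w) i = Σᴿ (λ j → ⟪ A i j ⟫ ⊠ w j)

  module _ {n} (A : Fin n → Fin n → Bool) where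

    ·-nonneg : ∀ {w} → (∀ i → 0ʳ ≼ w i) → ∀ i → 0ʳ ≼ (A · w) i
    ·-nonneg 0≼w i = Σᴿ-nonneg λ j → ⊠-nonneg (0≼⟪⟫ (A i j)) (0≼w j)

    exchange : (∀ i j → A i j ≡ A j i) → ∀ w z →
               Σᴿ (λ i → w i ⊠ (A · z) i) ≈ Σᴿ (λ j → (A · w) j ⊠ z j)
    exchange A-sym w z = begin-equality
      Σᴿ (λ i → w i ⊠ (A · z) i)
        ≈⟨ Σᴿ-cong (λ i → Σᴿ-distribˡ-⊠ (w i) (λ j → ⟪ A i j ⟫ ⊠ z j)) ⟩
      Σᴿ (λ i → Σᴿ (λ j → w i ⊠ (⟪ A i j ⟫ ⊠ z j)))
        ≈⟨ Σᴿ-comm (λ i j → w i ⊠ (⟪ A i j ⟫ ⊠ z j)) ⟩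
      Σᴿ (λ j → Σᴿ (λ i → w i ⊠ (⟪ A i j ⟫ ⊠ z j)))
        ≈⟨ Σᴿ-cong (λ j → Σᴿ-cong λ i → begin-equality
             w i ⊠ (⟪ A i j ⟫ ⊠ z j)   ≈⟨ *-assoc (w i) ⟪ A i j ⟫ (z j) ⟨
             w i ⊠ ⟪ A i j ⟫ ⊠ z j     ≈⟨ ⊠-congʳ (*-comm (w i) ⟪ A i j ⟫) ⟩
             ⟪ A i j ⟫ ⊠ w i ⊠ z j     ≈⟨ ⊠-congʳ (⊠-congʳ (≡⇒≈ (cong ⟪_⟫ (A-sym i j)))) ⟩
             ⟪ A j i ⟫ ⊠ w i ⊠ z j     ∎) ⟩
      Σᴿ (λ j → Σᴿ (λ i → ⟪ A j i ⟫ ⊠ w i ⊠ z j))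
        ≈⟨ Σᴿ-cong (λ j → Σᴿ-distribʳ-⊠ (z j) (λ i → ⟪ A j i ⟫ ⊠ w i)) ⟨
      Σᴿ (λ j → (A · w) j ⊠ z j) ∎

    weighted : (∀ i j → A i j ≡ A j i) → ∀ ρ (w z : Fin n → ℝ) → (∀ i → 0ʳ ≼ w i) →
               (∀ i → ρ ⊠ z i ≼ (A · z) i) →
               ρ ⊠ Σᴿ (λ i → w i ⊠ z i) ≼ Σᴿ (λ j → (A · w) j ⊠ z j)
    weighted A-sym ρ w z 0≼w ρz≼Az = begin
      ρ ⊠ Σᴿ (λ i → w i ⊠ z i)      ≈⟨ pull-scalar ρ w z ⟩
      Σᴿ (λ i → w i ⊠ (ρ ⊠ z i))    ≲⟨ Σᴿ-mono (λ i → ⊠-monoʳ (0≼w i) (ρz≼Az i)) ⟩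
      Σᴿ (λ i → w i ⊠ (A · z) i)      ≈⟨ exchange A-sym w z ⟩
      Σᴿ (λ j → (A · w) j ⊠ z j)      ∎

  entry : ∀ {n} (G : Graph n) i j → adjacencyMatrix G i j ≈ ⟪ adj G i j ⟫
  entry G i j with adj G i j
  ... | true  = ≈-trans (≡⇒≈ (κ-def 1ℚ)) (≈-sym int-1)
  ... | false = ≈-trans (≡⇒≈ (κ-def 0ℚ)) (≈-sym int-0)

  eigenvalue-intro : ∀ {n} (G : Graph n) μ (x : Fin n → ℝ) → ¬ (∀ i → x i ≈ 0ʳ) →
                     (∀ i → (adj G · x) i ≈ μ ⊠ x i) → IsEigenvalue (adjacencyMatrix G) μ
  eigenvalue-intro G μ x x≉0 Gx≈μx = x
    , (λ x≃0 → x≉0 λ i → ≈-trans (≃⇒≈ {x i} {0ᴿ} (x≃0 i)) (≡⇒≈ (κ-def 0ℚ)))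
    , λ i → eigenvector-equation⁻ (adjacencyMatrix G) μ x i
        (≈-trans (Σᴿ-cong λ j → ⊠-congʳ (entry G i j)) (Gx≈μx i))

  -- The substitute for a Perron vector: a nonnegative vector that `A` stretches by at least ρ.
  -- `nonzero` is a negated statement, so the arguments that use it show that every entry is at most
  -- 0.
  record Modulus {n} (A : Fin n → Fin n → Bool) (ρ : ℝ) : Set where
    field
      modulus  : Fin n → ℝ
      nonneg   : ∀ i → 0ʳ ≼ modulus i
      nonzero  : ¬ (∀ i → modulus i ≼ 0ʳ)
      subeigen : ∀ i → ρ ⊠ modulus i ≼ (A · modulus) i

  -- The triangle inequality in each row of the eigenvalue equation; ρ ≤ |ρ| covers eigenvalues of
  -- either sign.
  eigenvalue⇒modulus : ∀ {n} (G : Graph n) ρ → IsEigenvalue (adjacencyMatrix G) ρ →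
                       Modulus (adj G) ρ
  eigenvalue⇒modulus G ρ (x , x≄0 , Ax≃ρx) = record
    { modulus  = λ i → ∣ x i ∣ᴿ
    ; nonneg   = λ i → 0≼∣x∣ (x i)
    ; nonzero  = λ ∣x∣≼0 → x≄0 λ i → ≈⇒≃ (≈-trans (∣x∣≼0⇒x≈0 (∣x∣≼0 i)) (≡⇒≈ (sym (κ-def 0ℚ))))
    ; subeigen = λ i → begin
        ρ ⊠ ∣ x i ∣ᴿ
          ≲⟨ ⊠-monoˡ (0≼∣x∣ (x i)) (x≼∣x∣ ρ) ⟩
        ∣ ρ ∣ᴿ ⊠ ∣ x i ∣ᴿ
          ≈⟨ ∣x⊠y∣≈ ρ (x i) ⟨
        ∣ ρ ⊠ x i ∣ᴿ
          ≈⟨ ∣-∣-cong (Ax≈ρx i) ⟨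
        ∣ Σᴿ (λ j → ⟪ adj G i j ⟫ ⊠ x j) ∣ᴿ
          ≲⟨ ∣Σ∣≼Σ∣∣ (λ j → ⟪ adj G i j ⟫ ⊠ x j) ⟩
        Σᴿ (λ j → ∣ ⟪ adj G i j ⟫ ⊠ x j ∣ᴿ)
          ≈⟨ Σᴿ-cong (λ j → ≈-trans (∣x⊠y∣≈ ⟪ adj G i j ⟫ (x j)) (⊠-congʳ (0≼⇒∣x∣≈x (0≼⟪⟫ (adj G i j))))) ⟩
        Σᴿ (λ j → ⟪ adj G i j ⟫ ⊠ ∣ x j ∣ᴿ) ∎
    }
    where
    Ax≈ρx : ∀ i → Σᴿ (λ j → ⟪ adj G i j ⟫ ⊠ x j) ≈ ρ ⊠ x i
    Ax≈ρx i = begin-equality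
      Σᴿ (λ j → ⟪ adj G i j ⟫ ⊠ x j)
        ≈⟨ Σᴿ-cong (λ j → ⊠-congʳ (entry G i j)) ⟨
      Σᴿ (λ j → adjacencyMatrix G i j ⊠ x j)
        ≈⟨ eigenvector-equation (adjacencyMatrix G) ρ x i (Ax≃ρx i) ⟩
      ρ ⊠ x i ∎

  open Modulus

  -- ρ² ∑ᵢ zᵢ ≤ ∑ᵢ (A²1)ᵢ zᵢ for the moduli zᵢ of an eigenvector of ρ.
  row-sum-bound : ∀ {n} (A : Fin n → Fin n → Bool) → (∀ i j → A i j ≡ A j i) → ∀ D →
    (∀ i → Σℤ (λ j → ⟦ A i j ⟧ ℤ.* # (A j)) ℤ.≤ D) →
    ∀ ρ → 0ʳ ≼ ρ → Modulus A ρ → ¬ (int (D ℤ.+ ℤ.1ℤ) ≼ ρ ⊠ ρ)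
  row-sum-bound A A-sym D A²1≤D ρ 0≼ρ Z D<ρ² = nonzero Z λ i → Σᴿ-rigid (nonneg Z)
      (≼-trans s≼0 (≼-reflexive (≈-sym (Σᴿ-zero λ _ → ≈-refl)))) i
    where
    z = modulus Z
    s = Σᴿ z
    1≈ : ∀ i → (A · λ _ → 1ʳ) i ≈ int (# (A i))
    1≈ i = ≈-trans (Σᴿ-cong λ j → *-identityʳ ⟪ A i j ⟫) (Σᴿ-int (λ j → ⟦ A i j ⟧))

    Ad≼D : ∀ i → (A · λ j → int (# (A j))) i ≼ int D
    Ad≼D i = begin
      Σᴿ (λ j → ⟪ A i j ⟫ ⊠ int (# (A j)))          ≈⟨ Σᴿ-cong (λ j → int-⊠ ⟦ A i j ⟧ (# (A j))) ⟩
      Σᴿ (λ j → int (⟦ A i j ⟧ ℤ.* # (A j)))        ≈⟨ Σᴿ-int (λ j → ⟦ A i j ⟧ ℤ.* # (A j)) ⟩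
      int (Σℤ (λ j → ⟦ A i j ⟧ ℤ.* # (A j)))        ≲⟨ int-mono (A²1≤D i) ⟩
      int D                                         ∎

    0≼d : ∀ i → 0ʳ ≼ int (# (A i))
    0≼d i = ≼-trans (·-nonneg A (λ _ → κ-mono 0≤1) i) (≼-reflexive (1≈ i))

    ρs≼ : ρ ⊠ s ≼ Σᴿ (λ j → int (# (A j)) ⊠ z j)
    ρs≼ = begin
      ρ ⊠ s                                  ≈⟨ ⊠-cong ≈-refl (Σᴿ-cong λ i → *-identityˡ (z i)) ⟨
      ρ ⊠ Σᴿ (λ i → 1ʳ ⊠ z i)                ≲⟨ weighted A A-sym ρ (λ _ → 1ʳ) z (λ _ → κ-mono 0≤1) (subeigen Z) ⟩
      Σᴿ (λ j → (A · λ _ → 1ʳ) j ⊠ z j)      ≈⟨ Σᴿ-cong (λ j → ⊠-congʳ (1≈ j)) ⟩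
      Σᴿ (λ j → int (# (A j)) ⊠ z j)         ∎

    -- After a pass with all weights 1, this second pass weights by the degrees A1, which brings in
    -- the row sums A(A1) of A².
    ρ²s≼Ds : (ρ ⊠ ρ) ⊠ s ≼ int D ⊠ s
    ρ²s≼Ds = begin
      (ρ ⊠ ρ) ⊠ s                                        ≈⟨ *-assoc ρ ρ s ⟩
      ρ ⊠ (ρ ⊠ s)                                        ≲⟨ ⊠-monoʳ 0≼ρ ρs≼ ⟩
      ρ ⊠ Σᴿ (λ j → int (# (A j)) ⊠ z j)                 ≲⟨ weighted A A-sym ρ (λ j → int (# (A j))) z 0≼d (subeigen Z) ⟩
      Σᴿ (λ j → (A · λ j → int (# (A j))) j ⊠ z j)       ≲⟨ Σᴿ-mono (λ j → ⊠-monoˡ (nonneg Z j) (Ad≼D j)) ⟩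
      Σᴿ (λ j → int D ⊠ z j)                             ≈⟨ Σᴿ-distribˡ-⊠ (int D) z ⟨
      int D ⊠ s                                          ∎

    -- The gap of 1 between the two bounds on ρ² gives (D + 1)s ≤ Ds, and Ds cancels.
    s≼0 : s ≼ 0ʳ
    s≼0 = ⊞-cancelˡ (int D ⊠ s) (begin
      int D ⊠ s ⊞ s                   ≈⟨ ⊞-cong ≈-refl (≈-trans (⊠-congʳ int-1) (*-identityˡ s)) ⟨
      int D ⊠ s ⊞ int ℤ.1ℤ ⊠ s        ≈⟨ ℝ-Semiring.distribʳ s (int D) (int ℤ.1ℤ) ⟨
      (int D ⊞ int ℤ.1ℤ) ⊠ s          ≈⟨ ⊠-congʳ (int-⊞ D ℤ.1ℤ) ⟩
      int (D ℤ.+ ℤ.1ℤ) ⊠ s            ≲⟨ ⊠-monoˡ (Σᴿ-nonneg (nonneg Z)) D<ρ² ⟩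
      (ρ ⊠ ρ) ⊠ s                     ≲⟨ ρ²s≼Ds ⟩
      int D ⊠ s                       ≈⟨ +-identityʳ (int D ⊠ s) ⟨
      int D ⊠ s ⊞ 0ʳ                  ∎)

  -- The weights y turn the eigenvalue inequality for A into an equality, which
  -- kills z at a missing edge, and then everywhere along the connected graph A.
  no-proper-subgraph : ∀ {n} (A B : Fin n → Fin n → Bool) → (∀ i j → A i j ≡ A j i) →
    (∀ i j → Star (λ u v → A u v ≡ true) i j) →
    (∀ i j → A i j ≡ true → B i j ≡ true) →
    ∀ ρ ρ′ y → ρ′ ≼ ρ → (∀ i → 1ʳ ≼ y i) → (∀ i → (B · y) i ≈ ρ′ ⊠ y i) →
    Modulus A ρ → ∀ i k → B i k ≡ true → ¬ (A i k ≡ false)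
  no-proper-subgraph A B A-sym connected A⊆B ρ ρ′ y ρ′≼ρ 1≼y By≈ρ′y Z i₀ k₀ B-edge A-gap =
    nonzero Z λ i → propagate (connected i₀ i) zi₀≼0
    where
    z = modulus Z

    0≼y : ∀ i → 0ʳ ≼ y i
    0≼y i = ≼-trans (κ-mono 0≤1) (1≼y i)

    ρ′z≼Az : ∀ i → ρ′ ⊠ z i ≼ (A · z) i
    ρ′z≼Az i = ≼-trans (⊠-monoˡ (nonneg Z i) ρ′≼ρ) (subeigen Z i)

    A≼B : ∀ i j → ⟪ A i j ⟫ ≼ ⟪ B i j ⟫
    A≼B i j with A i j in eq
    ... | false = ≼-trans (≼-reflexive int-0) (0≼⟪⟫ (B i j))
    ... | true rewrite A⊆B i j eq = ≼-refl

    Ay≼By : ∀ j → (A · y) j ≼ (B · y) j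
    Ay≼By j = Σᴿ-mono λ k → ⊠-monoˡ (0≼y k) (A≼B j k)

    By·z : Σᴿ (λ j → (B · y) j ⊠ z j) ≈ ρ′ ⊠ Σᴿ (λ j → y j ⊠ z j)
    By·z = ≈-trans (Σᴿ-cong λ j → ≈-trans (⊠-congʳ (By≈ρ′y j)) (*-assoc ρ′ (y j) (z j)))
      (≈-sym (Σᴿ-distribˡ-⊠ ρ′ (λ j → y j ⊠ z j)))

    -- The circle ρ′⟨y,z⟩ ≤ ⟨Ay,z⟩ ≤ ⟨By,z⟩ = ρ′⟨y,z⟩ makes every inequality in it tight in each
    -- coordinate. Here this is used to compare Ay with By, and in `tight-A` to compare Az with ρ′z.
    tight-B : ∀ j → (B · y) j ⊠ z j ≼ (A · y) j ⊠ z j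
    tight-B = Σᴿ-rigid (λ j → ⊠-monoˡ (nonneg Z j) (Ay≼By j)) (begin
      Σᴿ (λ j → (B · y) j ⊠ z j)       ≈⟨ By·z ⟩
      ρ′ ⊠ Σᴿ (λ j → y j ⊠ z j)        ≲⟨ weighted A A-sym ρ′ y z 0≼y ρ′z≼Az ⟩
      Σᴿ (λ j → (A · y) j ⊠ z j)       ∎)

    tight-A : ∀ j → y j ⊠ (A · z) j ≼ y j ⊠ (ρ′ ⊠ z j)
    tight-A = Σᴿ-rigid (λ j → ⊠-monoʳ (0≼y j) (ρ′z≼Az j)) (begin
      Σᴿ (λ j → y j ⊠ (A · z) j)       ≈⟨ exchange A A-sym y z ⟩
      Σᴿ (λ j → (A · y) j ⊠ z j)       ≲⟨ Σᴿ-mono (λ j → ⊠-monoˡ (nonneg Z j) (Ay≼By j)) ⟩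
      Σᴿ (λ j → (B · y) j ⊠ z j)       ≈⟨ By·z ⟩
      ρ′ ⊠ Σᴿ (λ j → y j ⊠ z j)        ≈⟨ pull-scalar ρ′ y z ⟩
      Σᴿ (λ j → y j ⊠ (ρ′ ⊠ z j))      ∎)

    -- Entries of y that are at least 1 take the place of division by `y j`.
    absorb : ∀ j {x} → 0ʳ ≼ x → x ≼ y j ⊠ x
    absorb j {x} 0≼x = ≼-trans (≼-reflexive (≈-sym (*-identityˡ x))) (⊠-monoˡ 0≼x (1≼y j))

    zi₀≼0 : z i₀ ≼ 0ʳ
    zi₀≼0 = begin
      z i₀                                   ≲⟨ absorb k₀ (nonneg Z i₀) ⟩
      y k₀ ⊠ z i₀                            ≈⟨ ⊠-congʳ (≈-trans (⊠-congʳ (≈-trans (≡⇒≈ (cong ⟪_⟫ B-edge)) int-1)) (*-identityˡ (y k₀))) ⟨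
      -- The equality of row i₀ from `tight-B` is split into its terms. The term of the missing edge
      -- is y k₀ times z i₀ for B and 0 for A.
      ⟪ B i₀ k₀ ⟫ ⊠ y k₀ ⊠ z i₀              ≲⟨ Σᴿ-rigid (λ k → ⊠-monoˡ (nonneg Z i₀) (⊠-monoˡ (0≼y k) (A≼B i₀ k))) sums k₀ ⟩
      ⟪ A i₀ k₀ ⟫ ⊠ y k₀ ⊠ z i₀              ≈⟨ ⊠-congʳ (≈-trans (⊠-congʳ (≈-trans (≡⇒≈ (cong ⟪_⟫ A-gap)) int-0)) (zeroˡ (y k₀))) ⟩
      0ʳ ⊠ z i₀                              ≈⟨ zeroˡ (z i₀) ⟩
      0ʳ                                     ∎
      where
      sums : Σᴿ (λ k → ⟪ B i₀ k ⟫ ⊠ y k ⊠ z i₀) ≼ Σᴿ (λ k → ⟪ A i₀ k ⟫ ⊠ y k ⊠ z i₀)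
      sums = ≼-trans (≼-reflexive (≈-sym (Σᴿ-distribʳ-⊠ (z i₀) (λ k → ⟪ B i₀ k ⟫ ⊠ y k))))
        (≼-trans (tight-B i₀) (≼-reflexive (Σᴿ-distribʳ-⊠ (z i₀) (λ k → ⟪ A i₀ k ⟫ ⊠ y k))))

    -- Where z vanishes, tightness makes (A · z) j vanish as well. This is a sum of nonnegative
    -- terms, so z vanishes at every neighbour.
    step : ∀ j k → A j k ≡ true → z j ≼ 0ʳ → z k ≼ 0ʳ
    step j k Ajk zj≼0 = ≼-trans (≼-reflexive (≈-sym Az≈z)) (Σᴿ-rigid
        (λ k → ⊠-nonneg (0≼⟪⟫ (A j k)) (nonneg Z k))
        (≼-trans Az≼0 (≼-reflexive (≈-sym (Σᴿ-zero λ _ → ≈-refl)))) k)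
      where
      Az≈z : ⟪ A j k ⟫ ⊠ z k ≈ z k
      Az≈z = ≈-trans (⊠-congʳ (≈-trans (≡⇒≈ (cong ⟪_⟫ Ajk)) int-1)) (*-identityˡ (z k))
      zj≈0 : z j ≈ 0ʳ
      zj≈0 = ≼-antisym zj≼0 (nonneg Z j)
      Az≼0 : (A · z) j ≼ 0ʳ
      Az≼0 = begin
        (A · z) j                ≲⟨ absorb j (·-nonneg A (nonneg Z) j) ⟩
        y j ⊠ (A · z) j          ≲⟨ tight-A j ⟩
        y j ⊠ (ρ′ ⊠ z j)         ≈⟨ ⊠-cong ≈-refl (≈-trans (⊠-cong ≈-refl zj≈0) (zeroʳ ρ′)) ⟩
        y j ⊠ 0ʳ                 ≈⟨ zeroʳ (y j) ⟩
        0ʳ                       ∎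

    propagate : ∀ {j k : Fin _} → Star (λ u v → A u v ≡ true) j k → z j ≼ 0ʳ → z k ≼ 0ʳ
    propagate ε              zj≼0 = zj≼0
    propagate (Ajl ◅ path)   zj≼0 = propagate path (step _ _ Ajl zj≼0)

-- The quotient matrix of H, its largest root and a positive eigenvector.

module ExtremalEigenvector where

  open import Defs using (ℝ; seq)
  open IntegerSums using (#; δ; ⟦_⟧)
  open Rationals
  open Reals
  open Bisection
  open Spectral
  open import Data.Bool.Base using (Bool; true; false; _∧_; not)
  open import Data.Fin.Base using (Fin; zero; suc)
  open import Data.Integer.Base as ℤ using (ℤ)
  open import Data.Nat.Base as ℕ using (ℕ; zero; suc)
  open import Data.Product.Base using (_,_)
  open import Data.Rational.Base hiding (_≃_)
  open import Data.Rational.Properties hiding (_≟_)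
  open import Data.Rational.Solver using (module +-*-Solver)
  open import Function.Base using (_∘_)
  open import Relation.Binary.PropositionalEquality
  open import Tactic.RingSolver using (solve-∀)

  -- The four classes of vertices of H: r K₁, K_{a-1}, K_{n-a-r} and K₁.
  Label : Set
  Label = Fin 4

  pattern ind     = zero
  pattern core    = suc zero
  pattern clique  = suc (suc zero)
  pattern pendant = suc (suc (suc zero))

  -- On the diagonal it is true exactly for the three complete classes. Loops are removed only in
  -- `linked`, so a sum over classes counts a vertex of a complete class as its own neighbour; the
  -- terms `bit (link l l)` compensate.
  link : Label → Label → Bool
  link ind     ind     = false
  link clique  pendant = false
  link pendant clique  = false
  link _       _       = true

  linked : ∀ {n} → (Fin n → Label) → Fin n → Fin n → Bool
  linked ℓ u v = not (δ u v) ∧ link (ℓ u) (ℓ v)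

  size : ∀ {n} → (Fin n → Label) → Label → ℤ
  size ℓ k = # (λ v → δ (ℓ v) k)

  bit : Bool → ℚ
  bit true  = 1ℚ
  bit false = 0ℚ

  ⟪⟫≈bit : ∀ b → ⟪ b ⟫ ≈ κ (bit b)
  ⟪⟫≈bit true  = int-1
  ⟪⟫≈bit false = int-0

  remove-diagonal : ∀ {n} (i : Fin n) (b : Fin n → Bool) (g : Fin n → ℝ) →
    Σᴿ (λ j → ⟪ not (δ i j) ∧ b j ⟫ ⊠ g j) ⊞ ⟪ b i ⟫ ⊠ g i ≈ Σᴿ (λ j → ⟪ b j ⟫ ⊠ g j)
  remove-diagonal i b g = begin-equality
    Σᴿ (λ j → ⟪ not (δ i j) ∧ b j ⟫ ⊠ g j) ⊞ ⟪ b i ⟫ ⊠ g i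
      ≈⟨ ⊞-cong ≈-refl (Σᴿ-δ i (λ j → ⟪ b j ⟫ ⊠ g j)) ⟨
    Σᴿ (λ j → ⟪ not (δ i j) ∧ b j ⟫ ⊠ g j) ⊞ Σᴿ (λ j → ⟪ δ i j ⟫ ⊠ (⟪ b j ⟫ ⊠ g j))
      ≈⟨ Σᴿ-distrib-⊞ _ _ ⟨
    Σᴿ (λ j → ⟪ not (δ i j) ∧ b j ⟫ ⊠ g j ⊞ ⟪ δ i j ⟫ ⊠ (⟪ b j ⟫ ⊠ g j))
      ≈⟨ Σᴿ-cong (λ j → split (δ i j) (b j) (g j)) ⟩
    Σᴿ (λ j → ⟪ b j ⟫ ⊠ g j) ∎
    where
    open ≼-Reasoning
    split : ∀ d b x → ⟪ not d ∧ b ⟫ ⊠ x ⊞ ⟪ d ⟫ ⊠ (⟪ b ⟫ ⊠ x) ≈ ⟪ b ⟫ ⊠ x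
    split true  b x = ≈-trans (⊞-cong (≈-trans (⊠-congʳ int-0) (ℝ-Semiring.zeroˡ x))
      (≈-trans (⊠-congʳ int-1) (ℝ-Semiring.*-identityˡ _))) (ℝ-Semiring.+-identityˡ _)
    split false b x = ≈-trans (⊞-cong ≈-refl (≈-trans (⊠-congʳ int-0) (ℝ-Semiring.zeroˡ _))) (ℝ-Semiring.+-identityʳ _)

  sum-by-label : ∀ {n} (ℓ : Fin n → Label) (h : Label → ℝ) →
                 Σᴿ (h ∘ ℓ) ≈ Σᴿ (λ k → int (size ℓ k) ⊠ h k)
  sum-by-label ℓ h = begin-equality
    Σᴿ (h ∘ ℓ)                                    ≈⟨ Σᴿ-cong (λ v → Σᴿ-δ (ℓ v) h) ⟨
    Σᴿ (λ v → Σᴿ (λ k → ⟪ δ (ℓ v) k ⟫ ⊠ h k))     ≈⟨ Σᴿ-comm (λ v k → ⟪ δ (ℓ v) k ⟫ ⊠ h k) ⟩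
    Σᴿ (λ k → Σᴿ (λ v → ⟪ δ (ℓ v) k ⟫ ⊠ h k))     ≈⟨ Σᴿ-cong (λ k → Σᴿ-distribʳ-⊠ (h k) (λ v → ⟪ δ (ℓ v) k ⟫)) ⟨
    Σᴿ (λ k → Σᴿ (λ v → ⟪ δ (ℓ v) k ⟫) ⊠ h k)     ≈⟨ Σᴿ-cong (λ k → ⊠-congʳ (Σᴿ-int (λ v → ⟦ δ (ℓ v) k ⟧))) ⟩
    Σᴿ (λ k → int (size ℓ k) ⊠ h k)               ∎
    where open ≼-Reasoning

  Σᴿ-four : ∀ (f : Label → ℝ) → Σᴿ f ≈ f ind ⊞ (f core ⊞ (f clique ⊞ (f pendant ⊞ κ 0ℚ)))
  Σᴿ-four f = ≡⇒≈ (trans (Σᴿ-cons f) (cong (f ind ⊞_)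
    (trans (Σᴿ-cons (λ k → f (suc k))) (cong (f core ⊞_)
    (trans (Σᴿ-cons (λ k → f (suc (suc k)))) (cong (f clique ⊞_)
    (trans (Σᴿ-cons (λ k → f (suc (suc (suc k)))))
      (cong (f pendant ⊞_) (Σᴿ-nil (λ k → f (suc (suc (suc (suc k))))))))))))))

  1≤*1≤ : ∀ {p q} → 1ℚ ≤ p → 1ℚ ≤ q → 1ℚ ≤ p * q
  1≤*1≤ {p} {q} 1≤p 1≤q = ≤-by _ (diff 1≤p ⊛ diff 1≤q ⊕ diff 1≤p ⊕ diff 1≤q) (expand p q)
    where
    expand : ∀ p q → p * q - 1ℚ ≡ (p - 1ℚ) * (q - 1ℚ) + (p - 1ℚ) + (q - 1ℚ)
    expand = solve-∀ ring

  1≤+0≤ : ∀ {p q} → 1ℚ ≤ p → 0ℚ ≤ q → 1ℚ ≤ p + q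
  1≤+0≤ {p} {q} 1≤p 0≤q = subst (_≤ p + q) (+-identityʳ 1ℚ) (+-mono-≤ 1≤p 0≤q)

  0≤+1≤ : ∀ {p q} → 0ℚ ≤ p → 1ℚ ≤ q → 1ℚ ≤ p + q
  0≤+1≤ {p} {q} 0≤p 1≤q = subst (_≤ p + q) (+-identityˡ 1ℚ) (+-mono-≤ 0≤p 1≤q)

  -- The classes have r = R + 1, a - 1 = A, n - a - r = C + 1 and 1 vertices.
  -- Solving the eigenvalue equations of the quotient matrix in the order ind,
  -- core, pendant, clique leaves one equation, characteristic = 0.
  module Quotient (R A C : ℚ) where

    private
      1+ : Poly → Poly
      1+ P = P :+ con 1ℚ

      r Z : Poly
      r = con (1ℚ + R)
      Z = r :* 1+ var :+ con A :* (var :+ r)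

    -- The eigenvector scaled so that its entries sum to S = t(t + 1)²(t + r). The independent and
    -- core rows give S/(t + r) and S/(t + 1), the pendant row then gives (t + 1)Z, and the clique
    -- row (S - (t + 1)Z)/(t + 1). The scaling clears all denominators.
    weight : Label → Poly
    weight ind     = var :* 1+ var :* 1+ var
    weight core    = var :* 1+ var :* (var :+ r)
    weight clique  = var :* 1+ var :* (var :+ r) :+ con (- 1ℚ) :* Z
    weight pendant = 1+ var :* Z

    -- The clique row in which the contribution of the independent and core classes has been
    -- replaced by t times the pendant weight.
    characteristic : Poly
    characteristic = (var :+ con (- 1ℚ) :* con C) :* weight clique :+ con (- 1ℚ) :* (var :* weight pendant)

    class-size : Label → ℚ
    class-size ind     = 1ℚ + R
    class-size core    = A
    class-size clique  = 1ℚ + C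
    class-size pendant = 1ℚ

    row-sum : Label → Poly
    row-sum l = term ind :+ (term core :+ (term clique :+ (term pendant :+ con 0ℚ)))
      where
      term : Label → Poly
      term k = con (class-size k) :* (con (bit (link l k)) :* weight k)

    -- How often the characteristic polynomial must be added to make a row an identity in t. The
    -- pendant row holds identically, since it defines the pendant weight; the other rows involve
    -- the total S and hold only at a root.
    residue : Label → ℚ
    residue pendant = 0ℚ
    residue _       = 1ℚ

    open +-*-Solver using (Polynomial; solve; _:=_) renaming (con to con′; _:+_ to _+′_; _:*_ to _*′_)

    private
      module _ {n} (t R A C : Polynomial n) where
        one r′ Z′ w-ind w-core w-clique w-pendant char : Polynomial n
        one = con′ 1ℚ
        r′ = one +′ R
        Z′ = r′ *′ (t +′ one) +′ A *′ (t +′ r′)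
        w-ind = t *′ (t +′ one) *′ (t +′ one)
        w-core = t *′ (t +′ one) *′ (t +′ r′)
        w-clique = t *′ (t +′ one) *′ (t +′ r′) +′ con′ (- 1ℚ) *′ Z′
        w-pendant = (t +′ one) *′ Z′
        char = (t +′ con′ (- 1ℚ) *′ C) *′ w-clique +′ con′ (- 1ℚ) *′ (t *′ w-pendant)
        row : (b₁ b₂ b₃ b₄ : ℚ) → Polynomial n
        row b₁ b₂ b₃ b₄ = r′ *′ (con′ b₁ *′ w-ind) +′ (A *′ (con′ b₂ *′ w-core) +′
          ((one +′ C) *′ (con′ b₃ *′ w-clique) +′ (one *′ (con′ b₄ *′ w-pendant) +′ con′ 0ℚ)))

    quotient-equation : ∀ l t →
      ⟦ row-sum l :+ con (residue l) :* characteristic ⟧ℚ t ≡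
      ⟦ var :* weight l :+ con (bit (link l l)) :* weight l ⟧ℚ t
    quotient-equation ind t = solve 4 (λ t R A C →
      row t R A C 0ℚ 1ℚ 1ℚ 1ℚ +′ con′ 1ℚ *′ char t R A C :=
      t *′ w-ind t R A C +′ con′ 0ℚ *′ w-ind t R A C) refl t R A C
    quotient-equation core t = solve 4 (λ t R A C →
      row t R A C 1ℚ 1ℚ 1ℚ 1ℚ +′ con′ 1ℚ *′ char t R A C :=
      t *′ w-core t R A C +′ con′ 1ℚ *′ w-core t R A C) refl t R A C
    quotient-equation clique t = solve 4 (λ t R A C →
      row t R A C 1ℚ 1ℚ 1ℚ 0ℚ +′ con′ 1ℚ *′ char t R A C :=
      t *′ w-clique t R A C +′ con′ 1ℚ *′ w-clique t R A C) refl t R A C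
    quotient-equation pendant t = solve 4 (λ t R A C →
      row t R A C 1ℚ 1ℚ 0ℚ 1ℚ +′ con′ 0ℚ *′ char t R A C :=
      t *′ w-pendant t R A C +′ con′ 1ℚ *′ w-pendant t R A C) refl t R A C

    -- With n = R + A + C + 3 these are n - 3 and n - 1. The upper end is the greatest possible
    -- degree, and at the lower end the sign of the polynomial follows from (r - 1)² ≤ n - 2.
    lo hi : ℚ
    lo = R + A + C
    hi = R + A + C + (1ℚ + 1ℚ)

    module _ (0≤R : 0ℚ ≤ R) (0≤A : 0ℚ ≤ A) (1≤C : 1ℚ ≤ C) (R²≤ : R * R ≤ lo + 1ℚ) where

      private
        0≤C : 0ℚ ≤ C
        0≤C = ≤-trans 0≤1 1≤C

        1≤r : 1ℚ ≤ 1ℚ + R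
        1≤r = 1≤+0≤ ≤-refl 0≤R

        1≤Z : ∀ {t} → 1ℚ ≤ t → 1ℚ ≤ ⟦ Z ⟧ℚ t
        1≤Z 1≤t = 1≤+0≤ (1≤*1≤ 1≤r (1≤+0≤ 1≤t 0≤1)) (0≤A ⊛ (≤-trans 0≤1 1≤t ⊕ ≤-trans 0≤1 1≤r))

      1≤lo : 1ℚ ≤ lo
      1≤lo = 0≤+1≤ (0≤R ⊕ 0≤A) 1≤C

      1≤weight : ∀ l {t} → lo ≤ t → 1ℚ ≤ ⟦ weight l ⟧ℚ t
      1≤weight l {t} lo≤t = go l
        where
        1≤t : 1ℚ ≤ t
        1≤t = ≤-trans 1≤lo lo≤t
        1≤t+1 : 1ℚ ≤ t + 1ℚ
        1≤t+1 = 1≤+0≤ 1≤t 0≤1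
        0≤t = ≤-trans 0≤1 1≤t
        0≤t+1 = ≤-trans 0≤1 1≤t+1
        0≤t+r = 0≤t ⊕ ≤-trans 0≤1 1≤r
        -- The clique weight is the only one with a negative term. It is rewritten as a sum of terms
        -- that are nonnegative once t ≥ `lo` and C ≥ 1, the last of them being at least 1.
        clique-split : ∀ t R A C →
          t * (t + 1ℚ) * (t + (1ℚ + R)) + - 1ℚ * ((1ℚ + R) * (t + 1ℚ) + A * (t + (1ℚ + R))) ≡
          (t - (R + A + C) + (C - 1ℚ)) * (t + 1ℚ) * (t + (1ℚ + R)) + A * (t * (t + (1ℚ + R))) +
          (1ℚ + R) * ((t + 1ℚ) * (t + R))
        clique-split = solve-∀ ring
        go : ∀ l → 1ℚ ≤ ⟦ weight l ⟧ℚ t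
        go ind     = 1≤*1≤ (1≤*1≤ 1≤t 1≤t+1) 1≤t+1
        go core    = 1≤*1≤ (1≤*1≤ 1≤t 1≤t+1) (1≤+0≤ 1≤t (≤-trans 0≤1 1≤r))
        go clique  = subst (1ℚ ≤_) (sym (clique-split t R A C))
          (0≤+1≤ ((diff lo≤t ⊕ diff 1≤C) ⊛ 0≤t+1 ⊛ 0≤t+r ⊕ 0≤A ⊛ (0≤t ⊛ 0≤t+r))
            (1≤*1≤ 1≤r (1≤*1≤ 1≤t+1 (1≤+0≤ 1≤t 0≤R))))
        go pendant = 1≤*1≤ 1≤t+1 (1≤Z 1≤t)

      start : Bracket ⟦ characteristic ⟧ℚ
      start = bracket lo hi
        (subst (_≤ hi) (+-identityʳ lo) (+-monoʳ-≤ lo (0≤1 ⊕ 0≤1)))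
        (≤-by _ (0≤lo ⊛ (0≤lo ⊕ 0≤1) ⊛ diff R²≤ ⊕ (0≤R ⊕ 0≤A) ⊛ ≤-trans 0≤1 (1≤Z 1≤lo)) (at-lo R A C))
        (subst (0ℚ ≤_) (sym (at-hi R A C))
          ((0≤hi ⊕ ≤-trans 0≤1 1≤r) ⊛ ((0≤C ⊕ 0≤1) ⊛ (0≤hi ⊕ (≤-trans 0≤1 1≤r ⊕ 0≤A) ⊕ 0≤1)) ⊕
           ≤-trans 0≤1 1≤r ⊛ 0≤R ⊛ (≤-trans 0≤1 1≤r ⊕ 0≤A ⊕ 0≤1 ⊕ 0≤hi ⊛ (0≤hi ⊕ 0≤1))))
        where
        0≤lo = ≤-trans 0≤1 1≤lo
        0≤hi : 0ℚ ≤ hi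
        0≤hi = 0≤lo ⊕ (0≤1 ⊕ 0≤1)
        at-lo : ∀ R A C → let t = R + A + C ; Z = (1ℚ + R) * (t + 1ℚ) + A * (t + (1ℚ + R)) in
          0ℚ - ((t + - 1ℚ * C) * (t * (t + 1ℚ) * (t + (1ℚ + R)) + - 1ℚ * Z) + - 1ℚ * (t * ((t + 1ℚ) * Z))) ≡
          t * (t + 1ℚ) * (t + 1ℚ - R * R) + (R + A) * Z
        at-lo = solve-∀ ring
        at-hi : ∀ R A C → let t = R + A + C + (1ℚ + 1ℚ) ; Z = (1ℚ + R) * (t + 1ℚ) + A * (t + (1ℚ + R)) in
          (t + - 1ℚ * C) * (t * (t + 1ℚ) * (t + (1ℚ + R)) + - 1ℚ * Z) + - 1ℚ * (t * ((t + 1ℚ) * Z)) ≡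
          (t + (1ℚ + R)) * ((C + 1ℚ) * (t + (1ℚ + R + A) + 1ℚ)) +
          (1ℚ + R) * R * (1ℚ + R + A + 1ℚ + t * (t + 1ℚ))
        at-hi = solve-∀ ring

      -- Comparison with r K₁ ∨ K_{n-r-1}, a subgraph of H.
      square-bound : ∀ {t} → lo ≤ t → 0ℚ ≤ ⟦ characteristic ⟧ℚ t →
                     (A + C) * lo + (1ℚ + R) * (A + C + 1ℚ) ≤ t * t
      square-bound {t} lo≤t 0≤f = ≤-by _ (0≤gap ⊕ (0≤A ⊕ 0≤C) ⊛ diff lo≤t) (regroup t R A C)
        where
        1≤t = ≤-trans 1≤lo lo≤t
        0≤t = ≤-trans 0≤1 1≤t
        0≤Z = ≤-trans 0≤1 (1≤Z 1≤t)
        0≤r = ≤-trans 0≤1 1≤r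
        gap = t * t - (A + C) * t - (1ℚ + R) * (A + C + 1ℚ)
        regroup : ∀ t R A C → t * t - ((A + C) * (R + A + C) + (1ℚ + R) * (A + C + 1ℚ)) ≡
          t * t - (A + C) * t - (1ℚ + R) * (A + C + 1ℚ) + (A + C) * (t - (R + A + C))
        regroup = solve-∀ ring
        -- `gap` is the characteristic polynomial of the quotient matrix of r K₁ ∨ K_{n-r-1}.
        -- Multiplied by the clique weight it becomes a nonnegative combination of Z and the
        -- characteristic polynomial of H, and the positive weight is then cancelled.
        certificate : ∀ t R A C → let Z = (1ℚ + R) * (t + 1ℚ) + A * (t + (1ℚ + R)) ; w = t * (t + 1ℚ) * (t + (1ℚ + R)) + - 1ℚ * Z in
          (1ℚ + R) * A * Z + (1ℚ + R) * (t + 1ℚ) * Z + A * t * Z +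
          (1ℚ + R + t) * ((t + - 1ℚ * C) * w + - 1ℚ * (t * ((t + 1ℚ) * Z))) ≡
          (t * t - (A + C) * t - (1ℚ + R) * (A + C + 1ℚ)) * w
        certificate = solve-∀ ring
        0<w : 0ℚ < ⟦ weight clique ⟧ℚ t
        0<w = <-≤-trans (positive⁻¹ 1ℚ) (1≤weight clique lo≤t)
        0≤gap : 0ℚ ≤ gap
        0≤gap = *-cancelʳ-≤-pos (⟦ weight clique ⟧ℚ t) {{positive 0<w}}
          (subst₂ _≤_ (sym (*-zeroˡ (⟦ weight clique ⟧ℚ t))) (certificate t R A C)
            (0≤r ⊛ 0≤A ⊛ 0≤Z ⊕ 0≤r ⊛ (0≤t ⊕ 0≤1) ⊛ 0≤Z ⊕ 0≤A ⊛ 0≤t ⊛ 0≤Z ⊕ (0≤r ⊕ 0≤t) ⊛ 0≤f))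

  sizes : (r′ a′ c′ : ℕ) → Label → ℤ
  sizes r′ a′ c′ ind     = ℤ.+ suc r′
  sizes r′ a′ c′ core    = ℤ.+ a′
  sizes r′ a′ c′ clique  = ℤ.+ suc c′
  sizes r′ a′ c′ pendant = ℤ.1ℤ

  -- At the arguments r - 1, a - 1 and n - a - r - 1 this is (n - r - 2)(n - 3) + r(n - r - 1): the
  -- lower bound for λ(H)² with λ(H) itself replaced by n - 3.
  square-lower-bound : (r a c : ℤ) → ℤ
  square-lower-bound r a c = (a ℤ.+ c) ℤ.* (r ℤ.+ a ℤ.+ c) ℤ.+ (ℤ.1ℤ ℤ.+ r) ℤ.* (a ℤ.+ c ℤ.+ ℤ.1ℤ)

  ι-square-lower-bound : ∀ r a c → ι (square-lower-bound r a c) ≡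
    (ι a + ι c) * (ι r + ι a + ι c) + (1ℚ + ι r) * (ι a + ι c + 1ℚ)
  ι-square-lower-bound r a c = begin
    ι (square-lower-bound r a c)
      ≡⟨ ι-+ ((a ℤ.+ c) ℤ.* (r ℤ.+ a ℤ.+ c)) ((ℤ.1ℤ ℤ.+ r) ℤ.* (a ℤ.+ c ℤ.+ ℤ.1ℤ)) ⟩
    ι ((a ℤ.+ c) ℤ.* (r ℤ.+ a ℤ.+ c)) + ι ((ℤ.1ℤ ℤ.+ r) ℤ.* (a ℤ.+ c ℤ.+ ℤ.1ℤ))
      ≡⟨ cong₂ _+_ (ι-* (a ℤ.+ c) (r ℤ.+ a ℤ.+ c)) (ι-* (ℤ.1ℤ ℤ.+ r) (a ℤ.+ c ℤ.+ ℤ.1ℤ)) ⟩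
    ι (a ℤ.+ c) * ι (r ℤ.+ a ℤ.+ c) + ι (ℤ.1ℤ ℤ.+ r) * ι (a ℤ.+ c ℤ.+ ℤ.1ℤ)
      ≡⟨ cong₂ _+_
           (cong₂ _*_ (ι-+ a c) (trans (ι-+ (r ℤ.+ a) c) (cong (_+ ι c) (ι-+ r a))))
           (cong₂ _*_ (trans (ι-+ ℤ.1ℤ r) (cong (_+ ι r) ι-1))
                      (trans (ι-+ (a ℤ.+ c) ℤ.1ℤ) (cong₂ _+_ (ι-+ a c) ι-1))) ⟩
    (ι a + ι c) * (ι r + ι a + ι c) + (1ℚ + ι r) * (ι a + ι c + 1ℚ) ∎
    where open ≡-Reasoning

  -- The entries of the eigenvector depend on labels only, and `eigenvector` holds for every
  -- labelling with the right class sizes. The same pair thus serves the graph `joined` and any copy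
  -- of H laid over the vertices of G.
  record PerronPair (r′ a′ c′ : ℕ) : Set where
    field
      ρ            : ℝ
      y            : Label → ℝ
      1≼y          : ∀ l → 1ʳ ≼ y l
      0≼ρ          : 0ʳ ≼ ρ
      ρ²-large     : int (square-lower-bound (ℤ.+ r′) (ℤ.+ a′) (ℤ.+ c′)) ≼ ρ ⊠ ρ
      eigenvector  : ∀ {n} (ℓ : Fin n → Label) → (∀ k → size ℓ k ≡ sizes r′ a′ c′ k) →
                     ∀ i → (linked ℓ · (y ∘ ℓ)) i ≈ ρ ⊠ y (ℓ i)

  module _ (r′ a′ c′ : ℕ) (1≤c′ : 1 ℕ.≤ c′) (r′²≤ : r′ ℕ.* r′ ℕ.≤ r′ ℕ.+ a′ ℕ.+ c′ ℕ.+ 1) where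

    private
      R A C : ℚ
      R = ι (ℤ.+ r′)
      A = ι (ℤ.+ a′)
      C = ι (ℤ.+ c′)

      open Quotient R A C

      1≤C : 1ℚ ≤ C
      1≤C = subst (_≤ C) ι-1 (ι-mono (ℤ.+≤+ 1≤c′))

      R²≤ : R * R ≤ lo + 1ℚ
      R²≤ = subst₂ _≤_ (trans (cong ι (ℤ.pos-* r′ r′)) (ι-* (ℤ.+ r′) (ℤ.+ r′)))
        (trans (ι-+ (ℤ.+ (r′ ℕ.+ a′ ℕ.+ c′)) ℤ.1ℤ) (cong₂ _+_
          (trans (ι-+ (ℤ.+ (r′ ℕ.+ a′)) (ℤ.+ c′)) (cong (_+ C) (ι-+ (ℤ.+ r′) (ℤ.+ a′)))) ι-1))
        (ι-mono (ℤ.+≤+ r′²≤))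
        where import Data.Integer.Properties as ℤ

      B : Bracket ⟦ characteristic ⟧ℚ
      B = start (ι-nonneg r′) (ι-nonneg a′) 1≤C R²≤

      width≤2 : Bracket.width B ≤ ι (ℤ.+ 2)
      width≤2 = ≤-reflexive (trans (cancel lo (1ℚ + 1ℚ)) (sym (trans (ι-+ ℤ.1ℤ ℤ.1ℤ) (cong₂ _+_ ι-1 ι-1))))
        where
        cancel : ∀ a b → a + b - a ≡ b
        cancel = solve-∀ ring

      class-size-correct : ∀ k → ι (sizes r′ a′ c′ k) ≡ class-size k
      class-size-correct ind     = trans (ι-+ ℤ.1ℤ (ℤ.+ r′)) (cong (_+ R) ι-1)
      class-size-correct core    = refl
      class-size-correct clique  = trans (ι-+ ℤ.1ℤ (ℤ.+ c′)) (cong (_+ C) ι-1)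
      class-size-correct pendant = ι-1

    perron-pair-of-root : ∀ ρ → ⟦ characteristic ⟧ᴿ ρ ≈ κ 0ℚ → (∀ k → lo ≤ seq ρ k) →
                          (∀ k → 0ℚ ≤ ⟦ characteristic ⟧ℚ (seq ρ k)) → PerronPair r′ a′ c′
    perron-pair-of-root ρ fρ≈0 lo≤ρ 0≤fρ = record
      { ρ = ρ
      ; y = y
      ; 1≼y = λ l → ≼-pointwise λ k → subst₂ _≤_ (sym (seq-κ 1ℚ k)) (sym (seq-⟦⟧ᴿ (weight l) ρ k))
          (1≤weight (ι-nonneg r′) (ι-nonneg a′) 1≤C R²≤ l (lo≤ρ k))
      ; 0≼ρ = ≼-pointwise λ k → subst (_≤ seq ρ k) (sym (seq-κ 0ℚ k))
          (≤-trans 0≤1 (≤-trans (1≤lo (ι-nonneg r′) (ι-nonneg a′) 1≤C R²≤) (lo≤ρ k)))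
      ; ρ²-large = ≼-pointwise λ k → subst₂ _≤_
          (trans (sym (ι-square-lower-bound (ℤ.+ r′) (ℤ.+ a′) (ℤ.+ c′))) (sym (seq-κ _ k))) (sym (seq-⊠ ρ ρ k))
          (square-bound (ι-nonneg r′) (ι-nonneg a′) 1≤C R²≤ (lo≤ρ k) (0≤fρ k))
      ; eigenvector = eigen
      }
      where
      y : Label → ℝ
      y l = ⟦ weight l ⟧ᴿ ρ

      row-sum-equation : ∀ l → ⟦ row-sum l ⟧ᴿ ρ ≈ ρ ⊠ y l ⊞ κ (bit (link l l)) ⊠ y l
      row-sum-equation l = begin-equality
        ⟦ row-sum l ⟧ᴿ ρ
          ≈⟨ ℝ-Semiring.+-identityʳ _ ⟨
        ⟦ row-sum l ⟧ᴿ ρ ⊞ κ 0ℚ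
          ≈⟨ ⊞-cong ≈-refl (≈-trans (⊠-cong ≈-refl fρ≈0) (ℝ-Semiring.zeroʳ (κ (residue l)))) ⟨
        ⟦ row-sum l :+ con (residue l) :* characteristic ⟧ᴿ ρ
          ≈⟨ ≈-pointwise (λ k → trans (seq-⟦⟧ᴿ (row-sum l :+ con (residue l) :* characteristic) ρ k)
               (trans (quotient-equation l (seq ρ k))
                 (sym (seq-⟦⟧ᴿ (var :* weight l :+ con (bit (link l l)) :* weight l) ρ k)))) ⟩
        ρ ⊠ y l ⊞ κ (bit (link l l)) ⊠ y l ∎
        where open ≼-Reasoning

      eigen : ∀ {n} (ℓ : Fin n → Label) → (∀ k → size ℓ k ≡ sizes r′ a′ c′ k) →
              ∀ i → (linked ℓ · (y ∘ ℓ)) i ≈ ρ ⊠ y (ℓ i)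
      -- The term by which vertex i counts itself is added to both sides and then cancelled.
      eigen ℓ sizes-ok i = ≼-antisym
        (⊞-cancelʳ own (≼-reflexive (≈-trans total (⊞-cong ≈-refl (≈-sym own≈)))))
        (⊞-cancelʳ own (≼-reflexive (≈-trans (⊞-cong ≈-refl own≈) (≈-sym total))))
        where
        open ≼-Reasoning
        l = ℓ i
        own = ⟪ link l l ⟫ ⊠ y l
        own≈ : own ≈ κ (bit (link l l)) ⊠ y l
        own≈ = ⊠-congʳ (⟪⟫≈bit (link l l))
        term : ∀ k → int (size ℓ k) ⊠ (⟪ link l k ⟫ ⊠ y k) ≈
                     κ (class-size k) ⊠ (κ (bit (link l k)) ⊠ y k)
        term k = ⊠-cong (≡⇒≈ (cong κ (trans (cong ι (sizes-ok k)) (class-size-correct k))))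
          (⊠-congʳ (⟪⟫≈bit (link l k)))
        total : (linked ℓ · (y ∘ ℓ)) i ⊞ own ≈ ρ ⊠ y l ⊞ κ (bit (link l l)) ⊠ y l
        total = begin-equality
          (linked ℓ · (y ∘ ℓ)) i ⊞ own
            ≈⟨ remove-diagonal i (λ j → link l (ℓ j)) (y ∘ ℓ) ⟩
          Σᴿ (λ j → ⟪ link l (ℓ j) ⟫ ⊠ y (ℓ j))
            ≈⟨ sum-by-label ℓ (λ k → ⟪ link l k ⟫ ⊠ y k) ⟩
          Σᴿ (λ k → int (size ℓ k) ⊠ (⟪ link l k ⟫ ⊠ y k))
            ≈⟨ Σᴿ-cong term ⟩
          Σᴿ (λ k → κ (class-size k) ⊠ (κ (bit (link l k)) ⊠ y k))
            ≈⟨ Σᴿ-four _ ⟩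
          ⟦ row-sum l ⟧ᴿ ρ
            ≈⟨ row-sum-equation l ⟩
          ρ ⊠ y l ⊞ κ (bit (link l l)) ⊠ y l ∎

    perron-pair : PerronPair r′ a′ c′
    perron-pair =
      let ρ , fρ≈0 , lo≤ρ , 0≤fρ = root-between characteristic 2 B width≤2
      in perron-pair-of-root ρ fρ≈0 lo≤ρ 0≤fρ

-- Copies of H given by labellings, and isomorphism with H.

module Labellings where

  open import Defs hiding (sum)
  open IntegerSums
  open Reals
  open Spectral
  open ExtremalEigenvector
  open import Data.Bool.Base using (true; false; _∧_; not)
  open import Data.Bool.Properties using () renaming (_≟_ to _≟ᵇ_)
  open import Data.Empty using (⊥; ⊥-elim)
  open import Data.Fin.Base using (Fin; zero; suc; splitAt; punchIn; join)
  open import Data.Fin.Permutation using (Permutation; id; insert; insert-punchIn; _⟨$⟩ʳ_)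
  open import Data.Fin.Properties using (_≟_; any?; join-splitAt)
  open import Data.Integer.Base as ℤ using (ℤ; 0ℤ; 1ℤ)
  import Data.Integer.Properties as ℤ
  open import Algebra.Properties.AbelianGroup ℤ.+-0-abelianGroup using (∙-cancelˡ)
  open import Data.Nat.Properties using (≤-refl)
  open import Data.Rational.Properties using (positive⁻¹)
  open import Data.Nat.Base using (zero; suc; _+_; s≤s; z≤n)
  open import Data.Product.Base using (Σ-syntax; _,_)
  open import Data.Rational.Base using (½; *≤*)
  open import Data.Sum.Base using (_⊎_; inj₁; inj₂; [_,_]′; map₁)
  open import Function.Base using (_∘_; const)
  open import Function.Bundles using (_↔_; module Inverse)
  open import Relation.Binary.PropositionalEquality
  open import Relation.Nullary using (¬_; yes; no; contradiction)
  open import Relation.Nullary.Decidable using (_×-dec_)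

  δ-true : ∀ {n} {i j : Fin n} → δ i j ≡ true → i ≡ j
  δ-true {i = i} {j} eq with i ≟ j
  ... | yes i≡j = i≡j

  -- The first vertex is matched with any vertex of its label, which exists because the class sizes
  -- agree. Deleting both leaves equal class sizes.
  equal-sizes⇒↔ : ∀ {m n} (ℓ : Fin m → Label) (ℓ′ : Fin n → Label) → size ℓ ≗ size ℓ′ →
                  Σ[ π ∈ Permutation m n ] ∀ i → ℓ′ (π ⟨$⟩ʳ i) ≡ ℓ i
  equal-sizes⇒↔ {zero} {zero} ℓ ℓ′ eq = id , λ ()
  equal-sizes⇒↔ {zero} {suc n} ℓ ℓ′ eq =
    contradiction (subst (ℤ._≤ 0ℤ) (cong ⟦_⟧ (δ-refl (ℓ′ zero)))
      (ℤ.≤-trans (term≤Σ (λ v → ⟦⟧≥0 (δ (ℓ′ v) (ℓ′ zero))) zero)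
        (ℤ.≤-reflexive (trans (sym (eq (ℓ′ zero))) (Σ-nil _)))))
      λ { (ℤ.+≤+ ()) }
  equal-sizes⇒↔ {suc m} {n} ℓ ℓ′ eq
    with j , ℓ′j ← ∃-of-#>0 (λ v → δ (ℓ′ v) (ℓ zero)) (subst (0ℤ ℤ.<_) (eq (ℓ zero))
      (ℤ.<-≤-trans (ℤ.+<+ (s≤s z≤n)) (subst (ℤ._≤ size ℓ (ℓ zero)) (cong ⟦_⟧ (δ-refl (ℓ zero)))
        (term≤Σ (λ v → ⟦⟧≥0 (δ (ℓ v) (ℓ zero))) zero)))) = extend {ℓ′ = ℓ′} j (δ-true ℓ′j) eq
    where
    extend : ∀ {n} {ℓ′ : Fin n → Label} (j : Fin n) → ℓ′ j ≡ ℓ zero → size ℓ ≗ size ℓ′ →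
             Σ[ π ∈ Permutation (suc m) n ] ∀ i → ℓ′ (π ⟨$⟩ʳ i) ≡ ℓ i
    extend {suc n} {ℓ′} j ℓ′j eq
      with π , ok ← equal-sizes⇒↔ (ℓ ∘ suc) (ℓ′ ∘ punchIn j) (λ k → ∙-cancelˡ ⟦ δ (ℓ zero) k ⟧ _ _
        (trans (sym (Σ-cons _)) (trans (eq k) (trans (Σ-punchIn _ j)
          (cong (λ l → ⟦ δ l k ⟧ ℤ.+ size (ℓ′ ∘ punchIn j) k) ℓ′j))))) =
      insert zero j π , λ
        { zero    → ℓ′j
        ; (suc i) → trans (cong ℓ′ (insert-punchIn zero j π i)) (ok i)
        }

  Realises : ∀ {n} → Graph n → (Fin n → Label) → Set
  Realises G ℓ = ∀ u v → u ≢ v → adj G u v ≡ link (ℓ u) (ℓ v)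

  realises⇒linked : ∀ {n} (G : Graph n) ℓ → Realises G ℓ → ∀ u v → adj G u v ≡ linked ℓ u v
  realises⇒linked G ℓ realises u v with u ≟ v
  ... | yes refl = irrefl G u
  ... | no u≢v   = realises u v u≢v

  beside : ∀ {m n} → (Fin m → Label) → (Fin n → Label) → Fin (m + n) → Label
  beside {m} ℓ₁ ℓ₂ v = [ ℓ₁ , ℓ₂ ]′ (splitAt m v)

  Σ-splitAt : ∀ m {n} (f : Fin m → ℤ) (g : Fin n → ℤ) →
              Σℤ (λ v → [ f , g ]′ (splitAt m v)) ≡ Σℤ f ℤ.+ Σℤ g
  Σ-splitAt zero    f g = sym (trans (cong (ℤ._+ Σℤ g) (Σ-nil f)) (ℤ.+-identityˡ (Σℤ g)))
  Σ-splitAt (suc m) f g = begin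
    Σℤ (λ v → [ f , g ]′ (splitAt (suc m) v))
      ≡⟨ Σ-cons _ ⟩
    f zero ℤ.+ Σℤ (λ v → [ f , g ]′ (map₁ suc (splitAt m v)))
      ≡⟨ cong (λ s → f zero ℤ.+ s) (Σ-cong λ v → shift (splitAt m v)) ⟩
    f zero ℤ.+ Σℤ (λ v → [ f ∘ suc , g ]′ (splitAt m v))
      ≡⟨ cong (λ s → f zero ℤ.+ s) (Σ-splitAt m (f ∘ suc) g) ⟩
    f zero ℤ.+ (Σℤ (f ∘ suc) ℤ.+ Σℤ g)
      ≡⟨ ℤ.+-assoc (f zero) _ _ ⟨
    f zero ℤ.+ Σℤ (f ∘ suc) ℤ.+ Σℤ g
      ≡⟨ cong (ℤ._+ Σℤ g) (Σ-cons f) ⟨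
    Σℤ f ℤ.+ Σℤ g ∎
    where
    open ≡-Reasoning
    shift : ∀ s → [ f , g ]′ (map₁ suc s) ≡ [ f ∘ suc , g ]′ s
    shift (inj₁ _) = refl
    shift (inj₂ _) = refl

  size-beside : ∀ {m n} (ℓ₁ : Fin m → Label) (ℓ₂ : Fin n → Label) k →
                size (beside ℓ₁ ℓ₂) k ≡ size ℓ₁ k ℤ.+ size ℓ₂ k
  size-beside {m} ℓ₁ ℓ₂ k = trans (Σ-cong λ v → push (splitAt m v)) (Σ-splitAt m _ _)
    where
    push : ∀ s → ⟦ δ ([ ℓ₁ , ℓ₂ ]′ s) k ⟧ ≡ [ (λ v → ⟦ δ (ℓ₁ v) k ⟧) , (λ v → ⟦ δ (ℓ₂ v) k ⟧) ]′ s
    push (inj₁ _) = refl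
    push (inj₂ _) = refl

  size-const : ∀ n l k → size {n} (const l) k ≡ ℤ.+ n ℤ.* ⟦ δ l k ⟧
  size-const n l k = Σ-const n ⟦ δ l k ⟧

  realises-combine : ∀ {m n} cross (G₁ : Graph m) (G₂ : Graph n) {ℓ₁ ℓ₂} →
    Realises G₁ ℓ₁ → Realises G₂ ℓ₂ →
    (∀ u v → link (ℓ₁ u) (ℓ₂ v) ≡ cross) → (∀ u v → link (ℓ₂ u) (ℓ₁ v) ≡ cross) →
    Realises (combine cross G₁ G₂) (beside ℓ₁ ℓ₂)
  realises-combine {m} {n} cross G₁ G₂ {ℓ₁} {ℓ₂} real₁ real₂ link₁₂ link₂₁ u v u≢v =
    go (splitAt m u) (splitAt m v) λ eq → u≢v
      (trans (sym (join-splitAt m n u)) (trans (cong (join m n) eq) (join-splitAt m n v)))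
    where
    go : ∀ s t → s ≢ t → adj⊎ cross G₁ G₂ s t ≡ link ([ ℓ₁ , ℓ₂ ]′ s) ([ ℓ₁ , ℓ₂ ]′ t)
    go (inj₁ u) (inj₁ v) s≢t = real₁ u v (s≢t ∘ cong inj₁)
    go (inj₂ u) (inj₂ v) s≢t = real₂ u v (s≢t ∘ cong inj₂)
    go (inj₁ u) (inj₂ v) _   = sym (link₁₂ u v)
    go (inj₂ u) (inj₁ v) _   = sym (link₂₁ u v)

  realises-complete : ∀ n {l} → link l l ≡ true → Realises (complete n) (const l)
  realises-complete n link-ll u v u≢v = trans (cong not (δ-≢ u≢v)) (sym link-ll)

  joined : ∀ r a c → Graph (r + (a + (c + 1)))
  joined r a c = edgeless r ∨ᴳ (complete a ∨ᴳ (complete c ∪ᴳ complete 1))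

  joined-label : ∀ r a c → Fin (r + (a + (c + 1))) → Label
  joined-label r a c = beside {r} (const ind) (beside {a} (const core) (beside {c} (const clique) (const pendant)))

  joined-realises : ∀ r a c → Realises (joined r a c) (joined-label r a c)
  joined-realises r a c =
    realises-combine true (edgeless r) (complete a ∨ᴳ (complete c ∪ᴳ complete 1))
      (λ _ _ _ → refl)
      (realises-combine true (complete a) (complete c ∪ᴳ complete 1)
        (realises-complete a {core} refl)
        (realises-combine false (complete c) (complete 1)
          (realises-complete c {clique} refl) (realises-complete 1 {pendant} refl) (λ _ _ → refl) (λ _ _ → refl))
        (λ _ v → core-left (splitAt c v))
        (λ u _ → core-right (splitAt c u)))
      (λ _ v → ind-left (splitAt a v)) (λ u _ → ind-right (splitAt a u))
    where
    rest : Fin c ⊎ Fin 1 → Label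
    rest = [ const clique , const pendant ]′
    core-left : ∀ s → link core (rest s) ≡ true
    core-left (inj₁ _) = refl
    core-left (inj₂ _) = refl
    core-right : ∀ s → link (rest s) core ≡ true
    core-right (inj₁ _) = refl
    core-right (inj₂ _) = refl
    ind-left : ∀ s → link ind ([ const core , rest ∘ splitAt c ]′ s) ≡ true
    ind-left (inj₁ _) = refl
    ind-left (inj₂ v) with splitAt c v
    ... | inj₁ _ = refl
    ... | inj₂ _ = refl
    ind-right : ∀ s → link ([ const core , rest ∘ splitAt c ]′ s) ind ≡ true
    ind-right (inj₁ _) = refl
    ind-right (inj₂ v) with splitAt c v
    ... | inj₁ _ = refl
    ... | inj₂ _ = refl

  joined-size : ∀ r′ a′ c′ → size (joined-label (suc r′) a′ (suc c′)) ≗ sizes r′ a′ c′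
  joined-size r′ a′ c′ k = begin
    size (joined-label r a′ c) k
      ≡⟨ size-beside {r} _ _ k ⟩
    size {r} (const ind) k ℤ.+ size (beside {a′} (const core) (beside {c} (const clique) (const pendant))) k
      ≡⟨ cong₂ ℤ._+_ (size-const r ind k) (size-beside {a′} _ _ k) ⟩
    ℤ.+ r ℤ.* ⟦ δ ind k ⟧ ℤ.+ (size {a′} (const core) k ℤ.+ size (beside {c} (const clique) (const pendant)) k)
      ≡⟨ cong (λ s → ℤ.+ r ℤ.* ⟦ δ ind k ⟧ ℤ.+ s) (cong₂ ℤ._+_ (size-const a′ core k)
           (trans (size-beside {c} _ _ k) (cong₂ ℤ._+_ (size-const c clique k) (size-const 1 pendant k)))) ⟩
    ℤ.+ r ℤ.* ⟦ δ ind k ⟧ ℤ.+ (ℤ.+ a′ ℤ.* ⟦ δ core k ⟧ ℤ.+ (ℤ.+ c ℤ.* ⟦ δ clique k ⟧ ℤ.+ 1ℤ ℤ.* ⟦ δ pendant k ⟧))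
      ≡⟨ evaluate k ⟩
    sizes r′ a′ c′ k ∎
    where
    open ≡-Reasoning
    open import Data.Integer.Tactic.RingSolver using (solve-∀)
    r = suc r′
    c = suc c′
    first : ∀ r a c → r ℤ.* 1ℤ ℤ.+ (a ℤ.* 0ℤ ℤ.+ (c ℤ.* 0ℤ ℤ.+ 1ℤ ℤ.* 0ℤ)) ≡ r
    first = solve-∀
    second : ∀ r a c → r ℤ.* 0ℤ ℤ.+ (a ℤ.* 1ℤ ℤ.+ (c ℤ.* 0ℤ ℤ.+ 1ℤ ℤ.* 0ℤ)) ≡ a
    second = solve-∀
    third : ∀ r a c → r ℤ.* 0ℤ ℤ.+ (a ℤ.* 0ℤ ℤ.+ (c ℤ.* 1ℤ ℤ.+ 1ℤ ℤ.* 0ℤ)) ≡ c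
    third = solve-∀
    fourth : ∀ r a c → r ℤ.* 0ℤ ℤ.+ (a ℤ.* 0ℤ ℤ.+ (c ℤ.* 0ℤ ℤ.+ 1ℤ ℤ.* 1ℤ)) ≡ 1ℤ
    fourth = solve-∀
    evaluate : ∀ k → ℤ.+ r ℤ.* ⟦ δ ind k ⟧ ℤ.+ (ℤ.+ a′ ℤ.* ⟦ δ core k ⟧ ℤ.+ (ℤ.+ c ℤ.* ⟦ δ clique k ⟧ ℤ.+ 1ℤ ℤ.* ⟦ δ pendant k ⟧)) ≡ sizes r′ a′ c′ k
    evaluate ind     = first (ℤ.+ r) (ℤ.+ a′) (ℤ.+ c)
    evaluate core    = second (ℤ.+ r) (ℤ.+ a′) (ℤ.+ c)
    evaluate clique  = third (ℤ.+ r) (ℤ.+ a′) (ℤ.+ c)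
    evaluate pendant = fourth (ℤ.+ r) (ℤ.+ a′) (ℤ.+ c)

  linked⇒≅ : ∀ {n} (G : Graph n) ℓ {r′ a′ c′} → size ℓ ≗ sizes r′ a′ c′ →
             (∀ u v → adj G u v ≡ linked ℓ u v) → G ≅ joined (suc r′) a′ (suc c′)
  linked⇒≅ G ℓ {r′} {a′} {c′} sizes-ok G≡ℓ
    with π , ok ← equal-sizes⇒↔ ℓ (joined-label (suc r′) a′ (suc c′))
                    (λ k → trans (sizes-ok k) (sym (joined-size r′ a′ c′ k))) =
    π , λ u v → begin
      adj (joined (suc r′) a′ (suc c′)) (Inverse.to π u) (Inverse.to π v)
        ≡⟨ realises⇒linked (joined (suc r′) a′ (suc c′)) _ (joined-realises (suc r′) a′ (suc c′)) (Inverse.to π u) (Inverse.to π v) ⟩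
      linked (joined-label (suc r′) a′ (suc c′)) (Inverse.to π u) (Inverse.to π v)
        ≡⟨ cong₂ _∧_ (cong not (δ-to π u v)) (cong₂ link (ok u) (ok v)) ⟩
      linked ℓ u v
        ≡⟨ G≡ℓ u v ⟨
      adj G u v ∎
    where
    open ≡-Reasoning
    δ-to : ∀ {m n} (π : Fin m ↔ Fin n) u v → δ (Inverse.to π u) (Inverse.to π v) ≡ δ u v
    δ-to π u v with u ≟ v
    ... | yes refl = δ-refl (Inverse.to π u)
    ... | no u≢v = δ-≢ λ eq → u≢v (trans (sym (Inverse.strictlyInverseʳ π u))
                     (trans (cong (Inverse.from π) eq) (Inverse.strictlyInverseʳ π v)))

  opaque
    unfolding _≼_

    ¬1≼0 : ¬ (1ʳ ≼ 0ʳ)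
    ¬1≼0 h with N , p ← h ½ (positive⁻¹ ½) with p N ≤-refl
    ... | *≤* (ℤ.+≤+ (s≤s ()))

  open PerronPair

  perron-pair-eigenvalue : ∀ {r′ a′ c′} (P : PerronPair r′ a′ c′) →
    IsEigenvalue (adjacencyMatrix (joined (suc r′) a′ (suc c′))) (ρ P)
  perron-pair-eigenvalue {r′} {a′} {c′} P = eigenvalue-intro (joined (suc r′) a′ (suc c′)) (ρ P) (y P ∘ ℓ)
    (λ y≈0 → ¬1≼0 (≼-trans (1≼y P (ℓ zero)) (≼-reflexive (y≈0 zero))))
    λ i → ≈-trans
      (Σᴿ-cong λ j → ⊠-congʳ (≡⇒≈ (cong ⟪_⟫
        (realises⇒linked (joined (suc r′) a′ (suc c′)) ℓ (joined-realises (suc r′) a′ (suc c′)) i j))))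
      (eigenvector P ℓ (joined-size r′ a′ c′) i)
    where
    ℓ = joined-label (suc r′) a′ (suc c′)

  -- The labelling lays a copy of H over the vertices of G with all edges of G among its edges. A
  -- pair that is an edge of the copy only contradicts `no-proper-subgraph`; without such a pair G
  -- equals the copy, hence is isomorphic to H.
  sublabelling-impossible : ∀ {n} (G : Graph n) ℓ {r′ a′ c′} (P : PerronPair r′ a′ c′) →
    Connected G → size ℓ ≗ sizes r′ a′ c′ →
    (∀ u v → adj G u v ≡ true → link (ℓ u) (ℓ v) ≡ true) →
    ∀ {ρG} → ρ P ≼ ρG → Modulus (adj G) ρG → ¬ (G ≅ joined (suc r′) a′ (suc c′)) → ⊥
  sublabelling-impossible G ℓ P connected sizes-ok G⊆link ρ≼ρG Z G≇H
    with any? (λ u → any? λ v → (linked ℓ u v ≟ᵇ true) ×-dec (adj G u v ≟ᵇ false))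
  ... | yes (u , v , ℓ-edge , G-gap) =
    no-proper-subgraph (adj G) (linked ℓ) (symm G) connected G⊆linked _ (ρ P) (y P ∘ ℓ) ρ≼ρG
      (λ i → 1≼y P (ℓ i)) (eigenvector P ℓ sizes-ok) Z u v ℓ-edge G-gap
    where
    G⊆linked : ∀ u v → adj G u v ≡ true → linked ℓ u v ≡ true
    G⊆linked u v e with u ≟ v
    ... | no _ = G⊆link u v e
    ... | yes refl with () ← trans (sym e) (irrefl G u)
  ... | no no-gap = G≇H (linked⇒≅ G ℓ sizes-ok same)
    where
    same : ∀ u v → adj G u v ≡ linked ℓ u v
    same u v with adj G u v in eqG | linked ℓ u v in eqℓ
    ... | true  | true  = refl
    ... | false | false = refl
    ... | false | true  = ⊥-elim (no-gap (u , v , eqℓ , eqG))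
    ... | true  | false with u ≟ v
    ...   | yes refl with () ← trans (sym eqG) (irrefl G u)
    ...   | no _ with () ← trans (sym eqℓ) (G⊆link u v eqG)

-- Row sums of A², missing edges and the quadratic estimate.

module Counting where

  open import Defs using (Graph; adj; symm; irrefl; Connected; Adjacent)
  open IntegerSums
  open BipartiteFactors using (cells; ∀ᵇ⁴⇒)
  open import Data.Bool.Base using (Bool; true; false; _∧_; not; T)
  open import Data.Bool.Properties using (∧-comm)
  open import Data.Fin.Base using (Fin; zero; suc)
  open import Data.Fin.Properties using (_≟_)
  open import Data.Integer.Base hiding (suc)
  open import Data.Integer.Properties hiding (_≟_)
  import Data.Integer.Properties as ℤ
  open import Data.Integer.Tactic.RingSolver using (solve-∀)
  open import Data.Nat.Base as ℕ using (ℕ)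
  open import Data.Product.Base using (∃; _,_; proj₁; proj₂)
  open import Data.Unit.Base using (tt)
  open import Relation.Binary.Construct.Closure.ReflexiveTransitive using (Star; ε; _◅_)
  open import Relation.Binary.PropositionalEquality
  open import Relation.Nullary using (yes; no; ¬_; contradiction)

  pairs : ∀ {m n} (P : Fin m → Bool) (Q : Fin n → Bool) →
          Σℤ (λ u → Σℤ (λ v → ⟦ P u ∧ Q v ⟧)) ≡ # P * # Q
  pairs P Q = begin
    Σℤ (λ u → Σℤ (λ v → ⟦ P u ∧ Q v ⟧))          ≡⟨ Σ-cong (λ u → Σ-cong λ v → ⟦∧⟧ (P u) (Q v)) ⟩
    Σℤ (λ u → Σℤ (λ v → ⟦ P u ⟧ * ⟦ Q v ⟧))      ≡⟨ Σ-cong (λ u → Σ-distribˡ-* ⟦ P u ⟧ (λ v → ⟦ Q v ⟧)) ⟨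
    Σℤ (λ u → ⟦ P u ⟧ * # Q)                     ≡⟨ Σ-cong (λ u → *-comm ⟦ P u ⟧ (# Q)) ⟩
    Σℤ (λ u → # Q * ⟦ P u ⟧)                     ≡⟨ Σ-distribˡ-* (# Q) (λ u → ⟦ P u ⟧) ⟨
    # Q * # P                                    ≡⟨ *-comm (# Q) (# P) ⟩
    # P * # Q                                    ∎
    where open ≡-Reasoning

  Σδ-diagonal : ∀ {n} (P : Fin n → Bool) → Σℤ (λ u → Σℤ (λ v → ⟦ δ u v ∧ P v ⟧)) ≡ # P
  Σδ-diagonal P = Σ-cong λ u → trans (Σ-cong λ v → ⟦∧⟧ (δ u v) (P v)) (Σ-δ u (λ v → ⟦ P v ⟧))

  degree-sum : ∀ {n} → Graph n → ℤ
  degree-sum G = Σℤ (λ u → # (adj G u))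

  -- From the sum of all degrees, the row sum of A² at u omits the degree of u itself and those of
  -- the n - 1 - deg u vertices other than u that are not adjacent to it. Each of the latter is at
  -- least 1, so at least n - 1 is lost.
  two-step-bound : ∀ {n} (G : Graph n) → (∀ u → 1ℤ ≤ # (adj G u)) →
                   ∀ u → Σℤ (λ v → ⟦ adj G u v ⟧ * # (adj G v)) ≤ degree-sum G - + n + 1ℤ
  two-step-bound {n} G deg≥1 u = subst (Σℤ (λ v → ⟦ adj G u v ⟧ * d v) ≤_) total (Σ-mono cell)
    where
    d : Fin n → ℤ
    d v = # (adj G v)

    cell : ∀ v → ⟦ adj G u v ⟧ * d v ≤ d v - 1ℤ + ⟦ adj G u v ⟧ - ⟦ δ u v ⟧ * (d v - 1ℤ)
    cell v with u ≟ v
    ... | yes refl rewrite irrefl G u = ≤-reflexive (on-diagonal (d u))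
      where
      on-diagonal : ∀ d → 0ℤ * d ≡ d - 1ℤ + 0ℤ - 1ℤ * (d - 1ℤ)
      on-diagonal = solve-∀
    ... | no _ = ≤-by _ (diff (⟦⟧≤1 (adj G u v)) ⊛ diff (deg≥1 v)) (off-diagonal ⟦ adj G u v ⟧ (d v))
      where
      off-diagonal : ∀ a d → d - 1ℤ + a - 0ℤ * (d - 1ℤ) - a * d ≡ (1ℤ - a) * (d - 1ℤ)
      off-diagonal = solve-∀

    total : Σℤ (λ v → d v - 1ℤ + ⟦ adj G u v ⟧ - ⟦ δ u v ⟧ * (d v - 1ℤ)) ≡ degree-sum G - + n + 1ℤ
    total = begin
      Σℤ (λ v → d v - 1ℤ + ⟦ adj G u v ⟧ - ⟦ δ u v ⟧ * (d v - 1ℤ))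
        ≡⟨ Σ-distrib-- (λ v → d v - 1ℤ + ⟦ adj G u v ⟧) (λ v → ⟦ δ u v ⟧ * (d v - 1ℤ)) ⟩
      Σℤ (λ v → d v - 1ℤ + ⟦ adj G u v ⟧) - Σℤ (λ v → ⟦ δ u v ⟧ * (d v - 1ℤ))
        ≡⟨ cong₂ _-_ (trans (Σ-distrib-+ (λ v → d v - 1ℤ) (λ v → ⟦ adj G u v ⟧))
             (cong (_+ d u) (trans (Σ-distrib-- d (λ _ → 1ℤ)) (cong (λ s → degree-sum G - s) (Σ-const n 1ℤ)))))
             (Σ-δ u (λ v → d v - 1ℤ)) ⟩
      degree-sum G - + n * 1ℤ + d u - (d u - 1ℤ)
        ≡⟨ simplify (degree-sum G) (+ n) (d u) ⟩
      degree-sum G - + n + 1ℤ ∎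
      where
      open ≡-Reasoning
      simplify : ∀ s n d → s - n * 1ℤ + d - (d - 1ℤ) ≡ s - n + 1ℤ
      simplify = solve-∀

  connected⇒degree≥1 : ∀ {n} (G : Graph n) → 2 ℕ.≤ n → Connected G → ∀ u → 1ℤ ≤ # (adj G u)
  connected⇒degree≥1 {n} G 2≤n connected u =
    first-edge (connected u (proj₁ (another 2≤n u))) (proj₂ (another 2≤n u))
    where
    another : ∀ {n} → 2 ℕ.≤ n → (u : Fin n) → ∃ λ v → u ≢ v
    another (ℕ.s≤s (ℕ.s≤s _)) zero    = suc zero , λ ()
    another (ℕ.s≤s (ℕ.s≤s _)) (suc _) = zero , λ ()
    first-edge : ∀ {v} → Star (Adjacent G) u v → u ≢ v → 1ℤ ≤ # (adj G u)
    first-edge ε u≢v = contradiction refl u≢v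
    first-edge (_◅_ {j = w} e _) _ = subst (_≤ # (adj G u)) (cong ⟦_⟧ e) (term≤Σ (λ v → ⟦⟧≥0 (adj G u v)) w)

  cells-symmetric : ∀ {n} (G : Graph n) X Y → cells (adj G) X Y ≡ cells (adj G) Y X
  cells-symmetric G X Y = trans (Σ-comm (λ u v → ⟦ adj G u v ∧ X u ∧ Y v ⟧))
    (Σ-cong λ v → Σ-cong λ u → cong ⟦_⟧ (cong₂ _∧_ (symm G u v) (∧-comm (X u) (Y v))))

  -- The missing edges of G: those inside J, those between X and Y in either
  -- order (counted twice inside X ∩ Y), and the diagonal outside J and X ∩ Y.
  module _ {n} (G : Graph n) (J X₀ Y₀ : Fin n → Bool)
           (independent : ∀ u v → J u ≡ true → J v ≡ true → ¬ Adjacent G u v) where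

    private
      X Y K L : Fin n → Bool
      X u = X₀ u ∧ not (J u)
      Y u = Y₀ u ∧ not (J u)
      K u = X u ∧ Y u
      L u = not (J u) ∧ not (K u)

    missing-cell : ∀ u v →
      ⟦ adj G u v ⟧ + ⟦ J u ∧ J v ⟧ + ⟦ X u ∧ Y v ⟧ + ⟦ Y u ∧ X v ⟧ + ⟦ δ u v ∧ L v ⟧ ≤
      1ℤ + ⟦ adj G u v ∧ X u ∧ Y v ⟧ + ⟦ adj G u v ∧ Y u ∧ X v ⟧ + ⟦ K u ∧ K v ⟧
    missing-cell u v with u ≟ v
    ... | yes refl rewrite irrefl G u = ≤ᵇ⇒≤ (∀ᵇ⁴⇒ diagonal tt (J u) (X₀ u) (Y₀ u) true)
      where
      diagonal : Bool → Bool → Bool → Bool → Bool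
      diagonal j x y _ = let x = x ∧ not j ; y = y ∧ not j in
        0ℤ + ⟦ j ∧ j ⟧ + ⟦ x ∧ y ⟧ + ⟦ y ∧ x ⟧ + ⟦ not j ∧ not (x ∧ y) ⟧ ≤ᵇ
        1ℤ + 0ℤ + 0ℤ + ⟦ (x ∧ y) ∧ (x ∧ y) ⟧
    ... | no _ with adj G u v in eq | J u in eqJ | J v in eqJ′
    ...   | true  | true  | true  = contradiction eq (independent u v eqJ eqJ′)
    ...   | true  | true  | false = ≤ᵇ⇒≤ (∀ᵇ⁴⇒ (edge true false) tt (X₀ u) (X₀ v) (Y₀ u) (Y₀ v))
      where
      edge : Bool → Bool → Bool → Bool → Bool → Bool → Bool
      edge j j′ x x′ y y′ = let x = x ∧ not j ; y = y ∧ not j ; x′ = x′ ∧ not j′ ; y′ = y′ ∧ not j′ in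
        1ℤ + ⟦ j ∧ j′ ⟧ + ⟦ x ∧ y′ ⟧ + ⟦ y ∧ x′ ⟧ + 0ℤ ≤ᵇ 1ℤ + ⟦ x ∧ y′ ⟧ + ⟦ y ∧ x′ ⟧ + ⟦ (x ∧ y) ∧ (x′ ∧ y′) ⟧
    ...   | true  | false | j′ = ≤ᵇ⇒≤ (edge-any j′)
      where
      edge : Bool → Bool → Bool → Bool → Bool → Bool
      edge j′ x x′ y y′ = let x = x ∧ true ; y = y ∧ true ; x′ = x′ ∧ not j′ ; y′ = y′ ∧ not j′ in
        1ℤ + 0ℤ + ⟦ x ∧ y′ ⟧ + ⟦ y ∧ x′ ⟧ + 0ℤ ≤ᵇ 1ℤ + ⟦ x ∧ y′ ⟧ + ⟦ y ∧ x′ ⟧ + ⟦ (x ∧ y) ∧ (x′ ∧ y′) ⟧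
      edge-any : ∀ j′ → T (edge j′ (X₀ u) (X₀ v) (Y₀ u) (Y₀ v))
      edge-any true  = ∀ᵇ⁴⇒ (edge true) tt (X₀ u) (X₀ v) (Y₀ u) (Y₀ v)
      edge-any false = ∀ᵇ⁴⇒ (edge false) tt (X₀ u) (X₀ v) (Y₀ u) (Y₀ v)
    ...   | false | j | j′ = ≤ᵇ⇒≤ (non-edge-any j j′)
      where
      non-edge : Bool → Bool → Bool → Bool → Bool → Bool → Bool
      non-edge j j′ x x′ y y′ = let x = x ∧ not j ; y = y ∧ not j ; x′ = x′ ∧ not j′ ; y′ = y′ ∧ not j′ in
        0ℤ + ⟦ j ∧ j′ ⟧ + ⟦ x ∧ y′ ⟧ + ⟦ y ∧ x′ ⟧ + 0ℤ ≤ᵇ 1ℤ + 0ℤ + 0ℤ + ⟦ (x ∧ y) ∧ (x′ ∧ y′) ⟧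
      non-edge-any : ∀ j j′ → T (non-edge j j′ (X₀ u) (X₀ v) (Y₀ u) (Y₀ v))
      non-edge-any true  true  = ∀ᵇ⁴⇒ (non-edge true true) tt (X₀ u) (X₀ v) (Y₀ u) (Y₀ v)
      non-edge-any true  false = ∀ᵇ⁴⇒ (non-edge true false) tt (X₀ u) (X₀ v) (Y₀ u) (Y₀ v)
      non-edge-any false true  = ∀ᵇ⁴⇒ (non-edge false true) tt (X₀ u) (X₀ v) (Y₀ u) (Y₀ v)
      non-edge-any false false = ∀ᵇ⁴⇒ (non-edge false false) tt (X₀ u) (X₀ v) (Y₀ u) (Y₀ v)

    #L : # L ≡ + n - # J - # K
    #L = begin
      # L                                      ≡⟨ Σ-cong (λ u → part (J u) (X₀ u) (Y₀ u)) ⟩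
      Σℤ (λ u → 1ℤ - ⟦ J u ⟧ - ⟦ K u ⟧)        ≡⟨ Σ-distrib-- (λ u → 1ℤ - ⟦ J u ⟧) (λ u → ⟦ K u ⟧) ⟩
      Σℤ (λ u → 1ℤ - ⟦ J u ⟧) - # K            ≡⟨ cong (_- # K) (Σ-distrib-- (λ _ → 1ℤ) (λ u → ⟦ J u ⟧)) ⟩
      Σℤ {n} (λ _ → 1ℤ) - # J - # K            ≡⟨ cong (λ s → s - # J - # K) (trans (Σ-const n 1ℤ) (*-identityʳ (+ n))) ⟩
      + n - # J - # K                          ∎
      where
      open ≡-Reasoning
      part : ∀ j x y → ⟦ not j ∧ not ((x ∧ not j) ∧ (y ∧ not j)) ⟧ ≡ 1ℤ - ⟦ j ⟧ - ⟦ (x ∧ not j) ∧ (y ∧ not j) ⟧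
      part true  true  true  = refl
      part true  true  false = refl
      part true  false true  = refl
      part true  false false = refl
      part false true  true  = refl
      part false true  false = refl
      part false false true  = refl
      part false false false = refl

    missing-edges : let e = cells (adj G) X Y ; k = # K in
      degree-sum G + # J * # J + # X * # Y + # Y * # X + (+ n - # J - k) ≤
      + n * + n + e + e + k * k
    missing-edges = subst₂ _≤_ lhs rhs (Σ-mono λ u → Σ-mono (missing-cell u))
      where
      open ≡-Reasoning
      ΣΣ-+ : ∀ (f g : Fin n → Fin n → ℤ) →
             Σℤ (λ i → Σℤ (λ j → f i j + g i j)) ≡ Σℤ (λ i → Σℤ (f i)) + Σℤ (λ i → Σℤ (g i))
      ΣΣ-+ f g = trans (Σ-cong λ i → Σ-distrib-+ (f i) (g i)) (Σ-distrib-+ (λ i → Σℤ (f i)) (λ i → Σℤ (g i)))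
      lhs : Σℤ (λ u → Σℤ (λ v → ⟦ adj G u v ⟧ + ⟦ J u ∧ J v ⟧ + ⟦ X u ∧ Y v ⟧ + ⟦ Y u ∧ X v ⟧ + ⟦ δ u v ∧ L v ⟧)) ≡
            degree-sum G + # J * # J + # X * # Y + # Y * # X + (+ n - # J - # K)
      lhs = trans (ΣΣ-+ _ (λ u v → ⟦ δ u v ∧ L v ⟧)) (cong₂ _+_
        (trans (ΣΣ-+ _ (λ u v → ⟦ Y u ∧ X v ⟧)) (cong₂ _+_
          (trans (ΣΣ-+ _ (λ u v → ⟦ X u ∧ Y v ⟧)) (cong₂ _+_
            (trans (ΣΣ-+ (λ u v → ⟦ adj G u v ⟧) (λ u v → ⟦ J u ∧ J v ⟧)) (cong (λ s → degree-sum G + s) (pairs J J)))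
            (pairs X Y)))
          (pairs Y X)))
        (trans (Σδ-diagonal L) #L))
      rhs : Σℤ (λ u → Σℤ (λ v → 1ℤ + ⟦ adj G u v ∧ X u ∧ Y v ⟧ + ⟦ adj G u v ∧ Y u ∧ X v ⟧ + ⟦ K u ∧ K v ⟧)) ≡
            + n * + n + cells (adj G) X Y + cells (adj G) X Y + # K * # K
      rhs = trans (ΣΣ-+ _ (λ u v → ⟦ K u ∧ K v ⟧)) (cong₂ _+_
        (trans (ΣΣ-+ _ (λ u v → ⟦ adj G u v ∧ Y u ∧ X v ⟧)) (cong₂ _+_
          (trans (ΣΣ-+ (λ _ _ → 1ℤ) (λ u v → ⟦ adj G u v ∧ X u ∧ Y v ⟧))
            (cong (_+ cells (adj G) X Y) (trans (Σ-cong {n} λ _ → trans (Σ-const n 1ℤ) (*-identityʳ (+ n))) (Σ-const n (+ n)))))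
          (cells-symmetric G Y X)))
        (pairs K K))

  -- The lower bound on n of the theorem for the least possible b, 2r + 2.
  Large : (n r a : ℤ) → Set
  Large n r a = r * r + r + r + 1ℤ + (a * a + a * a) + (a * r + a * r) + (a + a + a + a) ≤ n - r

  module _ {x y k d r a e n s : ℤ}
           (1≤a : 1ℤ ≤ a) (1≤r : 1ℤ ≤ r) (2≤x : + 2 ≤ x) (x≤y : x ≤ y) (0≤k : 0ℤ ≤ k) (k≤x : k ≤ x)
           (y≤ : y ≤ n - r) (1≤d : 1ℤ ≤ d) (d≡ : d ≡ x + y - (n - r)) (e< : e + 1ℤ ≤ a * d)
           (large : Large n r a)
           (missing : s + r * r + x * y + y * x + (n - r - k) ≤ n * n + e + e + k * k) where

    private
      t : ℤ
      t = y - x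

      0≤t : 0ℤ ≤ t
      0≤t = diff x≤y

      N₀ : ℤ
      N₀ = r * r + r + r + 1ℤ + (a * a + a * a) + (a * r + a * r) + (a + a + a + a)

      0≤a = ≤-trans (nat 1) 1≤a
      0≤r = ≤-trans (nat 1) 1≤r
      0≤x = ≤-trans (nat 2) 2≤x

      -- The order bound expressed through t, by n - r = x + y - d = 2x + t - d.
      slack : 0ℤ ≤ t - (N₀ + d - (x + x))
      slack = subst (0ℤ ≤_) (trans (regroup n r x y N₀) (cong (λ d → y - x - (N₀ + d - (x + x))) (sym d≡))) (diff large)
        where
        regroup : ∀ n r x y N → n - r - N ≡ y - x - (N + (x + y - (n - r)) - (x + x))
        regroup = solve-∀

      d≤x : 0ℤ ≤ x - d
      d≤x = subst (0ℤ ≤_) (trans (regroup n r x y) (cong (λ d → x - d) (sym d≡))) (diff y≤)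
        where
        regroup : ∀ n r x y → n - r - y ≡ x - (x + y - (n - r))
        regroup = solve-∀

      -- Here x, y and k stand for |X|, |Y| and |X ∩ Y|. This is the room left in the desired bound
      -- on s once `missing` is relaxed by e ≤ ad - 1 and k ≤ x and n is eliminated through n - r =
      -- 2x + t - d.
      Φ : ℤ
      Φ = (x - 1ℤ) * (x - + 6) + (x + x - + 3) * t - (a + a - + 3) * d - (r + r)

    Φ≥0⇒ : 0ℤ ≤ Φ → s ≤ n * n - + 4 * n - r * r + (r + r) + + 4
    Φ≥0⇒ 0≤Φ = ≤-by _
      (diff missing ⊕ (diff e< ⊕ diff e<) ⊕ (diff k≤x ⊛ (0≤x ⊕ 0≤k ⊕ nat 1)) ⊕ 0≤Φ)
      (trans (certificate x y k r a e n s) (cong (λ d → n * n + e + e + k * k - (s + r * r + x * y + y * x + (n - r - k)) +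
          (a * d - (e + 1ℤ) + (a * d - (e + 1ℤ))) + (x - k) * (x + k + 1ℤ) +
          ((x - 1ℤ) * (x - + 6) + (x + x - + 3) * (y - x) - (a + a - + 3) * d - (r + r))) (sym d≡)))
      where
      certificate : ∀ x y k r a e n s → let d = x + y - (n - r) in
        n * n - + 4 * n - r * r + (r + r) + + 4 - s ≡
        n * n + e + e + k * k - (s + r * r + x * y + y * x + (n - r - k)) +
        (a * d - (e + 1ℤ) + (a * d - (e + 1ℤ))) + (x - k) * (x + k + 1ℤ) +
        ((x - 1ℤ) * (x - + 6) + (x + x - + 3) * (y - x) - (a + a - + 3) * d - (r + r))
      certificate = solve-∀

    -- Φ is convex in x; t ≥ N₀ + d - 2x turns it into a quadratic in x of
    -- negative discriminant.
    Φ≥0 : 0ℤ ≤ Φ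
    Φ≥0 with 1ℤ ℤ.≟ a
    -- For a ≥ 2, one copy of `slack` supplies a single t and cancels a single d. The other 2a - 4
    -- copies of d are bounded by x, leaving a quadratic in x with linear coefficient -(2a + 5); the
    -- factor 4 completes its square over the integers.
    ... | no 1≢a = *-cancelʳ-≤-pos 0ℤ Φ (+ 4) (≤-by _
        (square (x + x - + 5 - (a + a))
          ⊕ (nat 3 ⊕ nat 4 ⊛ square r ⊕ nat 4 ⊛ (0≤a ⊛ diff 1≤a) ⊕ nat 8 ⊛ (0≤a ⊛ 0≤r))
          ⊕ nat 4 ⊛ ((diff 2≤x ⊕ diff 2≤x) ⊛ 0≤t ⊕ slack ⊕ (diff 2≤a ⊕ diff 2≤a) ⊛ d≤x))
        (quadratic x y d r a))
      where
      2≤a : + 2 ≤ a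
      2≤a = i<j⇒suc[i]≤j (≤∧≢⇒< 1≤a 1≢a)
      quadratic : ∀ x y d r a → let t = y - x ; N₀ = r * r + r + r + 1ℤ + (a * a + a * a) + (a * r + a * r) + (a + a + a + a) in
        ((x - 1ℤ) * (x - + 6) + (x + x - + 3) * t - (a + a - + 3) * d - (r + r)) * + 4 - 0ℤ * + 4 ≡
        (x + x - + 5 - (a + a)) * (x + x - + 5 - (a + a)) +
        (+ 3 + + 4 * (r * r) + + 4 * (a * (a - 1ℤ)) + + 8 * (a * r)) +
        + 4 * ((x - + 2 + (x - + 2)) * t + (t - (N₀ + d - (x + x))) + (a - + 2 + (a - + 2)) * (x - d))
      quadratic = solve-∀
    -- For a = 1 a single copy of `slack` falls short: with r = d = 1 it yields x² - 9x + 18, which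
    -- is negative at x = 4 and x = 5. From x = 3 on the coefficient 2x - 3 of t is at least 3 and
    -- allows two copies, so only x = 2 is treated apart.
    ... | yes refl with + 2 ℤ.≟ x
    ...   | yes refl = ≤-by _ (slack ⊕ (square r ⊕ (diff 1≤r ⊕ diff 1≤r) ⊕ (diff 1≤d ⊕ diff 1≤d) ⊕ nat 3)) (linear y d r)
      where
      linear : ∀ y d r → let t = y - + 2 ; N₀ = r * r + r + r + 1ℤ + + 2 + (1ℤ * r + 1ℤ * r) + + 4 in
        + 1 * (+ 2 - + 6) + + 1 * t - (-[1+ 0 ]) * d - (r + r) - 0ℤ ≡
        t - (N₀ + d - + 4) + (r * r + (r - 1ℤ + (r - 1ℤ)) + (d - 1ℤ + (d - 1ℤ)) + + 3)
      linear = solve-∀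
    ...   | no 2≢x = *-cancelʳ-≤-pos 0ℤ Φ (+ 4) (≤-by _
        (square (x + x - + 11)
          ⊕ nat 4 ⊛ ((diff 3≤x ⊕ diff 3≤x) ⊛ 0≤t ⊕ 0≤t ⊕ (slack ⊕ slack))
          ⊕ (nat 8 ⊛ (0≤r ⊛ diff 1≤r) ⊕ nat 32 ⊛ diff 1≤r ⊕ nat 12 ⊛ diff 1≤d ⊕ nat 3))
        (quadratic x y d r))
      where
      3≤x : + 3 ≤ x
      3≤x = i<j⇒suc[i]≤j (≤∧≢⇒< 2≤x 2≢x)
      quadratic : ∀ x y d r → let t = y - x ; N₀ = r * r + r + r + 1ℤ + + 2 + (1ℤ * r + 1ℤ * r) + + 4 in
        ((x - 1ℤ) * (x - + 6) + (x + x - + 3) * t - (-[1+ 0 ]) * d - (r + r)) * + 4 - 0ℤ * + 4 ≡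
        (x + x - + 11) * (x + x - + 11) +
        + 4 * ((x - + 3 + (x - + 3)) * t + t + (t - (N₀ + d - (x + x)) + (t - (N₀ + d - (x + x))))) +
        (+ 8 * (r * (r - 1ℤ)) + + 32 * (r - 1ℤ) + + 12 * (d - 1ℤ) + + 3)
      quadratic = solve-∀

    few-edges : s ≤ n * n - + 4 * n - r * r + (r + r) + + 4
    few-edges = Φ≥0⇒ Φ≥0

-- A vertex with few neighbours outside J makes G a subgraph of H.

module LowDegree where

  open import Defs using (Graph; adj; symm; irrefl; Adjacent)
  open IntegerSums
  open ExtremalEigenvector using (Label; ind; core; clique; pendant; link; size; sizes)
  open import Data.Bool.Base using (Bool; true; false; _∧_; not; if_then_else_)
  open import Data.Bool.Properties using (∧-zeroʳ)
  open import Data.Fin.Base using (Fin; zero; suc)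
  open import Data.Fin.Properties using (_≟_)
  open import Data.Integer.Base hiding (suc)
  open import Data.Integer.Properties hiding (_≟_)
  open import Data.Integer.Tactic.RingSolver using (solve-∀)
  open import Data.Nat.Base using (ℕ; zero; suc)
  open import Data.Product.Base using (∃; _,_; _×_)
  open import Function.Base using (_∘_)
  open import Relation.Binary.PropositionalEquality
  open import Relation.Nullary using (yes; no; ¬_; contradiction)

  _⊆_ : ∀ {n} → (Fin n → Bool) → (Fin n → Bool) → Set
  P ⊆ Q = ∀ i → P i ≡ true → Q i ≡ true

  #-mono : ∀ {n} {P Q : Fin n → Bool} → P ⊆ Q → # P ≤ # Q
  #-mono {P = P} {Q} P⊆Q = Σ-mono term
    where
    term : ∀ i → ⟦ P i ⟧ ≤ ⟦ Q i ⟧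
    term i with P i in eq
    ... | false = ⟦⟧≥0 (Q i)
    ... | true rewrite P⊆Q i eq = ≤-refl

  cons : ∀ {n} → Bool → (Fin n → Bool) → Fin (suc n) → Bool
  cons b S zero    = b
  cons b S (suc i) = S i

  private
    shift : ∀ k p → k - 1ℤ - p ≡ k - (1ℤ + p)
    shift = solve-∀
    shift′ : ∀ k q → q - (k - 1ℤ) ≡ 1ℤ + q - k
    shift′ = solve-∀
    restore : ∀ k → 1ℤ + (k - 1ℤ) ≡ k
    restore = solve-∀

  -- The low-degree vertex may have fewer than a - 1 neighbours outside J. This pads them to the
  -- exact size of the core.
  interpolate : ∀ {n} (P Q : Fin n → Bool) k → P ⊆ Q → # P ≤ k → k ≤ # Q →
                ∃ λ S → P ⊆ S × S ⊆ Q × # S ≡ k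
  interpolate {zero} P Q k P⊆Q #P≤k k≤#Q = P , (λ _ p → p) , P⊆Q
    , ≤-antisym #P≤k (≤-trans k≤#Q (≤-reflexive (trans (Σ-nil _) (sym (Σ-nil _)))))
  interpolate {suc n} P Q k P⊆Q #P≤k k≤#Q
    with P zero in eqP | Q zero in eqQ | subst (_≤ k) (Σ-cons _) #P≤k | subst (k ≤_) (Σ-cons _) k≤#Q
  ... | true | false | _ | _ with () ← trans (sym (P⊆Q zero eqP)) eqQ
  ... | true | true | P≤ | ≤Q
    with S , P⊆S , S⊆Q , #S ← interpolate (P ∘ suc) (Q ∘ suc) (k - 1ℤ) (P⊆Q ∘ suc)
      (≤-by _ (diff P≤) (shift k (# (P ∘ suc)))) (≤-by _ (diff ≤Q) (shift′ k (# (Q ∘ suc)))) =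
    cons true S , (λ { zero _ → refl ; (suc i) → P⊆S i }) , (λ { zero _ → eqQ ; (suc i) → S⊆Q i })
    , trans (Σ-cons _) (trans (cong (λ s → 1ℤ + s) #S) (restore k))
  ... | false | false | P≤ | ≤Q
    with S , P⊆S , S⊆Q , #S ← interpolate (P ∘ suc) (Q ∘ suc) k (P⊆Q ∘ suc)
      (subst (_≤ k) (+-identityˡ _) P≤) (subst (k ≤_) (+-identityˡ _) ≤Q) =
    cons false S , (λ { zero p → contradiction (trans (sym p) eqP) (λ ()) ; (suc i) → P⊆S i })
    , (λ { (suc i) → S⊆Q i }) , trans (Σ-cons _) (trans (+-identityˡ _) #S)
  -- An optional position is skipped as long as the rest of Q can still supply k elements.
  ... | false | true | P≤ | ≤Q with k ≤? # (Q ∘ suc)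
  ...   | yes k≤Q
    with S , P⊆S , S⊆Q , #S ← interpolate (P ∘ suc) (Q ∘ suc) k (P⊆Q ∘ suc)
      (subst (_≤ k) (+-identityˡ _) P≤) k≤Q =
    cons false S , (λ { zero p → contradiction (trans (sym p) eqP) (λ ()) ; (suc i) → P⊆S i })
    , (λ { (suc i) → S⊆Q i }) , trans (Σ-cons _) (trans (+-identityˡ _) #S)
  ...   | no k≰Q
    with S , P⊆S , S⊆Q , #S ← interpolate (P ∘ suc) (Q ∘ suc) (k - 1ℤ) (P⊆Q ∘ suc)
      (≤-by _ (diff (≤-trans (+-monoʳ-≤ 1ℤ (#-mono (P⊆Q ∘ suc))) (i<j⇒suc[i]≤j (≰⇒> k≰Q)))) (shift k (# (P ∘ suc))))
      (≤-by _ (diff ≤Q) (shift′ k (# (Q ∘ suc)))) =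
    cons true S , (λ { zero _ → refl ; (suc i) → P⊆S i }) , (λ { zero _ → eqQ ; (suc i) → S⊆Q i })
    , trans (Σ-cons _) (trans (cong (λ s → 1ℤ + s) #S) (restore k))

  module _ {n} (G : Graph n) (J : Fin n → Bool) (v : Fin n) (r′ a′ c′ : ℕ)
           (independent : ∀ u w → J u ≡ true → J w ≡ true → ¬ Adjacent G u w)
           (#J : # J ≡ + suc r′) (v∉J : J v ≡ false)
           (degree : # (λ w → adj G v w ∧ not (J w)) ≤ + a′)
           (order : + n ≡ + suc r′ + + a′ + + suc c′ + 1ℤ) where

    private
      N Q : Fin n → Bool
      N w = adj G v w ∧ not (J w)
      Q w = not (J w) ∧ not (δ v w)

      N⊆Q : N ⊆ Q
      N⊆Q w e with v ≟ w
      ... | yes refl rewrite irrefl G v with () ← e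
      ... | no _ with adj G v w | J w
      ...   | true | false = refl

      partition : ∀ w → ⟦ J w ⟧ + ⟦ δ v w ⟧ + ⟦ Q w ⟧ ≡ 1ℤ
      partition w with v ≟ w
      ... | yes refl rewrite v∉J = refl
      ... | no _ with J w
      ...   | true  = refl
      ...   | false = refl

      #δ : # (δ v) ≡ 1ℤ
      #δ = trans (Σ-cong λ w → sym (*-identityʳ ⟦ δ v w ⟧)) (Σ-δ v (λ _ → 1ℤ))

      #Q : # Q ≡ + a′ + + suc c′
      #Q = trans (complement (# J) (# (δ v)) (# Q) (+ n) total)
        (trans (cong (λ m → m - # J - # (δ v)) order)
        (trans (cong₂ (λ j d → + suc r′ + + a′ + + suc c′ + 1ℤ - j - d) #J #δ)
               (simplify (+ suc r′) (+ a′) (+ suc c′))))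
        where
        total : # J + # (δ v) + # Q ≡ + n
        total = trans (sym (trans (Σ-distrib-+ (λ w → ⟦ J w ⟧ + ⟦ δ v w ⟧) (λ w → ⟦ Q w ⟧))
                  (cong (_+ # Q) (Σ-distrib-+ (λ w → ⟦ J w ⟧) (λ w → ⟦ δ v w ⟧)))))
          (trans (Σ-cong partition) (trans (Σ-const n 1ℤ) (*-identityʳ (+ n))))
        complement : ∀ j d q m → j + d + q ≡ m → q ≡ m - j - d
        complement j d q m eq = trans (solo j d q) (cong (λ m → m - j - d) eq)
          where
          solo : ∀ j d q → q ≡ j + d + q - j - d
          solo = solve-∀
        simplify : ∀ r a c → r + a + c + 1ℤ - r - 1ℤ ≡ a + c
        simplify = solve-∀

    -- J becomes the independent class, v the pendant vertex, the padded neighbourhood of v the core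
    -- and everything else the clique. H forbids edges only inside J, which is independent, and
    -- between v and the clique, which contains no neighbour of v.
    low-degree-label : ∃ λ (ℓ : Fin n → Label) → size ℓ ≗ sizes r′ a′ c′ ×
                         (∀ u w → adj G u w ≡ true → link (ℓ u) (ℓ w) ≡ true)
    low-degree-label
      with S , N⊆S , S⊆Q , #S ← interpolate N Q (+ a′) N⊆Q degree
             (subst (+ a′ ≤_) (sym #Q) (i≤i+j (+ a′) (+ suc c′))) = ℓ , ℓ-size , ℓ-link
      where
      ℓ : Fin n → Label
      ℓ w = if J w then ind else if δ v w then pendant else if S w then core else clique

      S-false : ∀ {w} → Q w ≡ false → S w ≡ false
      S-false {w} Qw with S w in eq
      ... | false = refl
      ... | true with () ← trans (sym (S⊆Q w eq)) Qw

      is-core : ∀ w → ⟦ δ (ℓ w) core ⟧ ≡ ⟦ S w ⟧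
      is-core w with J w in eqJ | v ≟ w
      ... | true  | _        rewrite S-false {w} (cong (λ j → not j ∧ not (δ v w)) eqJ) = refl
      ... | false | yes refl rewrite S-false {v} (trans (cong (λ d → not (J v) ∧ not d) (δ-refl v)) (∧-zeroʳ (not (J v)))) = refl
      ... | false | no _ with S w
      ...   | true  = refl
      ...   | false = refl

      is-clique : ∀ w → ⟦ δ (ℓ w) clique ⟧ + ⟦ S w ⟧ ≡ ⟦ Q w ⟧
      is-clique w with J w in eqJ | v ≟ w
      ... | true  | _        rewrite S-false {w} (cong (λ j → not j ∧ not (δ v w)) eqJ) = refl
      ... | false | yes refl rewrite S-false {v} (trans (cong (λ d → not (J v) ∧ not d) (δ-refl v)) (∧-zeroʳ (not (J v)))) = refl
      ... | false | no _ with S w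
      ...   | true  = refl
      ...   | false = refl

      is-ind : ∀ w → ⟦ δ (ℓ w) ind ⟧ ≡ ⟦ J w ⟧
      is-ind w with J w | δ v w | S w
      ... | true  | _     | _     = refl
      ... | false | true  | _     = refl
      ... | false | false | true  = refl
      ... | false | false | false = refl

      is-pendant : ∀ w → ⟦ δ (ℓ w) pendant ⟧ ≡ ⟦ δ v w ⟧
      is-pendant w with v ≟ w
      ... | yes refl rewrite v∉J = refl
      ... | no _ with J w | S w
      ...   | true  | _     = refl
      ...   | false | true  = refl
      ...   | false | false = refl

      ℓ-size : size ℓ ≗ sizes r′ a′ c′
      ℓ-size ind     = trans (Σ-cong is-ind) #J
      ℓ-size core    = trans (Σ-cong is-core) #S
      ℓ-size clique  = begin
        size ℓ clique                          ≡⟨ add-sub (size ℓ clique) (# S) ⟩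
        size ℓ clique + # S - # S              ≡⟨ cong (_- # S) (Σ-distrib-+ (λ w → ⟦ δ (ℓ w) clique ⟧) (λ w → ⟦ S w ⟧)) ⟨
        Σℤ (λ w → ⟦ δ (ℓ w) clique ⟧ + ⟦ S w ⟧) - # S
                                               ≡⟨ cong₂ _-_ (trans (Σ-cong is-clique) #Q) #S ⟩
        + a′ + + suc c′ - + a′                 ≡⟨ sub (+ a′) (+ suc c′) ⟩
        + suc c′                               ∎
        where
        open ≡-Reasoning
        add-sub : ∀ x y → x ≡ x + y - y
        add-sub = solve-∀
        sub : ∀ a c → a + c - a ≡ c
        sub = solve-∀
      ℓ-size pendant = trans (Σ-cong is-pendant) #δ

      not-clique : ∀ {w} → adj G v w ≡ true → ℓ w ≡ clique → ∀ {A : Set} → A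
      not-clique {w} vw ℓw with J w in eqJ | v ≟ w
      ... | true  | _     with () ← ℓw
      ... | false | yes _ with () ← ℓw
      ... | false | no _  with S w in eqS
      ...   | true  with () ← ℓw
      ...   | false with () ← trans (sym (N⊆S w (cong₂ (λ e j → e ∧ not j) vw eqJ))) eqS

      pendant⇒v : ∀ {w} → ℓ w ≡ pendant → v ≡ w
      pendant⇒v {w} ℓw with J w | v ≟ w
      ... | true  | _       with () ← ℓw
      ... | false | yes v≡w = v≡w
      ... | false | no _    with S w
      ...   | true  with () ← ℓw
      ...   | false with () ← ℓw

      ind⇒J : ∀ {w} → ℓ w ≡ ind → J w ≡ true
      ind⇒J {w} ℓw with J w | v ≟ w
      ... | true  | _     = refl
      ... | false | yes _ with () ← ℓw
      ... | false | no _  with S w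
      ...   | true  with () ← ℓw
      ...   | false with () ← ℓw

      ℓ-link : ∀ u w → adj G u w ≡ true → link (ℓ u) (ℓ w) ≡ true
      ℓ-link u w e with ℓ u in eqᵘ | ℓ w in eqʷ
      ... | ind     | ind     = contradiction e (independent u w (ind⇒J eqᵘ) (ind⇒J eqʷ))
      ... | ind     | core    = refl
      ... | ind     | clique  = refl
      ... | ind     | pendant = refl
      ... | core    | ind     = refl
      ... | core    | core    = refl
      ... | core    | clique  = refl
      ... | core    | pendant = refl
      ... | clique  | ind     = refl
      ... | clique  | core    = refl
      ... | clique  | clique  = refl
      ... | clique  | pendant with refl ← pendant⇒v {w} eqʷ = not-clique (trans (symm G v u) e) eqᵘ
      ... | pendant | ind     = refl
      ... | pendant | core    = refl
      ... | pendant | clique  with refl ← pendant⇒v {u} eqᵘ = not-clique e eqʷ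
      ... | pendant | pendant = refl

-- From a 0/1 matrix to a fractional factor of G - I.

module FractionalFactors where

  open import Defs hiding (sum)
  import Defs
  open IntegerSums
  open BipartiteFactors
  open Rationals using (ι; ι-def; ι-0; ι-+; ι-mono; half+half) renaming (_⊛_ to _⊛ℚ_)
  open Reals
  open Spectral
  open import Data.Bool.Base using (Bool; true; false; _∧_; not; if_then_else_)
  open import Data.Fin.Base using (Fin; zero; suc)
  open import Data.Fin.Subset using (Subset; ∁; ∣_∣)
  open import Data.Integer.Base as ℤ using (ℤ; +_; 0ℤ; 1ℤ)
  import Data.Integer.Properties as ℤ
  open import Data.Nat.Base as ℕ using (ℕ)
  open import Data.Product.Base using (_,_; _×_; proj₁; proj₂)
  open import Data.Rational.Base as ℚ using (ℚ; 0ℚ; 1ℚ; ½)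
  import Data.Rational.Properties as ℚ
  open import Data.Vec.Base using (_∷_; []; lookup)
  open import Data.Vec.Properties using (lookup-map)
  open import Function.Base using (_∘_)
  open import Relation.Binary.PropositionalEquality

  lookup-embed : ∀ {n} (p : Subset n) i → lookup p (embed p i) ≡ true
  lookup-embed (true  ∷ p) zero    = refl
  lookup-embed (true  ∷ p) (suc i) = lookup-embed p i
  lookup-embed (false ∷ p) i       = lookup-embed p i

  Σ-embed : ∀ {n} (p : Subset n) (f : Fin n → ℤ) →
            Σℤ (f ∘ embed p) ≡ Σℤ (λ i → ⟦ lookup p i ⟧ ℤ.* f i)
  Σ-embed [] f = trans (Σ-nil _) (sym (Σ-nil _))
  Σ-embed (true ∷ p) f = begin
    Σℤ (f ∘ embed (true ∷ p))                              ≡⟨ Σ-cons _ ⟩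
    f zero ℤ.+ Σℤ (f ∘ suc ∘ embed p)                      ≡⟨ cong₂ ℤ._+_ (sym (ℤ.*-identityˡ (f zero))) (Σ-embed p (f ∘ suc)) ⟩
    1ℤ ℤ.* f zero ℤ.+ Σℤ (λ i → ⟦ lookup p i ⟧ ℤ.* f (suc i)) ≡⟨ Σ-cons _ ⟨
    Σℤ (λ i → ⟦ lookup (true ∷ p) i ⟧ ℤ.* f i)             ∎
    where open ≡-Reasoning
  Σ-embed (false ∷ p) f = begin
    Σℤ (f ∘ suc ∘ embed p)                                 ≡⟨ Σ-embed p (f ∘ suc) ⟩
    Σℤ (λ i → ⟦ lookup p i ⟧ ℤ.* f (suc i))                ≡⟨ ℤ.+-identityˡ _ ⟨
    0ℤ ℤ.* f zero ℤ.+ Σℤ (λ i → ⟦ lookup p i ⟧ ℤ.* f (suc i)) ≡⟨ Σ-cons _ ⟨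
    Σℤ (λ i → ⟦ lookup (false ∷ p) i ⟧ ℤ.* f i)            ∎
    where open ≡-Reasoning

  fromℚ-mono : ∀ {p q} → p ℚ.≤ q → fromℚ p ≤ᴿ fromℚ q
  fromℚ-mono {p} {q} p≤q = ≼⇒≤ {fromℚ p} {fromℚ q} (subst₂ _≼_ (sym (κ-def p)) (sym (κ-def q)) (κ-mono p≤q))

  module _ {n} (G : Graph n) (I : Subset n) where

    outside : Fin n → Bool
    outside u = not (lookup I u)

    remaining : Fin n → Fin n → Bool
    remaining u v = adj G u v ∧ (outside u ∧ outside v)

    -- The vertices of I are kept, with demand 0 and without cells. The cut criterion then speaks
    -- about all vertices of G, and reindexing by `embed` is confined to the final weights.
    remaining-degree : ℕ → Fin n → ℤ
    remaining-degree a u = ⟦ outside u ⟧ ℤ.* + a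

    module _ (a b : ℕ) (a≤b : a ℕ.≤ b)
             (F : Factor remaining (remaining-degree a) (remaining-degree a)) where

      private
        e : Fin ∣ ∁ I ∣ → Fin n
        e = embed (∁ I)

        e-outside : ∀ u → outside (e u) ≡ true
        e-outside u = trans (sym (lookup-map (e u) not I)) (lookup-embed (∁ I) u)

        twice : Fin n → Fin n → ℤ
        twice u v = ⟦ factor F u v ⟧ ℤ.+ ⟦ factor F v u ⟧

        h : Fin ∣ ∁ I ∣ → Fin ∣ ∁ I ∣ → ℝ
        h u v = fromℚ (½ ℚ.* ι (twice (e u) (e v)))

        within-adj : ∀ {u v} → factor F u v ≡ true → adj G u v ≡ true
        within-adj {u} {v} f with adj G u v | within F u v f
        ... | true | _ = refl

        within-outside : ∀ {u v} → factor F u v ≡ true → outside u ≡ true × outside v ≡ true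
        within-outside {u} {v} f with adj G u v | outside u | outside v | within F u v f
        ... | true | true | true | _ = refl , refl

        supported : ∀ b u v → ⟦ b ⟧ ≡ 0ℤ → (factor F u v ≡ true → b ≡ true) → ⟦ factor F u v ⟧ ≡ 0ℤ
        supported b u v b≡0 f⇒b with factor F u v
        ... | false = refl
        ... | true with refl ← f⇒b refl = b≡0

        drop-outside : ∀ b c → (c ≡ true → b ≡ true) → ⟦ b ⟧ ℤ.* ⟦ c ⟧ ≡ ⟦ c ⟧
        drop-outside true  c     _   = ℤ.*-identityˡ ⟦ c ⟧
        drop-outside false false _   = refl
        drop-outside false true  c⇒b with () ← c⇒b refl

        Σ-outside : ∀ (P : Fin n → Bool) → (∀ u → P u ≡ true → outside u ≡ true) →
                    Σℤ (λ u → ⟦ P (e u) ⟧) ≡ # P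
        Σ-outside P P⊆ = trans (Σ-embed (∁ I) (λ u → ⟦ P u ⟧)) (Σ-cong λ u →
          trans (cong (λ b → ⟦ b ⟧ ℤ.* ⟦ P u ⟧) (lookup-map u not I)) (drop-outside (outside u) (P u) (P⊆ u)))

        Σ-twice : ∀ v → Σℤ (λ u → twice (e v) (e u)) ≡ + a ℤ.+ + a
        Σ-twice v = trans (Σ-distrib-+ _ _) (cong₂ ℤ._+_
          (trans (Σ-outside (factor F (e v)) (λ u f → proj₂ (within-outside f))) (trans (rows F (e v)) at-v))
          (trans (Σ-outside (λ u → factor F u (e v)) (λ u f → proj₁ (within-outside f))) (trans (columns F (e v)) at-v)))
          where
          at-v : remaining-degree a (e v) ≡ + a
          at-v = trans (cong (λ b → ⟦ b ⟧ ℤ.* + a) (e-outside v)) (ℤ.*-identityˡ (+ a))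

        term : ∀ v u → (if adj G (e v) (e u) then h v u else 0ᴿ) ≈ κ ½ ⊠ int (twice (e v) (e u))
        term v u with adj G (e v) (e u) in eq
        ... | true  = ≈-trans (≡⇒≈ (κ-def _)) (≈-sym (κ-⊠ ½ (ι (twice (e v) (e u)))))
        ... | false = ≈-trans (≡⇒≈ (κ-def 0ℚ)) (≈-sym (≈-trans (⊠-cong ≈-refl (≈-trans (≡⇒≈ (cong int (cong₂ ℤ._+_
            (supported (adj G (e v) (e u)) (e v) (e u) (cong ⟦_⟧ eq) within-adj)
            (supported (adj G (e v) (e u)) (e u) (e v) (cong ⟦_⟧ eq) λ f → trans (symm G (e v) (e u)) (within-adj f)))))
            int-0)) (ℝ-Semiring.zeroʳ (κ ½))))

        ½*2a : ½ ℚ.* ι (+ a ℤ.+ + a) ≡ + a ℚ./ 1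
        ½*2a = begin
          ½ ℚ.* ι (+ a ℤ.+ + a)           ≡⟨ cong (½ ℚ.*_) (ι-+ (+ a) (+ a)) ⟩
          ½ ℚ.* (ι (+ a) ℚ.+ ι (+ a))     ≡⟨ ℚ.*-comm ½ (ι (+ a) ℚ.+ ι (+ a)) ⟩
          (ι (+ a) ℚ.+ ι (+ a)) ℚ.* ½     ≡⟨ ℚ.*-distribʳ-+ ½ (ι (+ a)) (ι (+ a)) ⟩
          ι (+ a) ℚ.* ½ ℚ.+ ι (+ a) ℚ.* ½ ≡⟨ half+half (ι (+ a)) ⟩
          ι (+ a)                         ≡⟨ ι-def (+ a) ⟩
          + a ℚ./ 1                       ∎
          where open ≡-Reasoning

        degree≈a : ∀ v → weightedDegree (G -ᴳ I) h v ≈ fromℕ a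
        degree≈a v = begin-equality
          Defs.sum (λ u → if adj G (e v) (e u) then h v u else 0ᴿ)
            ≈⟨ ≡⇒≈ (Σᴿ-def (λ u → if adj G (e v) (e u) then h v u else 0ᴿ)) ⟩
          Σᴿ (λ u → if adj G (e v) (e u) then h v u else 0ᴿ)
            ≈⟨ Σᴿ-cong (term v) ⟩
          Σᴿ (λ u → κ ½ ⊠ int (twice (e v) (e u)))
            ≈⟨ Σᴿ-distribˡ-⊠ (κ ½) (λ u → int (twice (e v) (e u))) ⟨
          κ ½ ⊠ Σᴿ (λ u → int (twice (e v) (e u)))
            ≈⟨ ⊠-cong ≈-refl (Σᴿ-int (λ u → twice (e v) (e u))) ⟩
          κ ½ ⊠ int (Σℤ (λ u → twice (e v) (e u)))
            ≈⟨ ⊠-cong ≈-refl (≡⇒≈ (cong int (Σ-twice v))) ⟩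
          κ ½ ⊠ int (+ a ℤ.+ + a)
            ≈⟨ κ-⊠ ½ (ι (+ a ℤ.+ + a)) ⟩
          κ (½ ℚ.* ι (+ a ℤ.+ + a))
            ≈⟨ ≡⇒≈ (trans (cong κ ½*2a) (sym (κ-def (+ a ℚ./ 1)))) ⟩
          fromℕ a ∎
          where open ≼-Reasoning

        0≤twice : ∀ u v → 0ℤ ℤ.≤ twice u v
        0≤twice u v = ⟦⟧≥0 (factor F u v) ⊕ ⟦⟧≥0 (factor F v u)

        twice≤2 : ∀ u v → twice u v ℤ.≤ 1ℤ ℤ.+ 1ℤ
        twice≤2 u v = ℤ.+-mono-≤ (⟦⟧≤1 (factor F u v)) (⟦⟧≤1 (factor F v u))

      -- Symmetrising the 0/1 matrix gives the weights.
      half-integral-factor : HasFractionalFactor (G -ᴳ I) a b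
      half-integral-factor = h
        , (λ u v _ → ≈⇒≃ {h u v} {h v u} (≡⇒≈ (cong (λ i → fromℚ (½ ℚ.* ι i))
            (ℤ.+-comm ⟦ factor F (e u) (e v) ⟧ ⟦ factor F (e v) (e u) ⟧))))
        , (λ u v _ → fromℚ-mono (ℚ.nonNegative⁻¹ ½ ⊛ℚ subst (ℚ._≤ ι (twice (e u) (e v))) ι-0 (ι-mono (0≤twice (e u) (e v))))
                   , fromℚ-mono (subst (½ ℚ.* ι (twice (e u) (e v)) ℚ.≤_) ½*2
                       (ℚ.*-monoˡ-≤-nonNeg ½ (ι-mono (twice≤2 (e u) (e v))))))
        , λ v → ≼⇒≤ {fromℕ a} {weightedDegree (G -ᴳ I) h v} (≼-reflexive (≈-sym (degree≈a v)))
              , ≼⇒≤ {weightedDegree (G -ᴳ I) h v} {fromℕ b} (≼-trans (≼-reflexive (degree≈a v))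
                  (≤⇒≼ {fromℕ a} {fromℕ b} (fromℚ-mono (subst₂ ℚ._≤_ (ι-def (+ a)) (ι-def (+ b)) (ι-mono (ℤ.+≤+ a≤b))))))
        where
        ½*2 : ½ ℚ.* ι (1ℤ ℤ.+ 1ℤ) ≡ 1ℚ
        ½*2 = cong (½ ℚ.*_) (ι-def (1ℤ ℤ.+ 1ℤ))

-- From a violated cut to a contradiction with λ(G) ≥ λ(H).

open import Defs
open import Data.Nat.Base using (ℕ; _+_; _*_; _∸_; _^_; _≤_; _≥_; _⊔_)
open import Relation.Nullary using (¬_)

open IntegerSums using (Σ-cong; Σ-nil; Σ-cons; Σ-const; Σ-distrib--; Σ-distribˡ-*; Σ-nonneg; Σ-≡⇒≗; term≤Σ; #; ∃-of-#>0; ⟦_⟧; ⟦⟧≥0; ⟦∧⟧; ⟦not⟧; ≤-by; diff; nat; square; _⊕_; _⊛_)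
open BipartiteFactors using (cells; demand; capacity; Violated; factor-or-violation)
open Reals using (≼-trans; ⊠-monoˡ; ⊠-monoʳ; _≼_; ≤⇒≼)
open Spectral using (Modulus; int-mono; eigenvalue⇒modulus; row-sum-bound)
open ExtremalEigenvector using (PerronPair; perron-pair; square-lower-bound)
open Labellings using (joined; perron-pair-eigenvalue; sublabelling-impossible)
open Counting
open LowDegree using (#-mono; low-degree-label)
open FractionalFactors using (remaining; remaining-degree; half-integral-factor)
open import Data.Bool.Base using (Bool; true; false; _∧_; not)
open import Data.Bool.Properties using (∧-comm; ∧-zeroʳ)
open import Data.Empty using (⊥-elim)
open import Data.Fin.Base using (Fin; suc)
open import Data.Fin.Subset using (Subset; ∣_∣)
open import Data.Integer.Base as ℤ using (ℤ; +_; 0ℤ; 1ℤ)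
import Data.Integer.Properties as ℤ
open import Data.Integer.Tactic.RingSolver using (solve-∀)
open import Data.Nat.Base using (suc; s≤s; z≤n)
import Data.Nat.Properties as ℕ
import Data.Nat.Tactic.RingSolver as ℕ-Ring
open import Data.Product.Base using (∃; _,_; _×_; proj₁; proj₂)
open import Data.Sum.Base using (inj₁; inj₂; [_,_]′)
open import Data.Vec.Base using (_∷_; []; lookup)
open import Data.Vec.Properties using (lookup⇒[]=)
open import Function.Base using (_∘_)
open import Relation.Binary.PropositionalEquality hiding (J)
open import Relation.Nullary using (yes; no)

#-lookup : ∀ {n} (p : Subset n) → # (lookup p) ≡ + ∣ p ∣
#-lookup []          = Σ-nil _
#-lookup (true  ∷ p) = trans (Σ-cons _) (cong (λ s → 1ℤ ℤ.+ s) (#-lookup p))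
#-lookup (false ∷ p) = trans (Σ-cons _) (trans (ℤ.+-identityˡ _) (#-lookup p))

#-not : ∀ {n} (P : Fin n → Bool) → # (not ∘ P) ≡ + n ℤ.- # P
#-not {n} P = trans (Σ-cong λ u → ⟦not⟧ (P u)) (trans (Σ-distrib-- (λ _ → 1ℤ) (λ u → ⟦ P u ⟧))
  (cong (ℤ._- # P) (trans (Σ-const n 1ℤ) (ℤ.*-identityʳ (+ n)))))

module _ {n} (G : Graph n) (connected : Connected G) {r′ a′ c′ : ℕ}
         (order : + n ≡ + suc r′ ℤ.+ + a′ ℤ.+ + suc c′ ℤ.+ 1ℤ) (2≤n : 2 ≤ n)
         (large : Large (+ n) (+ suc r′) (+ suc a′))
         {ρG : ℝ} (Z : Modulus (adj G) ρG)
         (P : PerronPair r′ a′ c′) (ρ≼ρG : PerronPair.ρ P ≼ ρG)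
         (G≇H : ¬ (G ≅ joined (suc r′) a′ (suc c′))) where

  private
    r a : ℤ
    r = + suc r′
    a = + suc a′

  -- The excluded bound is 2e(G) - n + 2 ≤ (n - r - 2)(n - 3) + r(n - r - 1), solved for 2e(G). Its
  -- left side exceeds the row sum bound of `two-step-bound` by 1, the gap that `row-sum-bound` asks
  -- for.
  many-edges : ¬ (degree-sum G ℤ.≤ + n ℤ.* + n ℤ.- + 4 ℤ.* + n ℤ.- r ℤ.* r ℤ.+ (r ℤ.+ r) ℤ.+ + 4)
  many-edges few = row-sum-bound (adj G) (symm G) (degree-sum G ℤ.- + n ℤ.+ 1ℤ)
    (two-step-bound G (connected⇒degree≥1 G 2≤n connected)) ρG 0≼ρG Z
    (≼-trans (int-mono (≤-by _ (diff few) gap))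
      (≼-trans ρ²-large (≼-trans (⊠-monoʳ 0≼ρ ρ≼ρG) (⊠-monoˡ 0≼ρG ρ≼ρG))))
    where
    open PerronPair P
    0≼ρG = ≼-trans 0≼ρ ρ≼ρG
    expand : ∀ r a c s → let r₁ = 1ℤ ℤ.+ r ; n = r₁ ℤ.+ a ℤ.+ (1ℤ ℤ.+ c) ℤ.+ 1ℤ in
      (a ℤ.+ c) ℤ.* (r ℤ.+ a ℤ.+ c) ℤ.+ (1ℤ ℤ.+ r) ℤ.* (a ℤ.+ c ℤ.+ 1ℤ) ℤ.- (s ℤ.- n ℤ.+ 1ℤ ℤ.+ 1ℤ) ≡
      n ℤ.* n ℤ.- + 4 ℤ.* n ℤ.- r₁ ℤ.* r₁ ℤ.+ (r₁ ℤ.+ r₁) ℤ.+ + 4 ℤ.- s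
    expand = solve-∀
    gap : square-lower-bound (+ r′) (+ a′) (+ c′) ℤ.- (degree-sum G ℤ.- + n ℤ.+ 1ℤ ℤ.+ 1ℤ) ≡
          + n ℤ.* + n ℤ.- + 4 ℤ.* + n ℤ.- r ℤ.* r ℤ.+ (r ℤ.+ r) ℤ.+ + 4 ℤ.- degree-sum G
    gap = subst (λ m → square-lower-bound (+ r′) (+ a′) (+ c′) ℤ.- (degree-sum G ℤ.- m ℤ.+ 1ℤ ℤ.+ 1ℤ) ≡
                       m ℤ.* m ℤ.- + 4 ℤ.* m ℤ.- r ℤ.* r ℤ.+ (r ℤ.+ r) ℤ.+ + 4 ℤ.- degree-sum G)
                (sym order) (expand (+ r′) (+ a′) (+ c′) (degree-sum G))

  module _ (J : Fin n → Bool) (independent : ∀ u v → J u ≡ true → J v ≡ true → ¬ Adjacent G u v)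
           (#J : # J ≡ r) where

    no-low-degree : ∀ v → J v ≡ false → ¬ (# (λ w → adj G v w ∧ not (J w)) ℤ.≤ + a′)
    no-low-degree v v∉J low with ℓ , ℓ-size , ℓ-link ← low-degree-label G J v r′ a′ c′ independent #J v∉J low order
      = sublabelling-impossible G ℓ P connected ℓ-size ℓ-link ρ≼ρG Z G≇H

    module _ (X₀ Y₀ : Fin n → Bool) where

      private
        X Y K : Fin n → Bool
        X u = X₀ u ∧ not (J u)
        Y u = Y₀ u ∧ not (J u)
        K u = X u ∧ Y u
        e d : ℤ
        e = cells (adj G) X Y
        d = # X ℤ.+ # Y ℤ.- (+ n ℤ.- r)

        ∧-right : ∀ b {c} → b ∧ c ≡ true → c ≡ true
        ∧-right true eq = eq

        ∧-left : ∀ b {c} → b ∧ c ≡ true → b ≡ true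
        ∧-left true _ = refl

        ⟦⟧-injective : ∀ {b c} → ⟦ b ⟧ ≡ ⟦ c ⟧ → b ≡ c
        ⟦⟧-injective {true}  {true}  _ = refl
        ⟦⟧-injective {false} {false} _ = refl

        ⟦∧⟧≤ : ∀ b c → ⟦ b ∧ c ⟧ ℤ.≤ ⟦ c ⟧
        ⟦∧⟧≤ true  c = ℤ.≤-refl
        ⟦∧⟧≤ false c = ⟦⟧≥0 c

        #Y≤ : # Y ℤ.≤ + n ℤ.- r
        #Y≤ = subst (# Y ℤ.≤_) (trans (#-not J) (cong (λ j → + n ℤ.- j) #J)) (#-mono (λ u → ∧-right (Y₀ u)))

        0≤e : 0ℤ ℤ.≤ e
        0≤e = Σ-nonneg λ u → Σ-nonneg λ v → ⟦⟧≥0 (adj G u v ∧ X u ∧ Y v)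

        impossible-surplus : ∀ e a d → 0ℤ ℤ.≤ e → 0ℤ ℤ.≤ a → d ℤ.≤ 0ℤ → ¬ (e ℤ.+ 1ℤ ℤ.≤ a ℤ.* d)
        impossible-surplus e a d 0≤e 0≤a d≤0 sparse =
          0≰-1 (subst (0ℤ ℤ.≤_) (cancel e a d) (0≤e ⊕ diff sparse ⊕ 0≤a ⊛ diff d≤0))
          where
          0≰-1 : ¬ (0ℤ ℤ.≤ ℤ.-1ℤ)
          0≰-1 ()
          cancel : ∀ e a d → e ℤ.+ (a ℤ.* d ℤ.- (e ℤ.+ 1ℤ)) ℤ.+ a ℤ.* (0ℤ ℤ.- d) ≡ ℤ.-1ℤ
          cancel = solve-∀

        positive-surplus : e ℤ.+ 1ℤ ℤ.≤ a ℤ.* d → 1ℤ ℤ.≤ d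
        positive-surplus sparse with 1ℤ ℤ.≤? d
        ... | yes 1≤d = 1≤d
        ... | no d<1  = ⊥-elim (impossible-surplus e a d 0≤e (nat (suc a′)) (ℤ.i<j⇒i≤pred[j] (ℤ.≰⇒> d<1)) sparse)

        -- A surplus d ≥ 1 together with |Y| ≤ n - r leaves only |X| = 1 and Y the whole complement
        -- of J, so d = 1. Then e counts the neighbours of the single vertex of X outside J, and
        -- there are at most a - 1 of them.
        single-row : # X ℤ.≤ 1ℤ → ¬ (e ℤ.+ 1ℤ ℤ.≤ a ℤ.* d)
        single-row X≤1 sparse = no-low-degree v (not-true (∧-right (X₀ v) Xv))
          (≤-by _ (diff row≤e ⊕ diff sparse ⊕ (nat (suc a′) ⊛ (diff X≤1 ⊕ diff #Y≤)))
            (budget (+ a′) (# (λ w → adj G v w ∧ not (J w))) e (# X) (# Y) (+ n ℤ.- r)))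
          where
          size-X : ∀ x y m → x ℤ.- 1ℤ ≡ x ℤ.+ y ℤ.- m ℤ.- 1ℤ ℤ.+ (m ℤ.- y)
          size-X = solve-∀
          row : ∃ λ v → X v ≡ true
          row = ∃-of-#>0 X (ℤ.suc[i]≤j⇒i<j
            (≤-by _ (diff (positive-surplus sparse) ⊕ diff #Y≤) (size-X (# X) (# Y) (+ n ℤ.- r))))
          v = proj₁ row
          Xv = proj₂ row
          not-true : ∀ {b} → not b ≡ true → b ≡ false
          not-true {false} _ = refl
          budget : ∀ a′ s e x y m → a′ ℤ.- s ≡
            e ℤ.- s ℤ.+ ((1ℤ ℤ.+ a′) ℤ.* (x ℤ.+ y ℤ.- m) ℤ.- (e ℤ.+ 1ℤ)) ℤ.+ (1ℤ ℤ.+ a′) ℤ.* (1ℤ ℤ.- x ℤ.+ (m ℤ.- y))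
          budget = solve-∀
          size-Y : ∀ x y m → y ℤ.- m ≡ x ℤ.+ y ℤ.- m ℤ.- 1ℤ ℤ.+ (1ℤ ℤ.- x)
          size-Y = solve-∀
          not-J≤Y : # (not ∘ J) ℤ.≤ # Y
          not-J≤Y = subst (ℤ._≤ # Y) (sym (trans (#-not J) (cong (λ j → + n ℤ.- j) #J)))
            (≤-by _ (diff (positive-surplus sparse) ⊕ diff X≤1) (size-Y (# X) (# Y) (+ n ℤ.- r)))
          Y≡not-J : ∀ w → Y w ≡ not (J w)
          Y≡not-J w = ⟦⟧-injective (Σ-≡⇒≗ (λ w → ⟦∧⟧≤ (Y₀ w) (not (J w))) not-J≤Y w)
          row≤e : # (λ w → adj G v w ∧ not (J w)) ℤ.≤ e
          row≤e = subst (ℤ._≤ e)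
            (Σ-cong λ w → cong (λ b → ⟦ adj G v w ∧ b ⟧) (cong₂ _∧_ Xv (Y≡not-J w)))
            (term≤Σ (λ u → Σ-nonneg λ w → ⟦⟧≥0 (adj G u w ∧ X u ∧ Y w)) v)

      sparse-pair-impossible : # X ℤ.≤ # Y → ¬ (e ℤ.+ 1ℤ ℤ.≤ a ℤ.* d)
      sparse-pair-impossible X≤Y sparse with + 2 ℤ.≤? # X
      ... | no X<2 = single-row (ℤ.i<j⇒i≤pred[j] (ℤ.≰⇒> X<2)) sparse
      ... | yes 2≤X = many-edges (few-edges {x = # X} {y = # Y} {k = # K} {d = d} {r = r} {a = a}
              {e = e} {n = + n} {s = degree-sum G}
              (ℤ.+≤+ (s≤s z≤n)) (ℤ.+≤+ (s≤s z≤n)) 2≤X X≤Y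
              (Σ-nonneg λ u → ⟦⟧≥0 (K u)) (#-mono (λ u → ∧-left (X u))) #Y≤
              (positive-surplus sparse) refl sparse large
              (subst (λ j → degree-sum G ℤ.+ j ℤ.* j ℤ.+ # X ℤ.* # Y ℤ.+ # Y ℤ.* # X ℤ.+ (+ n ℤ.- j ℤ.- # K) ℤ.≤
                            + n ℤ.* + n ℤ.+ e ℤ.+ e ℤ.+ # K ℤ.* # K) #J
                (missing-edges G J X₀ Y₀ independent)))

    no-sparse-pair : ∀ X₀ Y₀ → let X = λ u → X₀ u ∧ not (J u) ; Y = λ u → Y₀ u ∧ not (J u) in
      ¬ (cells (adj G) X Y ℤ.+ 1ℤ ℤ.≤ a ℤ.* (# X ℤ.+ # Y ℤ.- (+ n ℤ.- r)))
    no-sparse-pair X₀ Y₀ sparse with ℤ.≤-total (# (λ u → X₀ u ∧ not (J u))) (# (λ u → Y₀ u ∧ not (J u)))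
    ... | inj₁ X≤Y = sparse-pair-impossible X₀ Y₀ X≤Y sparse
    ... | inj₂ Y≤X = sparse-pair-impossible Y₀ X₀ Y≤X (subst₂ (λ e s → e ℤ.+ 1ℤ ℤ.≤ a ℤ.* (s ℤ.- (+ n ℤ.- r)))
      (cells-symmetric G (λ u → X₀ u ∧ not (J u)) (λ u → Y₀ u ∧ not (J u)))
      (ℤ.+-comm (# (λ u → X₀ u ∧ not (J u))) (# (λ u → Y₀ u ∧ not (J u)))) sparse)

module _ {n} (G : Graph n) (I : Subset n) (a : ℕ) (X Y : Fin n → Bool) where

  private
    J : Fin n → Bool
    J = lookup I
    X′ Y′ : Fin n → Bool
    X′ u = X u ∧ not (J u)
    Y′ u = Y u ∧ not (J u)

  demand-outside : ∀ (P : Fin n → Bool) → demand (remaining-degree G I a) P ≡ + a ℤ.* # (λ u → P u ∧ not (J u))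
  demand-outside P = trans (Σ-cong λ u → trans (reorder ⟦ P u ⟧ ⟦ not (J u) ⟧ (+ a)) (cong (λ s → + a ℤ.* s) (sym (⟦∧⟧ (P u) (not (J u))))))
    (sym (Σ-distribˡ-* (+ a) (λ u → ⟦ P u ∧ not (J u) ⟧)))
    where
    reorder : ∀ p j a → p ℤ.* (j ℤ.* a) ≡ a ℤ.* (p ℤ.* j)
    reorder = solve-∀

  -- Only the parts of X and Y outside I carry demand or cells. The columns outside Y contribute
  -- a(|G - I| - |Y′|) to the capacity, and moving this to the other side gives the form symmetric
  -- in X′ and Y′.
  violation⇒sparse : capacity (remaining G I) (remaining-degree G I a) X Y ℤ.< demand (remaining-degree G I a) X →
    cells (adj G) X′ Y′ ℤ.+ 1ℤ ℤ.≤ + a ℤ.* (# X′ ℤ.+ # Y′ ℤ.- (+ n ℤ.- # J))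
  violation⇒sparse viol = ≤-by _ (diff (ℤ.i<j⇒suc[i]≤j viol)) (sym (trans
    (cong₂ (λ x c → x ℤ.- (1ℤ ℤ.+ c)) (demand-outside X) (cong₂ ℤ._+_ cells-outside (trans (demand-outside (not ∘ Y)) (cong (λ s → + a ℤ.* s) #notY))))
    (regroup (+ a) (# X′) (# Y′) (+ n) (# J) (cells (adj G) X′ Y′))))
    where
    regroup : ∀ a x y n j e → a ℤ.* x ℤ.- (1ℤ ℤ.+ (e ℤ.+ a ℤ.* (n ℤ.- j ℤ.- y))) ≡
      a ℤ.* (x ℤ.+ y ℤ.- (n ℤ.- j)) ℤ.- (e ℤ.+ 1ℤ)
    regroup = solve-∀
    move : ∀ b x j y k → (b ∧ (not j ∧ not k)) ∧ x ∧ y ≡ b ∧ (x ∧ not j) ∧ (y ∧ not k)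
    move false _     _     _ _ = refl
    move true  false false y k = ∧-zeroʳ (not k)
    move true  false true  _ _ = refl
    move true  true  false y k = ∧-comm (not k) y
    move true  true  true  _ _ = refl
    cells-outside : cells (remaining G I) X Y ≡ cells (adj G) X′ Y′
    cells-outside = Σ-cong λ u → Σ-cong λ v → cong ⟦_⟧ (move (adj G u v) (X u) (J u) (Y v) (J v))
    split : ∀ y j → ⟦ not y ∧ not j ⟧ ≡ ⟦ not j ⟧ ℤ.- ⟦ y ∧ not j ⟧
    split true  true  = refl
    split true  false = refl
    split false true  = refl
    split false false = refl
    #notY : # (λ u → not (Y u) ∧ not (J u)) ≡ + n ℤ.- # J ℤ.- # Y′
    #notY = trans (Σ-cong λ u → split (Y u) (J u)) (trans (Σ-distrib-- (λ u → ⟦ not (J u) ⟧) (λ u → ⟦ Y u ∧ not (J u) ⟧))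
      (cong (ℤ._- # Y′) (#-not J)))

-- The order bound increases with b, so b is lowered to 2r + 2, where b - r becomes r + 2.
large-order : ∀ a b r n → b ≥ a ⊔ (2 * r + 2) →
              n ≥ (r + 1) * (b ∸ r) + 2 * a ^ 2 + 2 * a * (r + 2) ∸ 1 → Large (+ n) (+ r) (+ a)
large-order a b r n b≥ n≥ = ≤-by _ (diff (subst (ℤ._≤ + n) to-ℤ (ℤ.+≤+ bound)))
  (regroup (+ n) (+ r) (N₀ (+ r ℤ.* + r) (+ a ℤ.* + a) (+ a ℤ.* + r)))
  where
  N₀ : ℤ → ℤ → ℤ → ℤ
  N₀ rr aa ar = rr ℤ.+ + r ℤ.+ + r ℤ.+ 1ℤ ℤ.+ (aa ℤ.+ aa) ℤ.+ (ar ℤ.+ ar) ℤ.+ (+ a ℤ.+ + a ℤ.+ + a ℤ.+ + a)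
  regroup : ∀ n r N → n ℤ.- r ℤ.- N ≡ n ℤ.- (N ℤ.+ r)
  regroup = solve-∀
  poly : ℕ
  poly = r * r + r + r + 1 + (a * a + a * a) + (a * r + a * r) + (a + a + a + a) + r
  to-ℤ : + poly ≡ N₀ (+ r ℤ.* + r) (+ a ℤ.* + a) (+ a ℤ.* + r) ℤ.+ + r
  to-ℤ = cong (ℤ._+ + r) (trans (cong₂ (λ rr aa → N₀ rr aa (+ (a * r))) (ℤ.pos-* r r) (ℤ.pos-* a a))
    (cong (N₀ (+ r ℤ.* + r) (+ a ℤ.* + a)) (ℤ.pos-* a r)))
  b∸r≥ : r + 2 ≤ b ∸ r
  b∸r≥ = subst (_≤ b ∸ r) (trans (cong (_∸ r) (shape r)) (ℕ.m+n∸n≡m (r + 2) r))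
    (ℕ.∸-monoˡ-≤ r (ℕ.m⊔n≤o⇒n≤o a (2 * r + 2) b≥))
    where
    shape : ∀ r → 2 * r + 2 ≡ r + 2 + r
    shape = ℕ-Ring.solve-∀
  bound : poly ≤ n
  -- Adding 1 to both sides undoes the truncated subtraction of 1 in the hypothesis.
  bound = ℕ.+-cancelˡ-≤ 1 poly n (ℕ.≤-trans (ℕ.≤-trans (ℕ.≤-reflexive (shape a r))
      (ℕ.+-monoˡ-≤ (2 * a * (r + 2)) (ℕ.+-monoˡ-≤ (2 * (a * (a * 1))) (ℕ.*-monoʳ-≤ (r + 1) b∸r≥))))
    (ℕ.≤-trans (ℕ.m≤n+m∸n _ 1) (ℕ.+-monoʳ-≤ 1 n≥)))
    where
    shape : ∀ a r → 1 + (r * r + r + r + 1 + (a * a + a * a) + (a * r + a * r) + (a + a + a + a) + r) ≡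
      (r + 1) * (r + 2) + 2 * (a * (a * 1)) + 2 * a * (r + 2)
    shape = ℕ-Ring.solve-∀

-- Makes the truncated difference in `extremal` exact, and gives a clique of at least two vertices,
-- the condition C ≥ 1 used by `1≤weight`.
clique-size : ∀ {a′ r′ n} → suc r′ + suc a′ + 2 ≤ n →
              ∃ λ c′ → 1 ≤ c′ × n ∸ suc a′ ∸ suc r′ ≡ suc c′ × n ≡ suc r′ + a′ + suc c′ + 1
clique-size {a′} {r′} {n} small with k , refl ← ℕ.m≤n⇒∃[o]m+o≡n small = suc k , s≤s z≤n
  , trans (ℕ.∸-+-assoc (suc r′ + suc a′ + 2 + k) (suc a′) (suc r′))
      (trans (cong (_∸ (suc a′ + suc r′)) (shape a′ r′ k)) (ℕ.m+n∸m≡n (suc a′ + suc r′) (suc (suc k))))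
  , shape′ a′ r′ k
  where
  shape : ∀ a r k → suc r + suc a + 2 + k ≡ suc a + suc r + suc (suc k)
  shape = ℕ-Ring.solve-∀
  shape′ : ∀ a r k → suc r + suc a + 2 + k ≡ suc r + a + suc (suc k) + 1
  shape′ = ℕ-Ring.solve-∀

large⇒order : ∀ {n r a} → 1 ≤ r → 1 ≤ a → Large (+ n) (+ r) (+ a) → r + a + 2 ≤ n
large⇒order {n} {r} {a} 1≤r 1≤a large = ℤ.drop‿+≤+ (≤-by _
  (diff large ⊕ (square (+ r) ⊕ (diff (ℤ.+≤+ 1≤r) ⊕ nat r) ⊕ (square (+ a) ⊕ square (+ a)) ⊕
    (nat a ⊛ nat r ⊕ nat a ⊛ nat r) ⊕ (nat a ⊕ nat a ⊕ nat a)))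
  (regroup (+ n) (+ r) (+ a)))
  where
  regroup : ∀ n r a → n ℤ.- (r ℤ.+ a ℤ.+ + 2) ≡
    n ℤ.- r ℤ.- (r ℤ.* r ℤ.+ r ℤ.+ r ℤ.+ 1ℤ ℤ.+ (a ℤ.* a ℤ.+ a ℤ.* a) ℤ.+ (a ℤ.* r ℤ.+ a ℤ.* r) ℤ.+ (a ℤ.+ a ℤ.+ a ℤ.+ a)) ℤ.+
    (r ℤ.* r ℤ.+ (r ℤ.- 1ℤ ℤ.+ r) ℤ.+ (a ℤ.* a ℤ.+ a ℤ.* a) ℤ.+ (a ℤ.* r ℤ.+ a ℤ.* r) ℤ.+ (a ℤ.+ a ℤ.+ a))
  regroup = solve-∀

-- This is (r - 1)² ≤ n - 2, the condition under which the bisection may start at n - 3.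
large⇒r′² : ∀ {n r′ a′ c′} → n ≡ suc r′ + a′ + suc c′ + 1 → Large (+ n) (+ suc r′) (+ suc a′) →
            r′ * r′ ≤ r′ + a′ + c′ + 1
large⇒r′² {n} {r′} {a′} {c′} n≡ large = ℤ.drop‿+≤+ (subst (ℤ._≤ + (r′ + a′ + c′ + 1)) (sym (ℤ.pos-* r′ r′))
  (≤-by _
    (diff large ⊕ (nat 5 ⊛ nat r′ ⊕ (square a ⊕ square a) ⊕ (nat (suc a′) ⊛ nat (suc r′) ⊕ nat (suc a′) ⊛ nat (suc r′)) ⊕ nat 4 ⊛ nat (suc a′) ⊕ nat 3))
    (subst (λ m → + r′ ℤ.+ + a′ ℤ.+ + c′ ℤ.+ 1ℤ ℤ.- + r′ ℤ.* + r′ ≡ m ℤ.- r ℤ.- N₀ ℤ.+ rest) (cong +_ (sym n≡))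
      (regroup (+ r′) (+ a′) (+ c′)))))
  where
  r = + suc r′
  a = + suc a′
  N₀ = r ℤ.* r ℤ.+ r ℤ.+ r ℤ.+ 1ℤ ℤ.+ (a ℤ.* a ℤ.+ a ℤ.* a) ℤ.+ (a ℤ.* r ℤ.+ a ℤ.* r) ℤ.+ (a ℤ.+ a ℤ.+ a ℤ.+ a)
  rest = + 5 ℤ.* + r′ ℤ.+ (a ℤ.* a ℤ.+ a ℤ.* a) ℤ.+ (a ℤ.* r ℤ.+ a ℤ.* r) ℤ.+ + 4 ℤ.* a ℤ.+ + 3
  regroup : ∀ r′ a′ c′ → let r = 1ℤ ℤ.+ r′ ; a = 1ℤ ℤ.+ a′ in
    r′ ℤ.+ a′ ℤ.+ c′ ℤ.+ 1ℤ ℤ.- r′ ℤ.* r′ ≡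
    r ℤ.+ a′ ℤ.+ (1ℤ ℤ.+ c′) ℤ.+ 1ℤ ℤ.- r ℤ.-
    (r ℤ.* r ℤ.+ r ℤ.+ r ℤ.+ 1ℤ ℤ.+ (a ℤ.* a ℤ.+ a ℤ.* a) ℤ.+ (a ℤ.* r ℤ.+ a ℤ.* r) ℤ.+ (a ℤ.+ a ℤ.+ a ℤ.+ a)) ℤ.+
    (+ 5 ℤ.* r′ ℤ.+ (a ℤ.* a ℤ.+ a ℤ.* a) ℤ.+ (a ℤ.* r ℤ.+ a ℤ.* r) ℤ.+ + 4 ℤ.* a ℤ.+ + 3)
  regroup = solve-∀

module _ {n} (G : Graph n) (connected : Connected G) {a′ r′ c′ : ℕ} (1≤c′ : 1 ≤ c′)
         (order : n ≡ suc r′ + a′ + suc c′ + 1)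
         (large : Large (+ n) (+ suc r′) (+ suc a′)) where

  -- The order of `extremal` contains truncated differences that reduce only after the value of n -
  -- a - r is known. Its parts are therefore variables with equations, and matching these with
  -- `refl` identifies H with `joined` without transporting graphs.
  violation-impossible : ∀ a₁ c (H : Graph (suc r′ + (a₁ + (c + 1)))) →
    a₁ ≡ a′ → c ≡ suc c′ → H ≡ joined (suc r′) a₁ c →
    ∀ ρG ρH → IsEigenvalue (adjacencyMatrix G) ρG →
    (∀ μ → IsEigenvalue (adjacencyMatrix H) μ → μ ≤ᴿ ρH) → ρH ≤ᴿ ρG →
    ¬ (G ≅ H) → ∀ I → Independent G I → ∣ I ∣ ≡ suc r′ →
    ¬ Violated (remaining G I) (remaining-degree G I (suc a′)) (remaining-degree G I (suc a′))
  violation-impossible a₁ c H refl refl refl ρG ρH ρG-eigen ρH-max ρH≤ρG G≇H I independent ∣I∣≡r (X , Y , violated) =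
    no-sparse-pair G connected (cong +_ order)
      (ℕ.≤-trans (ℕ.m≤n+m 2 (suc r′ + suc a′)) (large⇒order (s≤s z≤n) (s≤s z≤n) large)) large
      (eigenvalue⇒modulus G ρG ρG-eigen) P
      (≼-trans (≤⇒≼ {PerronPair.ρ P} {ρH} (ρH-max (PerronPair.ρ P) (perron-pair-eigenvalue P)))
        (≤⇒≼ {ρH} {ρG} ρH≤ρG))
      G≇H (lookup I)
      (λ u v u∈I v∈I → independent u v (lookup⇒[]= u I u∈I) (lookup⇒[]= v I v∈I)) #I X Y
      (subst (λ j → cells (adj G) X′ Y′ ℤ.+ 1ℤ ℤ.≤ + suc a′ ℤ.* (# X′ ℤ.+ # Y′ ℤ.- (+ n ℤ.- j)))
        #I (violation⇒sparse G I (suc a′) X Y violated))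
    where
    P : PerronPair r′ a′ c′
    P = perron-pair r′ a′ c′ 1≤c′ (large⇒r′² order large)
    X′ Y′ : Fin n → Bool
    X′ u = X u ∧ not (lookup I u)
    Y′ u = Y u ∧ not (lookup I u)
    #I : # (lookup I) ≡ + suc r′
    #I = trans (#-lookup I) (cong +_ ∣I∣≡r)

theorem1p7 : (a b r n : ℕ) → a ≥ 1 → r ≥ 1 → b ≥ a ⊔ (2 * r + 2) →
    (G : Graph n) → Connected G →
    n ≥ (r + 1) * (b ∸ r) + 2 * a ^ 2 + 2 * a * (r + 2) ∸ 1 →
    (ρG ρH : ℝ) → IsSpectralRadius G ρG → IsSpectralRadius (extremal n a r) ρH →
    ρH ≤ᴿ ρG →
    ¬ (G ≅ extremal n a r) →
    IsFractionalIDFactorCritical G r a b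
theorem1p7 (suc a′) b (suc r′) n 1≤a 1≤r b≥ G connected n≥ ρG ρH (ρG-eigen , _) (_ , ρH-max)
           ρH≤ρG G≇H I independent ∣I∣≡r =
  conclude (clique-size (large⇒order 1≤r 1≤a large))
  where
  large : Large (+ n) (+ suc r′) (+ suc a′)
  large = large-order (suc a′) b (suc r′) n b≥ n≥
  conclude : (∃ λ c′ → 1 ≤ c′ × n ∸ suc a′ ∸ suc r′ ≡ suc c′ × n ≡ suc r′ + a′ + suc c′ + 1) →
             HasFractionalFactor (G -ᴳ I) (suc a′) b
  conclude (c′ , 1≤c′ , c≡ , order) =
    [ half-integral-factor G I (suc a′) b (ℕ.m⊔n≤o⇒m≤o (suc a′) (2 * suc r′ + 2) b≥)
    , (λ violated → ⊥-elim (violation-impossible G connected 1≤c′ order large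
        (suc a′ ∸ 1) (n ∸ suc a′ ∸ suc r′) (extremal n (suc a′) (suc r′)) refl c≡ refl
        ρG ρH ρG-eigen ρH-max ρH≤ρG G≇H I independent ∣I∣≡r violated))
    ]′ (factor-or-violation (remaining G I) (remaining-degree G I (suc a′)) (remaining-degree G I (suc a′)) refl)
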